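{- Let $G$ be a connected graph of maximal degree at most $3$ which is isomorphic neither to $K_4$ nor to the graph $T$. Then each connected component of the neighborhood complex $\mathcal{N}(G)$ is either contractible or homotopy equivalent to a wedge sum of circles.
   Context: All graphs are finite and simple (no loops). The maximal degree of a graph is the maximum of the degrees of its vertices. $K_4$ is the complete graph on $4$ vertices. $T$ is the graph with vertex set $\{1,2,\dots,8\}$ and edge set $\{12, 13, 14, 27, 28, 47, 45, 35, 38, 56, 67, 68\}$ (where $ij$ denotes the edge $\{i,j\}$). The neighborhood complex $\mathcal{N}(G)$ of a graph $G$ is the (abstract) simplicial complex whose vertices are all non-isolated vertices of $G$ and whose simplices are those subsets of $V(G)$ which have a common neighbor in $G$. Topological statements about a simplicial complex refer to its geometric realization. -}

module Defs where

open import Level using (0ℓ)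
open import Algebra.Bundles using (CommutativeRing)
import Algebra.Properties.Monoid.Sum as Sum
open import Data.Fin.Base using (Fin; zero; suc; toℕ)
open import Data.Fin.Patterns using (0F; 1F)
import Data.Fin.Properties as Fin
open import Data.Fin.Subset using (Subset; _∈_; _∉_; _⊆_; ⁅_⁆; ∣_∣; Nonempty)
open import Data.Fin.Subset.Properties using (x∈⁅y⁆⇒x≡y; x∈⁅x⁆)
open import Data.List.Base using (List; []; _∷_)
import Data.List.Membership.DecPropositional as DecMembership
open import Data.Maybe.Base using (Maybe; just; nothing)
open import Data.Nat.Base as ℕ using (ℕ; _⊔_)
import Data.Nat.Properties as ℕ
open import Data.Product.Base using (Σ; ∃; ∃₂; _×_; _,_; proj₁; proj₂)
open import Data.Product.Properties using (≡-dec)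
open import Data.Sum.Base using (_⊎_; swap)
open import Data.Unit.Base using (⊤)
open import Data.Vec.Base using (tabulate)
import Data.Vec.Functional as Vector
open import Function.Base using (_∘_; id)
open import Function.Bundles using (_↔_; _⇔_; Inverse)
open import Relation.Binary.Construct.Closure.ReflexiveTransitive using (Star)
import Relation.Binary.Construct.NonStrictToStrict as ToStrict
open import Relation.Binary.Core using (Rel)
open import Relation.Binary.Definitions using (Decidable; Irreflexive; Symmetric)
open import Relation.Binary.PropositionalEquality.Core as ≡
  using (_≡_; _≢_; refl; ≢-sym; subst)
open import Relation.Binary.Structures using (IsTotalOrder)
open import Relation.Nullary.Decidable
  using (does; ¬?; _⊎-dec_; from-yes)
open import Relation.Nullary.Negation using (¬_)
open import Relation.Unary as Pred using (Pred)

------------------------------------------------------------------------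
-- Finite simple graphs

record Graph (n : ℕ) : Set₁ where
  infix 4 _~_ _~?_
  field
    _~_    : Rel (Fin n) 0ℓ
    _~?_   : Decidable _~_
    irrefl : Irreflexive _≡_ _~_
    sym    : Symmetric _~_

  neighbours : Fin n → Subset n
  neighbours v = tabulate (λ w → does (v ~? w))

  degree : Fin n → ℕ
  degree v = ∣ neighbours v ∣

  maxDegree : ℕ
  maxDegree = Vector.foldr _⊔_ 0 degree

  Connected : Set
  Connected = ∀ u v → Star _~_ u v

open Graph public using (maxDegree; Connected)

infix 4 _≅_

_≅_ : ∀ {m n} → Graph m → Graph n → Set
_≅_ {m} {n} G H =
  Σ (Fin m ↔ Fin n) λ f →
    ∀ u v → (u G.~ v) ⇔ (Inverse.to f u H.~ Inverse.to f v)
  where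
  module G = Graph G
  module H = Graph H

complete : ∀ n → Graph n
complete n = record
  { _~_    = _≢_
  ; _~?_   = λ u v → ¬? (u Fin.≟ v)
  ; irrefl = λ u≡v u≢v → u≢v u≡v
  ; sym    = ≢-sym
  }

K₄ : Graph 4
K₄ = complete 4

open DecMembership (≡-dec ℕ._≟_ ℕ._≟_)
  using () renaming (_∈_ to _∈ₗ_; _∈?_ to _∈ₗ?_)

edgesT : List (ℕ × ℕ)
edgesT = (1 , 2) ∷ (1 , 3) ∷ (1 , 4) ∷ (2 , 7) ∷ (2 , 8) ∷ (4 , 7)
       ∷ (4 , 5) ∷ (3 , 5) ∷ (3 , 8) ∷ (5 , 6) ∷ (6 , 7) ∷ (6 , 8) ∷ []

-- The vertices 1, …, 8 are the elements of Fin 8, shifted by one.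
T : Graph 8
T = record
  { _~_    = adj
  ; _~?_   = adj?
  ; irrefl = λ { {u} refl → from-yes (Fin.all? (λ v → ¬? (adj? v v))) u }
  ; sym    = swap
  }
  where
  label : Fin 8 → ℕ
  label i = ℕ.suc (toℕ i)

  adj : Rel (Fin 8) 0ℓ
  adj u v = (label u , label v) ∈ₗ edgesT ⊎ (label v , label u) ∈ₗ edgesT

  adj? : Decidable adj
  adj? u v = ((label u , label v) ∈ₗ? edgesT) ⊎-dec ((label v , label u) ∈ₗ? edgesT)

------------------------------------------------------------------------
-- Abstract simplicial complexes

-- Simplices are nonempty by convention.
record SimplicialComplex (n : ℕ) : Set₁ where
  field
    Vertex   : Fin n → Set
    Simplex  : Subset n → Set
    nonempty : ∀ {σ} → Simplex σ → Nonempty σ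
    vertices : ∀ {σ v} → Simplex σ → v ∈ σ → Vertex v
    points   : ∀ {v} → Vertex v → Simplex ⁅ v ⁆
    faces    : ∀ {σ τ} → Simplex σ → τ ⊆ σ → Nonempty τ → Simplex τ

-- The neighborhood complex.
𝒩 : ∀ {n} → Graph n → SimplicialComplex n
𝒩 G = record
  { Vertex   = λ v → ∃ λ w → v ~ w
  ; Simplex  = λ σ → Nonempty σ × ∃ λ w → ∀ {v} → v ∈ σ → v ~ w
  ; nonempty = proj₁
  ; vertices = λ (_ , w , σ~w) v∈σ → w , σ~w v∈σ
  ; points   = λ { {v} (w , v~w) →
      (v , x∈⁅x⁆ v) , w , λ u∈ → subst (_~ w) (≡.sym (x∈⁅y⁆⇒x≡y v u∈)) v~w }
  ; faces    = λ (_ , w , σ~w) τ⊆σ τ≠∅ → τ≠∅ , w , λ v∈τ → σ~w (τ⊆σ v∈τ)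
  }
  where
  open Graph G using (_~_)

------------------------------------------------------------------------
-- The real numbers

-- ℝ is axiomatised as a Dedekind-complete ordered field; in classical
-- logic this determines it up to a unique isomorphism.
record RealField : Set₁ where
  infix 4 _≤_ _<_
  field
    commutativeRing : CommutativeRing 0ℓ 0ℓ
  open CommutativeRing commutativeRing public
    renaming (Carrier to ℝ; refl to ≈-refl; sym to ≈-sym; trans to ≈-trans)
  field
    _≤_          : Rel ℝ 0ℓ
    isTotalOrder : IsTotalOrder _≈_ _≤_
    0≉1          : ¬ (0# ≈ 1#)
    inverse      : ∀ x → ¬ (x ≈ 0#) → ∃ λ y → x * y ≈ 1#
    +-monoˡ-≤    : ∀ {x y} z → x ≤ y → x + z ≤ y + z
    *-nonneg     : ∀ {x y} → 0# ≤ x → 0# ≤ y → 0# ≤ x * y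

  _IsUpperBoundOf_ : ℝ → Pred ℝ 0ℓ → Set
  b IsUpperBoundOf P = ∀ x → P x → x ≤ b

  field
    supremum : ∀ (P : Pred ℝ 0ℓ) → ∃ P → (∃ λ b → b IsUpperBoundOf P) →
               ∃ λ s → s IsUpperBoundOf P × (∀ b → b IsUpperBoundOf P → s ≤ b)

  _<_ : Rel ℝ 0ℓ
  _<_ = ToStrict._<_ _≈_ _≤_

  open Sum +-monoid public using (sum)

------------------------------------------------------------------------
-- Topology of subspaces of Euclidean spaces

module Topology (𝓡 : RealField) where

  open RealField 𝓡

  -- Coordinates are indexed by a type I, which is finite in all uses below.
  Euclidean : Set → Set
  Euclidean I = I → ℝ

  Space : Set → Set₁
  Space I = Pred (Euclidean I) 0ℓ

  private
    variable
      I J : Set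

  infix 4 _≋_

  _≋_ : Rel (Euclidean I) 0ℓ
  x ≋ y = ∀ i → x i ≈ y i

  -- The distance of x and y in the maximum norm is less than ε.
  Near : ℝ → Rel (Euclidean I) 0ℓ
  Near ε x y = ∀ i → x i < y i + ε × y i < x i + ε

  Open : Space I → Set
  Open U = ∀ x → U x → ∃ λ ε → 0# < ε × (∀ y → Near ε x y → U y)

  ConnectedSpace : Space I → Set₁
  ConnectedSpace A =
    ∃ A ×
    (∀ U V → Open U → Open V → A Pred.⊆ (U Pred.∪ V) →
       ∃ (A Pred.∩ U) → ∃ (A Pred.∩ V) → ∃ (A Pred.∩ (U Pred.∩ V)))

  IsComponentOf : Space I → Space I → Set₁
  IsComponentOf C X =
    C Pred.⊆ X × ConnectedSpace C ×
    (∀ B → ConnectedSpace B → C Pred.⊆ B → B Pred.⊆ X → B Pred.⊆ C)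

  Point : Space I → Set
  Point X = ∃ X

  -- Continuity compares underlying coordinates only, so a continuous map
  -- respects _≋_ and does not depend on the proofs of membership.
  Continuous : {X : Space I} {Y : Space J} → (Point X → Point Y) → Set
  Continuous {X = X} f =
    ∀ (p : Point X) ε → 0# < ε →
      ∃ λ δ → 0# < δ ×
        (∀ (q : Point X) → Near δ (proj₁ p) (proj₁ q) →
           Near ε (proj₁ (f p)) (proj₁ (f q)))

  infixr 5 _⟶_

  _⟶_ : Space I → Space J → Set
  X ⟶ Y = Σ (Point X → Point Y) (Continuous {X = X} {Y = Y})

  -- X × [0,1]; the coordinate indexed by nothing is the one in [0,1].
  Cylinder : Space I → Space (Maybe I)
  Cylinder X x = (0# ≤ x nothing × x nothing ≤ 1#) × X (x ∘ just)

  -- H is a homotopy from f to g; membership in the cylinder is quantified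
  -- over since it is irrelevant to the value of H.
  IsHomotopy : {X : Space I} {Y : Space J} →
               (f g : Point X → Point Y) → (Cylinder X ⟶ Y) → Set
  IsHomotopy {X = X} f g (H , _) =
    ∀ (p : Point (Cylinder X)) →
      (proj₁ p nothing ≈ 0# → proj₁ (H p) ≋ proj₁ (f (base p))) ×
      (proj₁ p nothing ≈ 1# → proj₁ (H p) ≋ proj₁ (g (base p)))
    where
    base : Point (Cylinder X) → Point X
    base (x , _ , x∈X) = x ∘ just , x∈X

  Homotopic : {X : Space I} {Y : Space J} → (f g : Point X → Point Y) → Set
  Homotopic {X = X} {Y = Y} f g =
    ∃ λ (H : Cylinder X ⟶ Y) → IsHomotopy {X = X} {Y = Y} f g H

  infix 4 _≃_

  _≃_ : Space I → Space J → Set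
  X ≃ Y =
    ∃₂ λ (f : X ⟶ Y) (g : Y ⟶ X) →
      Homotopic {X = X} {Y = X} (proj₁ g ∘ proj₁ f) id ×
      Homotopic {X = Y} {Y = Y} (proj₁ f ∘ proj₁ g) id

  -- ℝ⁰
  onePoint : Space (Fin 0)
  onePoint _ = ⊤

  Contractible : Space I → Set
  Contractible X = X ≃ onePoint

  circle : Space (Fin 2)
  circle x = x 0F * x 0F + x 1F * x 1F ≈ 1#

  circleBase : Euclidean (Fin 2)
  circleBase 0F = 1#
  circleBase 1F = 0#

  -- The wedge sum of k copies of (X , x₀), realised inside Xᵏ as the union
  -- of the coordinate axes, i.e. of the copies of X in which all coordinates
  -- but one are equal to x₀.  (For k ≡ 0 this is empty.)
  wedge : ∀ k → Space I → Euclidean I → Space (Fin k × I)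
  wedge k X x₀ x =
    ∃ λ c → X (λ i → x (c , i)) × (∀ c′ → c′ ≢ c → (λ i → x (c′ , i)) ≋ x₀)

  wedgeOfCircles : ∀ k → Space (Fin k × Fin 2)
  wedgeOfCircles k = wedge k circle circleBase

  -- Geometric realization, in barycentric coordinates.
  ∥_∥ : ∀ {n} → SimplicialComplex n → Space (Fin n)
  ∥ K ∥ x =
    (∀ v → 0# ≤ x v) × sum x ≈ 1# ×
    ∃ λ σ → SimplicialComplex.Simplex K σ × (∀ v → v ∉ σ → x v ≈ 0#)

{-# OPTIONS --safe #-}

-- The neighbourhood complex has dimension at most two, and each of its
-- vertices lies in at most three facets.  If every edge of a triangle lies in a
-- second triangle, the link of a vertex of a triangle is a cycle of length
-- three; so the triangles at it bound a tetrahedron, which is a whole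
-- component and forces G to be K₄ or T.  Otherwise some triangle has a free
-- edge, through which it is collapsed, and iterating this leaves a connected
-- graph.  An edge {v, w} of the graph off a base vertex r adjacent to v is slid
-- along {v, r} to {w, r}; if {w, r} is already an edge, the cycle r v w is first
-- moved to a new cycle attached at r.  Once all edges contain r, the leaves are
-- collapsed and a wedge of triangle boundaries remains.  Slides and changes of
-- cycles are themselves sequences of collapses and expansions, so the single
-- explicit homotopy of a collapse carries all of the topology.

module Submission where

open import Defs
open import Axiom.ExcludedMiddle using (ExcludedMiddle)
open import Level using (0ℓ)
open import Algebra.Solver.Ring.AlmostCommutativeRing using (fromCommutativeRing; _-Raw-AlmostCommutative⟶_)
import Algebra.Solver.Ring
import Data.Bool.Properties as Bool
open import Data.Empty using (⊥; ⊥-elim)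
open import Data.Fin.Base using (Fin; zero; suc; combine; remQuot; punchIn)
open import Data.Fin.Patterns using (0F; 1F; 2F; 3F; 4F; 5F; 6F; 7F)
import Data.Fin.Properties as Fin
import Data.Fin.Subset as Subset
import Data.Fin.Subset.Properties as Subset
open import Data.Integer.Base as ℤ using (ℤ; +_; -[1+_])
import Data.Integer.Properties as ℤ
open import Data.Maybe.Base as Maybe using (Maybe; just; nothing)
open import Data.Nat.Base as ℕ using (ℕ; zero; suc)
import Data.Nat.Properties as ℕ
open import Data.Product.Base using (∃; ∃₂; _×_; _,_; proj₁; proj₂)
import Data.Sign.Base as Sign
open import Data.Sum.Base using (_⊎_; inj₁; inj₂; [_,_]′)
open import Data.Unit.Base using (⊤; tt)
import Data.Vec.Base as Vec
import Data.Vec.Functional as Vector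
import Data.Vec.Properties as Vec
open import Function.Base using (_∘_; id)
open import Function.Bundles using (_⇔_; mk⇔; mk↔ₛ′; Equivalence)
open import Relation.Binary.Construct.Closure.ReflexiveTransitive using (Star; reverse; _◅◅_) renaming (ε to done; _◅_ to _then_)
open import Relation.Binary.PropositionalEquality as ≡ using (_≡_; refl; _≢_; subst)
open import Relation.Binary.Structures using (IsTotalOrder)
open import Relation.Nullary using (Dec; yes; no; ¬_)
open import Relation.Nullary.Decidable using (does; dec-true; dec⇒maybe; from-yes; ¬?)

-- By the degree bound, three vertices with a common neighbour are the whole neighbourhood of that
-- neighbour, their apex; so distinct triangles have distinct apexes. The four vertices of a
-- tetrahedron and the apexes of its four facets thus form K_{4,4} without a perfect matching, where
-- every vertex already has three neighbours, and connectedness makes this all of `G`. Its two sides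
-- either coincide, giving `K₄`, or are disjoint, giving the graph of the cube, which is `T`.
-- Collapsing destroys the property of being a neighbourhood complex; hence the argument is run for
-- connected subcomplexes of one, and apexes are always taken in `G`. A simplicial complex has no
-- double edges, so an edge cannot be slid onto an existing one; this is why such a cycle is rebuilt
-- on two new vertices. The component `C` is an arbitrary predicate and has to be identified with
-- the realization of a subcomplex; only this uses suprema. All maps are given by formulas with
-- minima, maxima and inverses of numbers at least 1, so they are continuous on the whole Euclidean
-- space.

module Proof (em : ∀ ℓ → ExcludedMiddle ℓ) (𝓡 : RealField) where

  -- Classical logic and the ring solver

  dec : {P : Set} → Dec P
  dec {P} = em 0ℓ

  byContradiction : {P : Set} → ¬ ¬ P → P
  byContradiction {P} ¬¬p with dec {P}
  ... | yes p = p
  ... | no ¬p = ⊥-elim (¬¬p ¬p)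

  open RealField 𝓡 hiding (zero)
  open Topology 𝓡
  open IsTotalOrder isTotalOrder using (total)
    renaming (refl to ≤-refl; trans to ≤-trans; antisym to ≤-antisym; reflexive to ≤-reflexive)

  private
    variable
      n : ℕ
      I J L : Set

  module RingSolver where
    open import Algebra.Properties.Semiring.Mult.TCOptimised semiring
      using (×1-homo-*; ×-homo-+; 1+×) renaming (_×_ to _×′_)
    open import Algebra.Properties.Ring ring
      using (-‿distribˡ-*; -‿distribʳ-*; -0#≈0#; -‿involutive)
    open import Algebra.Properties.AbelianGroup +-abelianGroup
      using (⁻¹-∙-comm)
    open import Relation.Binary.Reasoning.Setoid setoid

    -- The canonical ring homomorphism. The solver takes integer coefficients because their equality
    -- is computed, whereas equality in ℝ is an abstract relation.
    ⟦_⟧ : ℤ → ℝ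
    ⟦ + n ⟧      = n ×′ 1#
    ⟦ -[1+ n ] ⟧ = - (suc n ×′ 1#)

    neg-homo : ∀ i → ⟦ ℤ.- i ⟧ ≈ - ⟦ i ⟧
    neg-homo (+ zero)    = ≈-sym -0#≈0#
    neg-homo (+ suc n)   = ≈-refl
    neg-homo -[1+ n ]    = ≈-sym (-‿involutive _)

    cancel-1 : ∀ a b → (1# + a) - (1# + b) ≈ a - b
    cancel-1 a b = begin
      (1# + a) - (1# + b)       ≈⟨ +-congˡ (⁻¹-∙-comm 1# b) ⟨
      (1# + a) + (- 1# - b)     ≈⟨ +-congʳ (+-comm 1# a) ⟩
      (a + 1#) + (- 1# - b)     ≈⟨ +-assoc a 1# _ ⟩
      a + (1# + (- 1# - b))     ≈⟨ +-congˡ (+-assoc 1# (- 1#) _) ⟨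
      a + ((1# - 1#) - b)       ≈⟨ +-congˡ (+-congʳ (-‿inverseʳ 1#)) ⟩
      a + (0# - b)              ≈⟨ +-congˡ (+-identityˡ _) ⟩
      a - b                     ∎

    ⊖-homo : ∀ m n → ⟦ m ℤ.⊖ n ⟧ ≈ m ×′ 1# - n ×′ 1#
    ⊖-homo zero    zero    = ≈-sym (-‿inverseʳ 0#)
    ⊖-homo zero    (suc n) = ≈-sym (+-identityˡ _)
    ⊖-homo (suc m) zero    = ≈-trans (≈-sym (+-identityʳ _)) (+-congˡ (≈-sym -0#≈0#))
    ⊖-homo (suc m) (suc n) = begin
      ⟦ suc m ℤ.⊖ suc n ⟧                ≡⟨ ≡.cong ⟦_⟧ (ℤ.[1+m]⊖[1+n]≡m⊖n m n) ⟩
      ⟦ m ℤ.⊖ n ⟧                        ≈⟨ ⊖-homo m n ⟩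
      m ×′ 1# - n ×′ 1#                  ≈⟨ cancel-1 _ _ ⟨
      (1# + m ×′ 1#) - (1# + n ×′ 1#)    ≈⟨ +-cong (≈-sym (1+× m 1#)) (-‿cong (≈-sym (1+× n 1#))) ⟩
      suc m ×′ 1# - suc n ×′ 1#          ∎

    add-homo : ∀ i j → ⟦ i ℤ.+ j ⟧ ≈ ⟦ i ⟧ + ⟦ j ⟧
    add-homo (+ m)    (+ n)    = ×-homo-+ 1# m n
    add-homo (+ m)    -[1+ n ] = ⊖-homo m (suc n)
    add-homo -[1+ m ] (+ n)    = ≈-trans (⊖-homo n (suc m)) (+-comm _ _)
    add-homo -[1+ m ] -[1+ n ] = begin
      - (suc (suc (m ℕ.+ n)) ×′ 1#)           ≡⟨ ≡.cong (λ k → - (suc k ×′ 1#)) (≡.sym (ℕ.+-suc m n)) ⟩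
      - ((suc m ℕ.+ suc n) ×′ 1#)             ≈⟨ -‿cong (×-homo-+ 1# (suc m) (suc n)) ⟩
      - (suc m ×′ 1# + suc n ×′ 1#)           ≈⟨ ⁻¹-∙-comm _ _ ⟨
      - (suc m ×′ 1#) - suc n ×′ 1#           ∎

    neg-◃ : ∀ n → ⟦ Sign.- ℤ.◃ n ⟧ ≈ - (n ×′ 1#)
    neg-◃ zero    = ≈-sym -0#≈0#
    neg-◃ (suc n) = ≈-refl

    pos-◃ : ∀ n → ⟦ Sign.+ ℤ.◃ n ⟧ ≈ n ×′ 1#
    pos-◃ zero    = ≈-refl
    pos-◃ (suc n) = ≈-refl

    mul-homo : ∀ i j → ⟦ i ℤ.* j ⟧ ≈ ⟦ i ⟧ * ⟦ j ⟧
    mul-homo (+ m)    (+ n)    = ≈-trans (pos-◃ (m ℕ.* n)) (×1-homo-* m n)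
    mul-homo (+ m)    -[1+ n ] = ≈-trans (neg-◃ (m ℕ.* suc n))
      (≈-trans (-‿cong (×1-homo-* m (suc n))) (-‿distribʳ-* _ _))
    mul-homo -[1+ m ] (+ n)    = ≈-trans (neg-◃ (suc m ℕ.* n))
      (≈-trans (-‿cong (×1-homo-* (suc m) n)) (-‿distribˡ-* _ _))
    mul-homo -[1+ m ] -[1+ n ] = begin
      (suc m ℕ.* suc n) ×′ 1#                 ≈⟨ ×1-homo-* (suc m) (suc n) ⟩
      (suc m ×′ 1#) * (suc n ×′ 1#)           ≈⟨ -‿involutive _ ⟨
      - - ((suc m ×′ 1#) * (suc n ×′ 1#))     ≈⟨ -‿cong (-‿distribˡ-* _ _) ⟩
      - (- (suc m ×′ 1#) * (suc n ×′ 1#))     ≈⟨ -‿distribʳ-* _ _ ⟩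
      - (suc m ×′ 1#) * - (suc n ×′ 1#)       ∎

    morphism : ℤ.+-*-rawRing -Raw-AlmostCommutative⟶ fromCommutativeRing commutativeRing
    morphism = record
      { ⟦_⟧    = ⟦_⟧
      ; +-homo = add-homo
      ; *-homo = mul-homo
      ; -‿homo = neg-homo
      ; 0-homo = ≈-refl
      ; 1-homo = ≈-refl
      }

    open Algebra.Solver.Ring ℤ.+-*-rawRing (fromCommutativeRing commutativeRing) morphism
      (λ i j → Maybe.map (λ i≡j → reflexive (≡.cong ⟦_⟧ i≡j)) (dec⇒maybe (i ℤ.≟ j))) public
      using (solve; _:=_; _:+_; _:*_; _:-_; :-_; con; Polynomial)
    :1 : ∀ {n} → Polynomial n
    :1 = con (+ 1)
    :2 : ∀ {n} → Polynomial n
    :2 = con (+ 2)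
    :0 : ∀ {n} → Polynomial n
    :0 = con (+ 0)

  open RingSolver using (solve; _:=_; _:+_; _:*_; _:-_; :-_; :0; :1; :2)

  -- Ordered fields

  ≤-respˡ : ∀ {x y z} → x ≈ y → x ≤ z → y ≤ z
  ≤-respˡ x≈y x≤z = ≤-trans (≤-reflexive (≈-sym x≈y)) x≤z

  ≤-respʳ : ∀ {x y z} → x ≈ y → z ≤ x → z ≤ y
  ≤-respʳ x≈y z≤x = ≤-trans z≤x (≤-reflexive x≈y)

  <⇒≤ : ∀ {x y} → x < y → x ≤ y
  <⇒≤ = proj₁

  <⇒≱ : ∀ {x y} → x < y → ¬ y ≤ x
  <⇒≱ (x≤y , x≉y) y≤x = x≉y (≤-antisym x≤y y≤x)

  ≰⇒> : ∀ {x y} → ¬ x ≤ y → y < x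
  ≰⇒> {x} {y} x≰y with total x y
  ... | inj₁ x≤y = ⊥-elim (x≰y x≤y)
  ... | inj₂ y≤x = y≤x , λ y≈x → x≰y (≤-reflexive (≈-sym y≈x))

  ≮⇒≥ : ∀ {x y} → ¬ x < y → y ≤ x
  ≮⇒≥ x≮y = byContradiction λ y≰x → x≮y (≰⇒> y≰x)

  <-≤-trans : ∀ {x y z} → x < y → y ≤ z → x < z
  <-≤-trans x<y y≤z = ≤-trans (<⇒≤ x<y) y≤z , λ x≈z → <⇒≱ x<y (≤-respʳ (≈-sym x≈z) y≤z)

  ≤-<-trans : ∀ {x y z} → x ≤ y → y < z → x < z
  ≤-<-trans x≤y y<z = ≤-trans x≤y (<⇒≤ y<z) , λ x≈z → <⇒≱ y<z (≤-respˡ x≈z x≤y)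

  <-respˡ : ∀ {x y z} → x ≈ y → x < z → y < z
  <-respˡ x≈y = ≤-<-trans (≤-reflexive (≈-sym x≈y))

  <-respʳ : ∀ {x y z} → x ≈ y → z < x → z < y
  <-respʳ x≈y z<x = <-≤-trans z<x (≤-reflexive x≈y)

  <-irrefl : ∀ {x} → ¬ x < x
  <-irrefl x<x = proj₂ x<x ≈-refl

  ≤∨> : ∀ x y → x ≤ y ⊎ y < x
  ≤∨> x y with dec {x ≤ y}
  ... | yes x≤y = inj₁ x≤y
  ... | no x≰y = inj₂ (≰⇒> x≰y)

  0≤- : ∀ {x y} → x ≤ y → 0# ≤ y - x
  0≤- {x} x≤y = ≤-respˡ (-‿inverseʳ x) (+-monoˡ-≤ (- x) x≤y)

  -- The usual way to an inequality below: the difference is named as a visibly nonnegative term,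
  -- and the remaining identity goes to the ring solver.
  ≤-by : ∀ {x y p} → 0# ≤ p → y - x ≈ p → x ≤ y
  ≤-by {x} {y} {p} 0≤p y-x≈p = ≤-respˡ (+-identityˡ x) (≤-respʳ lemma (+-monoˡ-≤ x 0≤p))
    where
    lemma : p + x ≈ y
    lemma = ≈-trans (+-congʳ (≈-sym y-x≈p)) (solve 2 (λ x y → y :- x :+ x := y) ≈-refl x y)

  0<- : ∀ {x y} → x < y → 0# < y - x
  0<- {x} {y} (x≤y , x≉y) = 0≤- x≤y , λ 0≈y-x → x≉y
    (≈-trans (≈-sym (+-identityˡ x)) (≈-trans (+-congʳ 0≈y-x) (solve 2 (λ x y → y :- x :+ x := y) ≈-refl x y)))

  <-by : ∀ {x y p} → 0# < p → y - x ≈ p → x < y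
  <-by {x} {y} {p} 0<p y-x≈p = ≤-by (<⇒≤ 0<p) y-x≈p , λ x≈y → proj₂ 0<p
    (≈-trans (≈-sym (-‿inverseʳ x)) (≈-trans (+-congʳ x≈y) y-x≈p))

  0≤+ : ∀ {x y} → 0# ≤ x → 0# ≤ y → 0# ≤ x + y
  0≤+ {x} {y} 0≤x 0≤y = ≤-trans 0≤y (≤-respˡ (+-identityˡ y) (+-monoˡ-≤ y 0≤x))

  +-mono-≤ : ∀ {x y u v} → x ≤ y → u ≤ v → x + u ≤ y + v
  +-mono-≤ {x} {y} {u} {v} x≤y u≤v = ≤-by (0≤+ (0≤- x≤y) (0≤- u≤v))
    (solve 4 (λ x y u v → (y :+ v) :- (x :+ u) := (y :- x) :+ (v :- u)) ≈-refl x y u v)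

  0<+≤ : ∀ {x y} → 0# < x → 0# ≤ y → 0# < x + y
  0<+≤ {x} {y} 0<x 0≤y = <-≤-trans 0<x (≤-by 0≤y (solve 2 (λ x y → (x :+ y) :- x := y) ≈-refl x y))

  +-mono-<-≤ : ∀ {x y u v} → x < y → u ≤ v → x + u < y + v
  +-mono-<-≤ {x} {y} {u} {v} x<y u≤v = <-by (0<+≤ (0<- x<y) (0≤- u≤v))
    (solve 4 (λ x y u v → (y :+ v) :- (x :+ u) := (y :- x) :+ (v :- u)) ≈-refl x y u v)

  0≤-neg : ∀ {x} → x ≤ 0# → 0# ≤ - x
  0≤-neg {x} x≤0 = ≤-respʳ (+-identityˡ (- x)) (0≤- x≤0)

  0≤sq : ∀ x → 0# ≤ x * x
  0≤sq x with total 0# x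
  ... | inj₁ 0≤x = *-nonneg 0≤x 0≤x
  ... | inj₂ x≤0 = ≤-respʳ (solve 1 (λ x → (:- x) :* (:- x) := x :* x) ≈-refl x) (*-nonneg (0≤-neg x≤0) (0≤-neg x≤0))

  0≤1 : 0# ≤ 1#
  0≤1 = ≤-respʳ (*-identityˡ 1#) (0≤sq 1#)

  0<1 : 0# < 1#
  0<1 = 0≤1 , 0≉1

  ≉-sym : ∀ {x y} → ¬ x ≈ y → ¬ y ≈ x
  ≉-sym x≉y y≈x = x≉y (≈-sym y≈x)

  abstract
    -- The value at 0 is junk.
    inv : ℝ → ℝ
    inv x with dec {x ≈ 0#}
    ... | yes _ = 0#
    ... | no x≉0 = proj₁ (inverse x x≉0)

    *-inv : ∀ {x} → ¬ x ≈ 0# → x * inv x ≈ 1#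
    *-inv {x} x≉0 with dec {x ≈ 0#}
    ... | yes x≈0 = ⊥-elim (x≉0 x≈0)
    ... | no x≉0′ = proj₂ (inverse x x≉0′)

  0<⇒≉0 : ∀ {x} → 0# < x → ¬ x ≈ 0#
  0<⇒≉0 0<x x≈0 = proj₂ 0<x (≈-sym x≈0)

  *-cancelˡ : ∀ {x y z} → ¬ x ≈ 0# → x * y ≈ x * z → y ≈ z
  *-cancelˡ {x} {y} {z} x≉0 xy≈xz = ≈-trans (≈-sym (lemma y)) (≈-trans (*-congˡ xy≈xz) (lemma z))
    where
    lemma : ∀ w → inv x * (x * w) ≈ w
    lemma w = ≈-trans (solve 3 (λ i x w → i :* (x :* w) := (x :* i) :* w) ≈-refl (inv x) x w)
      (≈-trans (*-congʳ (*-inv x≉0)) (*-identityˡ w))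

  0<* : ∀ {x y} → 0# < x → 0# < y → 0# < x * y
  0<* {x} {y} 0<x 0<y = *-nonneg (<⇒≤ 0<x) (<⇒≤ 0<y) , λ 0≈xy →
    0<⇒≉0 0<y (*-cancelˡ (0<⇒≉0 0<x) (≈-trans (≈-sym 0≈xy) (≈-sym (zeroʳ x))))

  0<inv : ∀ {x} → 0# < x → 0# < inv x
  0<inv {x} 0<x = ≰⇒> λ i≤0 → <⇒≱ 0<1
    (≤-by (*-nonneg (<⇒≤ 0<x) (0≤-neg i≤0))
      (≈-trans (+-congˡ (-‿cong (≈-sym (*-inv (0<⇒≉0 0<x)))))
        (solve 2 (λ x i → :0 :- x :* i := x :* (:- i)) ≈-refl x (inv x))))

  0<2 : 0# < 1# + 1#
  0<2 = 0<+≤ 0<1 0≤1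

  ½ : ℝ
  ½ = inv (1# + 1#)

  ½+½ : ½ + ½ ≈ 1#
  ½+½ = ≈-trans (solve 1 (λ h → h :+ h := (:1 :+ :1) :* h) ≈-refl ½) (*-inv (0<⇒≉0 0<2))

  0<½ : 0# < ½
  0<½ = 0<inv 0<2

  -- Maximum, minimum and absolute value

  infixl 7 _⊔_ _⊓_

  abstract
    _⊔_ : ℝ → ℝ → ℝ
    x ⊔ y with total x y
    ... | inj₁ _ = y
    ... | inj₂ _ = x

    x≤x⊔y : ∀ x y → x ≤ x ⊔ y
    x≤x⊔y x y with total x y
    ... | inj₁ x≤y = x≤y
    ... | inj₂ _ = ≤-refl

    y≤x⊔y : ∀ x y → y ≤ x ⊔ y
    y≤x⊔y x y with total x y
    ... | inj₁ _ = ≤-refl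
    ... | inj₂ y≤x = y≤x

    ⊔-lub : ∀ {x y z} → x ≤ z → y ≤ z → x ⊔ y ≤ z
    ⊔-lub {x} {y} x≤z y≤z with total x y
    ... | inj₁ _ = y≤z
    ... | inj₂ _ = x≤z

    ⊔-lub-< : ∀ {x y z} → x < z → y < z → x ⊔ y < z
    ⊔-lub-< {x} {y} x<z y<z with total x y
    ... | inj₁ _ = y<z
    ... | inj₂ _ = x<z

  _⊓_ : ℝ → ℝ → ℝ
  x ⊓ y = - (- x ⊔ - y)

  abs : ℝ → ℝ
  abs x = x ⊔ - x

  x≤y⇒x⊔y≈y : ∀ {x y} → x ≤ y → x ⊔ y ≈ y
  x≤y⇒x⊔y≈y {x} {y} x≤y = ≤-antisym (⊔-lub x≤y ≤-refl) (y≤x⊔y x y)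

  y≤x⇒x⊔y≈x : ∀ {x y} → y ≤ x → x ⊔ y ≈ x
  y≤x⇒x⊔y≈x {x} {y} y≤x = ≤-antisym (⊔-lub ≤-refl y≤x) (x≤x⊔y x y)

  ⊔-cong : ∀ {x y u v} → x ≈ u → y ≈ v → x ⊔ y ≈ u ⊔ v
  ⊔-cong {x} {y} {u} {v} x≈u y≈v = ≤-antisym
    (⊔-lub (≤-respˡ (≈-sym x≈u) (x≤x⊔y u v)) (≤-respˡ (≈-sym y≈v) (y≤x⊔y u v)))
    (⊔-lub (≤-respˡ x≈u (x≤x⊔y x y)) (≤-respˡ y≈v (y≤x⊔y x y)))

  neg-≤ : ∀ {x y} → x ≤ y → - y ≤ - x
  neg-≤ {x} {y} x≤y = ≤-by (0≤- x≤y) (solve 2 (λ x y → (:- x) :- (:- y) := y :- x) ≈-refl x y)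

  neg-neg : ∀ x → - - x ≈ x
  neg-neg = solve 1 (λ x → :- (:- x) := x) ≈-refl

  x≤y⇒x⊓y≈x : ∀ {x y} → x ≤ y → x ⊓ y ≈ x
  x≤y⇒x⊓y≈x {x} x≤y = ≈-trans (-‿cong (y≤x⇒x⊔y≈x (neg-≤ x≤y))) (neg-neg x)

  y≤x⇒x⊓y≈y : ∀ {x y} → y ≤ x → x ⊓ y ≈ y
  y≤x⇒x⊓y≈y {y = y} y≤x = ≈-trans (-‿cong (x≤y⇒x⊔y≈y (neg-≤ y≤x))) (neg-neg y)

  ⊓-cong : ∀ {x y u v} → x ≈ u → y ≈ v → x ⊓ y ≈ u ⊓ v
  ⊓-cong x≈u y≈v = -‿cong (⊔-cong (-‿cong x≈u) (-‿cong y≈v))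

  x⊓y≤x : ∀ x y → x ⊓ y ≤ x
  x⊓y≤x x y = ≤-respʳ (neg-neg x) (neg-≤ (x≤x⊔y (- x) (- y)))

  x⊓y≤y : ∀ x y → x ⊓ y ≤ y
  x⊓y≤y x y = ≤-respʳ (neg-neg y) (neg-≤ (y≤x⊔y (- x) (- y)))

  0≤⊓ : ∀ {x y} → 0# ≤ x → 0# ≤ y → 0# ≤ x ⊓ y
  0≤⊓ {x} {y} 0≤x 0≤y with total x y
  ... | inj₁ x≤y = ≤-respʳ (≈-sym (x≤y⇒x⊓y≈x x≤y)) 0≤x
  ... | inj₂ y≤x = ≤-respʳ (≈-sym (y≤x⇒x⊓y≈y y≤x)) 0≤y

  0<⊓ : ∀ {x y} → 0# < x → 0# < y → 0# < x ⊓ y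
  0<⊓ {x} {y} 0<x 0<y with total x y
  ... | inj₁ x≤y = <-respʳ (≈-sym (x≤y⇒x⊓y≈x x≤y)) 0<x
  ... | inj₂ y≤x = <-respʳ (≈-sym (y≤x⇒x⊓y≈y y≤x)) 0<y

  abs-cong : ∀ {x y} → x ≈ y → abs x ≈ abs y
  abs-cong x≈y = ⊔-cong x≈y (-‿cong x≈y)

  abs-pos : ∀ {x} → 0# ≤ x → abs x ≈ x
  abs-pos {x} 0≤x = y≤x⇒x⊔y≈x (≤-trans (≤-respʳ (solve 0 (:- :0 := :0) ≈-refl) (neg-≤ 0≤x)) 0≤x)

  abs-neg : ∀ {x} → x ≤ 0# → abs x ≈ - x
  abs-neg x≤0 = x≤y⇒x⊔y≈y (≤-trans x≤0 (0≤-neg x≤0))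

  0≤abs : ∀ x → 0# ≤ abs x
  0≤abs x with total 0# x
  ... | inj₁ 0≤x = ≤-respʳ (≈-sym (abs-pos 0≤x)) 0≤x
  ... | inj₂ x≤0 = ≤-respʳ (≈-sym (abs-neg x≤0)) (0≤-neg x≤0)

  x≤abs : ∀ x → x ≤ abs x
  x≤abs x = x≤x⊔y x (- x)

  -x≤abs : ∀ x → - x ≤ abs x
  -x≤abs x = y≤x⊔y x (- x)

  abs*abs : ∀ x → abs x * abs x ≈ x * x
  abs*abs x with total 0# x
  ... | inj₁ 0≤x = *-cong (abs-pos 0≤x) (abs-pos 0≤x)
  ... | inj₂ x≤0 = ≈-trans (*-cong (abs-neg x≤0) (abs-neg x≤0)) (solve 1 (λ x → (:- x) :* (:- x) := x :* x) ≈-refl x)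

  Close : ℝ → ℝ → ℝ → Set
  Close ε x y = x < y + ε × y < x + ε

  close-sym : ∀ {ε x y} → Close ε x y → Close ε y x
  close-sym (p , q) = q , p

  close-mono : ∀ {δ ε x y} → δ ≤ ε → Close δ x y → Close ε x y
  close-mono δ≤ε (p , q) = <-≤-trans p (+-mono-≤ ≤-refl δ≤ε) , <-≤-trans q (+-mono-≤ ≤-refl δ≤ε)

  close-refl : ∀ {ε x y} → 0# < ε → x ≈ y → Close ε x y
  close-refl {ε} {x} {y} 0<ε x≈y =
    <-respˡ (≈-sym x≈y) (<-by 0<ε (solve 2 (λ y e → y :+ e :- y := e) ≈-refl y ε)) ,
    <-respˡ x≈y (<-by 0<ε (solve 2 (λ y e → y :+ e :- y := e) ≈-refl x ε))

  close⇒≈ : ∀ {x y} → (∀ ε → 0# < ε → Close ε x y) → x ≈ y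
  close⇒≈ {x} {y} h = ≤-antisym
    (byContradiction λ x≰y → let y<x = ≰⇒> x≰y in
      <-irrefl (<-respʳ (solve 2 (λ x y → y :+ (x :- y) := x) ≈-refl x y) (proj₁ (h _ (0<- y<x)))))
    (byContradiction λ y≰x → let x<y = ≰⇒> y≰x in
      <-irrefl (<-respʳ (solve 2 (λ x y → x :+ (y :- x) := y) ≈-refl x y) (proj₂ (h _ (0<- x<y)))))

  -- Continuity

  -- This is |x| ≤ a, split into two nonnegative quantities, so that bounds are added and multiplied
  -- by means of identities.
  Bounded : ℝ → ℝ → Set
  Bounded a x = 0# ≤ a - x × 0# ≤ a + x

  bounded-+ : ∀ {a b x y} → Bounded a x → Bounded b y → Bounded (a + b) (x + y)
  bounded-+ {a} {b} {x} {y} (p , q) (p′ , q′) =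
    ≤-respʳ (solve 4 (λ a b x y → (a :- x) :+ (b :- y) := (a :+ b) :- (x :+ y)) ≈-refl a b x y) (0≤+ p p′) ,
    ≤-respʳ (solve 4 (λ a b x y → (a :+ x) :+ (b :+ y) := (a :+ b) :+ (x :+ y)) ≈-refl a b x y) (0≤+ q q′)

  0≤-halve : ∀ {x} → 0# ≤ x + x → 0# ≤ x
  0≤-halve {x} 0≤2x = ≮⇒≥ λ x<0 → <⇒≱ (<-respʳ (+-identityˡ 0#) (+-mono-<-≤ x<0 (<⇒≤ x<0))) 0≤2x

  -- Twice `a * b - x * y` and twice `a * b + x * y` are sums of two products of the nonnegative
  -- quantities `a ± x` and `b ± y`.
  bounded-* : ∀ {a b x y} → Bounded a x → Bounded b y → Bounded (a * b) (x * y)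
  bounded-* {a} {b} {x} {y} (p , q) (p′ , q′) =
    0≤-halve (≤-respʳ (solve 4 (λ a b x y → (a :- x) :* (b :+ y) :+ (a :+ x) :* (b :- y)
      := (a :* b :- x :* y) :+ (a :* b :- x :* y)) ≈-refl a b x y) (0≤+ (*-nonneg p q′) (*-nonneg q p′))) ,
    0≤-halve (≤-respʳ (solve 4 (λ a b x y → (a :- x) :* (b :- y) :+ (a :+ x) :* (b :+ y)
      := (a :* b :+ x :* y) :+ (a :* b :+ x :* y)) ≈-refl a b x y) (0≤+ (*-nonneg p p′) (*-nonneg q q′)))

  bounded-abs : ∀ x → Bounded (abs x) x
  bounded-abs x = 0≤- (x≤abs x) ,
    ≤-respʳ (solve 2 (λ a x → a :- (:- x) := a :+ x) ≈-refl (abs x) x) (0≤- (-x≤abs x))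

  bounded-mono : ∀ {a b x} → a ≤ b → Bounded a x → Bounded b x
  bounded-mono {a} {b} {x} a≤b (p , q) =
    ≤-respʳ (solve 3 (λ a b x → (b :- a) :+ (a :- x) := b :- x) ≈-refl a b x) (0≤+ (0≤- a≤b) p) ,
    ≤-respʳ (solve 3 (λ a b x → (b :- a) :+ (a :+ x) := b :+ x) ≈-refl a b x) (0≤+ (0≤- a≤b) q)

  bounded-resp : ∀ {a x y} → x ≈ y → Bounded a x → Bounded a y
  bounded-resp x≈y (p , q) = ≤-respʳ (+-congˡ (-‿cong x≈y)) p , ≤-respʳ (+-congˡ x≈y) q

  close⇒bounded : ∀ {ε x y} → Close ε x y → Bounded ε (y - x)
  close⇒bounded {ε} {x} {y} (p , q) =
    ≤-respʳ (solve 3 (λ e x y → (x :+ e) :- y := e :- (y :- x)) ≈-refl ε x y) (0≤- (<⇒≤ q)) ,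
    ≤-respʳ (solve 3 (λ e x y → (y :+ e) :- x := e :+ (y :- x)) ≈-refl ε x y) (0≤- (<⇒≤ p))

  bounded⇒close : ∀ {a ε x y} → a < ε → Bounded a (y - x) → Close ε x y
  bounded⇒close {a} {ε} {x} {y} a<ε (p , q) =
    <-by (0<+≤ (0<- a<ε) q) (solve 4 (λ a e x y → (y :+ e) :- x := (e :- a) :+ (a :+ (y :- x))) ≈-refl a ε x y) ,
    <-by (0<+≤ (0<- a<ε) p) (solve 4 (λ a e x y → (x :+ e) :- y := (e :- a) :+ (a :- (y :- x))) ≈-refl a ε x y)

  halve-< : ∀ {ε} → 0# < ε → ½ * ε < ε
  halve-< {ε} 0<ε = <-by (0<* 0<½ 0<ε)
    (≈-trans (+-congʳ (≈-trans (≈-sym (*-identityˡ ε)) (*-congʳ (≈-sym ½+½))))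
      (solve 2 (λ h e → (h :+ h) :* e :- h :* e := h :* e) ≈-refl ½ ε))

  Contℝ : (Euclidean I → ℝ) → Set
  Contℝ φ = ∀ x ε → 0# < ε → ∃ λ δ → 0# < δ × (∀ y → Near δ x y → Close ε (φ x) (φ y))

  Cont : (Euclidean I → Euclidean J) → Set
  Cont f = ∀ x ε → 0# < ε → ∃ λ δ → 0# < δ × (∀ y → Near δ x y → Near ε (f x) (f y))

  near-mono : ∀ {δ ε} {x y : Euclidean I} → δ ≤ ε → Near δ x y → Near ε x y
  near-mono δ≤ε n i = close-mono δ≤ε (n i)

  cont-resp : {f : Euclidean I → Euclidean J} → Cont f → ∀ {x y} → x ≋ y → f x ≋ f y
  cont-resp c {x} {y} x≋y j = close⇒≈ λ ε 0<ε →
    let (_ , 0<δ , h) = c x ε 0<ε in h y (λ i → close-refl 0<δ (x≋y i)) j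

  cont-const : ∀ a → Contℝ {I} (λ _ → a)
  cont-const a x ε 0<ε = ε , 0<ε , λ _ _ → close-refl 0<ε ≈-refl

  cont-proj : ∀ i → Contℝ {I} (λ x → x i)
  cont-proj i x ε 0<ε = ε , 0<ε , λ _ n → n i

  cont-∘ℝ : {φ : Euclidean J → ℝ} {f : Euclidean I → Euclidean J} → Contℝ φ → Cont f → Contℝ (φ ∘ f)
  cont-∘ℝ {f = f} cφ cf x ε 0<ε =
    let (δ , 0<δ , h) = cφ (f x) ε 0<ε
        (γ , 0<γ , h′) = cf x δ 0<δ
    in γ , 0<γ , λ y n → h (f y) (h′ y n)

  cont-id : Cont {I} id
  cont-id x ε 0<ε = ε , 0<ε , λ _ n → n

  cont-∘ : {g : Euclidean J → Euclidean L} {f : Euclidean I → Euclidean J} → Cont g → Cont f → Cont (g ∘ f)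
  cont-∘ {f = f} cg cf x ε 0<ε =
    let (δ , 0<δ , h) = cg (f x) ε 0<ε
        (γ , 0<γ , h′) = cf x δ 0<δ
    in γ , 0<γ , λ y n → h (f y) (h′ y n)

  cont-reindex : (s : J → I) → Cont {I} {J} (_∘ s)
  cont-reindex s x ε 0<ε = ε , 0<ε , λ _ n j → n (s j)

  cont₂ : {φ ψ : Euclidean I → ℝ} → Contℝ φ → Contℝ ψ → ∀ x ε → 0# < ε →
    ∃ λ δ → 0# < δ × (∀ y → Near δ x y → Close ε (φ x) (φ y) × Close ε (ψ x) (ψ y))
  cont₂ cφ cψ x ε 0<ε =
    let (δ , 0<δ , h) = cφ x ε 0<ε
        (γ , 0<γ , h′) = cψ x ε 0<ε
    in δ ⊓ γ , 0<⊓ 0<δ 0<γ , λ y n →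
       h y (near-mono (x⊓y≤x δ γ) n) , h′ y (near-mono (x⊓y≤y δ γ) n)

  cont-neg : {φ : Euclidean I → ℝ} → Contℝ φ → Contℝ (λ x → - φ x)
  cont-neg {φ = φ} cφ x ε 0<ε =
    let (δ , 0<δ , h) = cφ x ε 0<ε in δ , 0<δ , λ y n →
    let (p , q) = h y n
        lem : ∀ a b → (- a + ε) - (- b) ≈ (b + ε) - a
        lem a b = solve 3 (λ a b e → ((:- a) :+ e) :- (:- b) := (b :+ e) :- a) ≈-refl a b ε
    in <-by (0<- q) (lem (φ y) (φ x)) , <-by (0<- p) (lem (φ x) (φ y))

  cont-+ : {φ ψ : Euclidean I → ℝ} → Contℝ φ → Contℝ ψ → Contℝ (λ x → φ x + ψ x)
  cont-+ {φ = φ} {ψ} cφ cψ x ε 0<ε =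
    let (δ , 0<δ , h) = cont₂ {φ = φ} {ψ} cφ cψ x (½ * ε) (0<* 0<½ 0<ε) in δ , 0<δ , λ y n →
    let ((p , q) , (p′ , q′)) = h y n
        lem : ∀ a b → (a + ½ * ε) + (b + ½ * ε) ≈ (a + b) + ε
        lem a b = ≈-trans (solve 4 (λ a b h e → (a :+ h :* e) :+ (b :+ h :* e) := (a :+ b) :+ (h :+ h) :* e) ≈-refl a b ½ ε)
          (+-congˡ (≈-trans (*-congʳ ½+½) (*-identityˡ ε)))
    in <-respʳ (lem (φ y) (ψ y)) (+-mono-<-≤ p (<⇒≤ p′)) , <-respʳ (lem (φ x) (ψ x)) (+-mono-<-≤ q (<⇒≤ q′))

  cont-- : {φ ψ : Euclidean I → ℝ} → Contℝ φ → Contℝ ψ → Contℝ (λ x → φ x - ψ x)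
  cont-- {φ = φ} {ψ} cφ cψ = cont-+ {φ = φ} cφ (cont-neg {φ = ψ} cψ)

  cont-⊔ : {φ ψ : Euclidean I → ℝ} → Contℝ φ → Contℝ ψ → Contℝ (λ x → φ x ⊔ ψ x)
  cont-⊔ {φ = φ} {ψ} cφ cψ x ε 0<ε =
    let (δ , 0<δ , h) = cont₂ {φ = φ} {ψ} cφ cψ x ε 0<ε in δ , 0<δ , λ y n →
    let ((p , q) , (p′ , q′)) = h y n
    in ⊔-lub-< (<-≤-trans p (+-mono-≤ (x≤x⊔y _ _) ≤-refl)) (<-≤-trans p′ (+-mono-≤ (y≤x⊔y _ _) ≤-refl)) ,
       ⊔-lub-< (<-≤-trans q (+-mono-≤ (x≤x⊔y _ _) ≤-refl)) (<-≤-trans q′ (+-mono-≤ (y≤x⊔y _ _) ≤-refl))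

  cont-⊓ : {φ ψ : Euclidean I → ℝ} → Contℝ φ → Contℝ ψ → Contℝ (λ x → φ x ⊓ ψ x)
  cont-⊓ {φ = φ} {ψ} cφ cψ =
    cont-neg {φ = λ x → - φ x ⊔ - ψ x} (cont-⊔ (cont-neg {φ = φ} cφ) (cont-neg {φ = ψ} cψ))

  cont-abs : {φ : Euclidean I → ℝ} → Contℝ φ → Contℝ (λ x → abs (φ x))
  cont-abs {φ = φ} cφ = cont-⊔ {φ = φ} cφ (cont-neg {φ = φ} cφ)

  cont-* : {φ ψ : Euclidean I → ℝ} → Contℝ φ → Contℝ ψ → Contℝ (λ x → φ x * ψ x)
  cont-* {φ = φ} {ψ} cφ cψ x ε 0<ε =
    let a = φ x
        b = ψ x
        -- The change of the product is a Δb + b Δa + Δa Δb. If both changes are at most `η ≤ 1`,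
        -- this is at most `M * η`, and `ρ` is chosen to make `M * ρ` half of `ε`.
        M = (abs a + abs b) + 1#
        0<M : 0# < M
        0<M = <-respʳ (+-comm _ _) (0<+≤ 0<1 (0≤+ (0≤abs a) (0≤abs b)))
        ρ = inv M * (½ * ε)
        0<ρ : 0# < ρ
        0<ρ = 0<* (0<inv 0<M) (0<* 0<½ 0<ε)
        η = 1# ⊓ ρ
        0<η : 0# < η
        0<η = 0<⊓ 0<1 0<ρ
        Mη<ε : M * η < ε
        Mη<ε = ≤-<-trans (≤-by (*-nonneg (<⇒≤ 0<M) (0≤- (x⊓y≤y 1# ρ)))
                 (solve 3 (λ m r e → m :* r :- m :* e := m :* (r :- e)) ≈-refl M ρ η))
               (<-respˡ (≈-trans (≈-sym (*-identityˡ _)) (≈-trans (*-congʳ (≈-sym (*-inv (0<⇒≉0 0<M))))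
                  (*-assoc M (inv M) _))) (halve-< 0<ε))
        (δ , 0<δ , h) = cont₂ {φ = φ} {ψ} cφ cψ x η 0<η
    in δ , 0<δ , λ y n →
    let (p , q) = h y n
        P = close⇒bounded p
        Q = close⇒bounded q
        bound = bounded-+ (bounded-+ (bounded-* (bounded-abs a) Q) (bounded-* (bounded-abs b) P))
                          (bounded-* (bounded-mono (x⊓y≤x 1# ρ) P) Q)
    in bounded⇒close
         (<-respˡ (solve 3 (λ a b e → ((a :+ b) :+ :1) :* e := (a :* e :+ b :* e) :+ :1 :* e) ≈-refl (abs a) (abs b) η) Mη<ε)
         (bounded-resp (solve 4 (λ a b a′ b′ → (a :* (b′ :- b) :+ b :* (a′ :- a)) :+ (a′ :- a) :* (b′ :- b)
             := a′ :* b′ :- a :* b) ≈-refl a b (φ y) (ψ y)) bound)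

  inv≤1 : ∀ {x} → 1# ≤ x → inv x ≤ 1#
  inv≤1 {x} 1≤x = ≤-by (*-nonneg (0≤- 1≤x) (<⇒≤ (0<inv 0<x)))
    (≈-trans (+-congʳ (≈-sym (*-inv (0<⇒≉0 0<x)))) (solve 2 (λ x i → x :* i :- i := (x :- :1) :* i) ≈-refl x (inv x)))
    where
    0<x : 0# < x
    0<x = <-≤-trans 0<1 1≤x

  -- Inversion is 1-Lipschitz on numbers at least 1, since 1/b - 1/a is (a - b)(1/a)(1/b). The
  -- denominators met later are 1 plus something nonnegative, so the bound holds on the whole space.
  cont-inv : {φ : Euclidean I → ℝ} → (∀ x → 1# ≤ φ x) → Contℝ φ → Contℝ (λ x → inv (φ x))
  cont-inv {φ = φ} 1≤φ cφ x ε 0<ε =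
    let (δ , 0<δ , h) = cφ x (½ * ε) (0<* 0<½ 0<ε) in δ , 0<δ , λ y n →
    bounded⇒close
      (<-respˡ (solve 2 (λ h e → h :* e := h :* e :* (:1 :* :1)) ≈-refl ½ ε) (halve-< 0<ε))
      (bounded-resp (lem (φ x) (φ y) (≉0 x) (≉0 y))
        (bounded-* (close⇒bounded (close-sym (h y n))) (bounded-* (bd x) (bd y))))
    where
    ≉0 : ∀ x → ¬ φ x ≈ 0#
    ≉0 x = 0<⇒≉0 (<-≤-trans 0<1 (1≤φ x))
    bd : ∀ x → Bounded 1# (inv (φ x))
    bd x = 0≤- (inv≤1 (1≤φ x)) , 0≤+ 0≤1 (<⇒≤ (0<inv (<-≤-trans 0<1 (1≤φ x))))
    lem : ∀ a b → ¬ a ≈ 0# → ¬ b ≈ 0# → (a - b) * (inv a * inv b) ≈ inv b - inv a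
    lem a b a≉0 b≉0 = ≈-trans
      (solve 4 (λ a b i j → (a :- b) :* (i :* j) := (a :* i) :* j :- (b :* j) :* i) ≈-refl a b (inv a) (inv b))
      (≈-trans (+-cong (*-congʳ (*-inv a≉0)) (-‿cong (*-congʳ (*-inv b≉0))))
        (+-cong (*-identityˡ _) (-‿cong (*-identityˡ _))))

  -- Finiteness of `J` in the form in which continuity uses it: positive radii, one for each index,
  -- can be replaced by a common one. Closure under products covers the coordinates of a wedge.
  Uniform : Set → Set₁
  Uniform J = (Q : J → ℝ → Set) → (∀ j {δ ε} → δ ≤ ε → Q j ε → Q j δ) →
    (∀ j → ∃ λ δ → 0# < δ × Q j δ) → ∃ λ δ → 0# < δ × (∀ j → Q j δ)

  uniform-Fin : ∀ n → Uniform (Fin n)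
  uniform-Fin zero Q mono h = 1# , 0<1 , λ ()
  uniform-Fin (suc n) Q mono h =
    let (δ , 0<δ , q) = h zero
        (γ , 0<γ , q′) = uniform-Fin n (Q ∘ suc) (λ j → mono (suc j)) (h ∘ suc)
    in δ ⊓ γ , 0<⊓ 0<δ 0<γ , λ where
      zero → mono zero (x⊓y≤x δ γ) q
      (suc j) → mono (suc j) (x⊓y≤y δ γ) (q′ j)

  uniform-× : ∀ {A B} → Uniform A → Uniform B → Uniform (A × B)
  uniform-× uA uB Q mono h =
    let (δ , 0<δ , q) = uA (λ a δ → ∀ b → Q (a , b) δ) (λ a δ≤ε q b → mono (a , b) δ≤ε (q b))
          (λ a → uB (λ b → Q (a , b)) (λ b → mono (a , b)) (λ b → h (a , b)))
    in δ , 0<δ , λ (a , b) → q a b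

  cont-coords : Uniform J → {f : Euclidean I → Euclidean J} → (∀ j → Contℝ (λ x → f x j)) → Cont f
  cont-coords uJ {f} c x ε 0<ε =
    let (δ , 0<δ , h) = uJ (λ j δ → ∀ y → Near δ x y → Close ε (f x j) (f y j))
          (λ j δ≤ε q y n → q y (near-mono δ≤ε n)) (λ j → c j x ε 0<ε)
    in δ , 0<δ , λ y n j → h j y n

  -- Homotopy equivalences

  at : ℝ → Euclidean I → Euclidean (Maybe I)
  at t x nothing  = t
  at t x (just i) = x i

  cont-at : {τ : Euclidean I → ℝ} {h : Euclidean I → Euclidean J} → Contℝ τ → Cont h → Cont (λ p → at (τ p) (h p))
  cont-at cτ ch x ε 0<ε =
    let (δ , 0<δ , q) = cτ x ε 0<ε
        (γ , 0<γ , q′) = ch x ε 0<ε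
    in δ ⊓ γ , 0<⊓ 0<δ 0<γ , λ where
      y n nothing  → q y (near-mono (x⊓y≤x δ γ) n)
      y n (just j) → q′ y (near-mono (x⊓y≤y δ γ) n) j

  Saturated : Space I → Set
  Saturated X = ∀ {x y} → x ≋ y → X x → X y

  record Deformation (X : Space I) (F : Euclidean I → Euclidean I) : Set where
    field
      H      : Euclidean (Maybe I) → Euclidean I
      H-cont : Cont H
      H∈     : ∀ p → Cylinder X p → X (H p)
      H-0    : ∀ p → X (p ∘ just) → p nothing ≈ 0# → H p ≋ F (p ∘ just)
      H-1    : ∀ p → X (p ∘ just) → p nothing ≈ 1# → H p ≋ p ∘ just

  -- Homotopy equivalences induced by maps defined on the whole ambient
  -- spaces: formulas can then be combined without gluing arguments.
  infix 4 _≃ᵗ_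
  record _≃ᵗ_ (X : Space I) (Y : Space J) : Set where
    field
      to        : Euclidean I → Euclidean J
      from      : Euclidean J → Euclidean I
      to-cont   : Cont to
      from-cont : Cont from
      to∈       : ∀ x → X x → Y (to x)
      from∈     : ∀ y → Y y → X (from y)
      left      : Deformation X (from ∘ to)
      right     : Deformation Y (to ∘ from)

  module _ {X : Space I} {Y : Space J} where

    ≃ᵗ⇒≃ : X ≃ᵗ Y → X ≃ Y
    ≃ᵗ⇒≃ e = (f , λ p ε 0<ε → let (δ , 0<δ , h) = to-cont (proj₁ p) ε 0<ε in δ , 0<δ , λ q → h (proj₁ q)) ,
             (g , λ p ε 0<ε → let (δ , 0<δ , h) = from-cont (proj₁ p) ε 0<ε in δ , 0<δ , λ q → h (proj₁ q)) ,
             official {F∈ = λ x x∈ → from∈ _ (to∈ x x∈)} left ,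
             official {F∈ = λ y y∈ → to∈ _ (from∈ y y∈)} right
      where
      open _≃ᵗ_ e
      f : Point X → Point Y
      f (x , x∈X) = to x , to∈ x x∈X
      g : Point Y → Point X
      g (y , y∈Y) = from y , from∈ y y∈Y
      official : ∀ {K} {Z : Space K} {F : Euclidean K → Euclidean K} {F∈ : ∀ x → Z x → Z (F x)} →
        Deformation Z F → Homotopic {X = Z} {Y = Z} (λ (x , x∈) → F x , F∈ x x∈) id
      official D =
        ((λ (p , p∈) → D.H p , D.H∈ p p∈) ,
         λ p ε 0<ε → let (δ , 0<δ , h) = D.H-cont (proj₁ p) ε 0<ε in δ , 0<δ , λ q → h (proj₁ q)) ,
        λ (p , p∈) → D.H-0 p (proj₂ p∈) , D.H-1 p (proj₂ p∈)
        where module D = Deformation D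

    ≃ᵗ-sym : X ≃ᵗ Y → Y ≃ᵗ X
    ≃ᵗ-sym e = record
      { to = from ; from = to ; to-cont = from-cont ; from-cont = to-cont
      ; to∈ = from∈ ; from∈ = to∈ ; left = right ; right = left }
      where open _≃ᵗ_ e

  deformation-const : {X : Space I} {F : Euclidean I → Euclidean I} →
    (∀ x → X x → F x ≋ x) → Deformation X F
  deformation-const h = record
    { H = _∘ just ; H-cont = cont-reindex just ; H∈ = λ p → proj₂
    ; H-0 = λ p p∈ _ i → ≈-sym (h (p ∘ just) p∈ i)
    ; H-1 = λ p _ _ i → ≈-refl }

  homeomorphism : {X : Space I} {Y : Space J}
    (f : Euclidean I → Euclidean J) (g : Euclidean J → Euclidean I) → Cont f → Cont g →
    (∀ x → X x → Y (f x)) → (∀ y → Y y → X (g y)) →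
    (∀ x → X x → g (f x) ≋ x) → (∀ y → Y y → f (g y) ≋ y) → X ≃ᵗ Y
  homeomorphism f g cf cg f∈ g∈ gf fg = record
    { to = f ; from = g ; to-cont = cf ; from-cont = cg ; to∈ = f∈ ; from∈ = g∈
    ; left = deformation-const gf ; right = deformation-const fg }

  ≃ᵗ-ext : {X Y : Space I} → (∀ x → X x → Y x) → (∀ x → Y x → X x) → X ≃ᵗ Y
  ≃ᵗ-ext X⊆Y Y⊆X = homeomorphism id id cont-id cont-id X⊆Y Y⊆X (λ _ _ _ → ≈-refl) (λ _ _ _ → ≈-refl)

  retraction : {X Y : Space I} (r : Euclidean I → Euclidean I) → Cont r →
    (∀ y → Y y → X y) → (∀ x → X x → Y (r x)) → (∀ y → Y y → r y ≋ y) → Deformation X r → X ≃ᵗ Y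
  retraction r cr Y⊆X r∈ r-id D = record
    { to = r ; from = id ; to-cont = cr ; from-cont = cont-id
    ; to∈ = r∈ ; from∈ = Y⊆X ; left = D ; right = deformation-const r-id }

  -- The concatenation of g ∘ H′ ∘ f (run for t ≤ ½) and H, written as the sum of
  -- both minus their common value g ∘ f in the middle.
  deformation-trans : {X : Space I} {Y : Space J} → Uniform I → Saturated X →
    {f : Euclidean I → Euclidean J} {g : Euclidean J → Euclidean I} → Cont f → Cont g →
    (∀ x → X x → Y (f x)) → (∀ y → Y y → X (g y)) →
    {F : Euclidean J → Euclidean J} → Deformation Y F → Deformation X (g ∘ f) →
    Deformation X (g ∘ F ∘ f)
  deformation-trans {I = I} {J} {X = X} {Y} uI sat {f} {g} cf cg f∈ g∈ {F} D E = record
    { H = K ; H-cont = K-cont ; H∈ = K∈ ; H-0 = K-0 ; H-1 = K-1 }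
    where
    module D = Deformation D
    module E = Deformation E
    t₁ t₂ : Euclidean (Maybe I) → ℝ
    t₁ p = (p nothing + p nothing) ⊓ 1#
    t₂ p = (p nothing + p nothing - 1#) ⊔ 0#
    A B M : Euclidean (Maybe I) → Euclidean I
    A p = g (D.H (at (t₁ p) (f (p ∘ just))))
    B p = E.H (at (t₂ p) (p ∘ just))
    M p = g (f (p ∘ just))
    -- While `t₂` is 0 the second homotopy rests at its start `M p`; once `t₁` is 1 the first rests
    -- at its end, again `M p`. The resting term cancels.
    K : Euclidean (Maybe I) → Euclidean I
    K p i = (A p i + B p i) - M p i

    c2t : Contℝ {Maybe I} (λ p → p nothing + p nothing)
    c2t = cont-+ (cont-proj nothing) (cont-proj nothing)
    ct₁ : Contℝ t₁
    ct₁ = cont-⊓ c2t (cont-const 1#)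
    ct₂ : Contℝ t₂
    ct₂ = cont-⊔ (cont-- c2t (cont-const 1#)) (cont-const 0#)
    cbase : Cont {Maybe I} (_∘ just)
    cbase = cont-reindex just
    cA : Cont A
    cA = cont-∘ cg (cont-∘ D.H-cont (cont-at ct₁ (cont-∘ cf cbase)))
    cB : Cont B
    cB = cont-∘ E.H-cont (cont-at ct₂ cbase)
    cM : Cont M
    cM = cont-∘ cg (cont-∘ cf cbase)
    K-cont : Cont K
    K-cont = cont-coords uI λ i → cont-- (cont-+ (cont-∘ℝ (cont-proj i) cA) (cont-∘ℝ (cont-proj i) cB))
                                         (cont-∘ℝ (cont-proj i) cM)

    K≋A : ∀ p → X (p ∘ just) → t₂ p ≈ 0# → K p ≋ A p
    K≋A p x∈ t₂≈0 i = ≈-trans (+-congʳ (+-congˡ (E.H-0 _ x∈ t₂≈0 i)))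
      (solve 2 (λ a m → (a :+ m) :- m := a) ≈-refl (A p i) (M p i))

    K≋B : ∀ p → X (p ∘ just) → t₁ p ≈ 1# → K p ≋ B p
    K≋B p x∈ t₁≈1 i = ≈-trans (+-congʳ (+-congʳ (cont-resp cg (D.H-1 _ (f∈ _ x∈) t₁≈1) i)))
      (solve 2 (λ b m → (m :+ b) :- m := b) ≈-refl (B p i) (M p i))

    K∈ : ∀ p → Cylinder X p → X (K p)
    K∈ p ((0≤t , t≤1) , x∈) with total (p nothing + p nothing) 1#
    ... | inj₁ 2t≤1 = sat (λ i → ≈-sym (K≋A p x∈ (x≤y⇒x⊔y≈y (≤-by (0≤- 2t≤1)
            (solve 1 (λ t → :0 :- (t :- :1) := :1 :- t) ≈-refl (p nothing + p nothing)))) i))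
          (g∈ _ (D.H∈ _ ((0≤⊓ (0≤+ 0≤t 0≤t) 0≤1 , x⊓y≤y _ _) , f∈ _ x∈)))
    ... | inj₂ 1≤2t = sat (λ i → ≈-sym (K≋B p x∈ (y≤x⇒x⊓y≈y 1≤2t) i))
          (E.H∈ _ ((y≤x⊔y _ _ , ⊔-lub (≤-by (0≤+ (0≤- t≤1) (0≤- t≤1))
            (solve 1 (λ t → :1 :- (t :+ t :- :1) := (:1 :- t) :+ (:1 :- t)) ≈-refl (p nothing))) 0≤1) , x∈))

    K-0 : ∀ p → X (p ∘ just) → p nothing ≈ 0# → K p ≋ g (F (f (p ∘ just)))
    K-0 p x∈ t≈0 i = ≈-trans (K≋A p x∈ (x≤y⇒x⊔y≈y (≤-by 0≤1
        (≈-trans (+-congˡ (-‿cong (+-congʳ (+-cong t≈0 t≈0)))) (solve 0 (:0 :- (:0 :+ :0 :- :1) := :1) ≈-refl)))) i)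
      (cont-resp cg (D.H-0 _ (f∈ _ x∈) t₁≈0) i)
      where
      t₁≈0 : t₁ p ≈ 0#
      t₁≈0 = ≈-trans (⊓-cong (≈-trans (+-cong t≈0 t≈0) (+-identityˡ 0#)) ≈-refl) (x≤y⇒x⊓y≈x 0≤1)

    K-1 : ∀ p → X (p ∘ just) → p nothing ≈ 1# → K p ≋ p ∘ just
    K-1 p x∈ t≈1 i = ≈-trans (K≋B p x∈ (y≤x⇒x⊓y≈y (≤-by 0≤1
        (≈-trans (+-congʳ (+-cong t≈1 t≈1)) (solve 0 (:1 :+ :1 :- :1 := :1) ≈-refl)))) i)
      (E.H-1 _ x∈ t₂≈1 i)
      where
      t₂≈1 : t₂ p ≈ 1#
      t₂≈1 = ≈-trans (⊔-cong (≈-trans (+-congʳ (+-cong t≈1 t≈1)) (solve 0 (:1 :+ :1 :- :1 := :1) ≈-refl)) ≈-refl)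
               (y≤x⇒x⊔y≈x 0≤1)

  ≃ᵗ-trans : {X : Space I} {Y : Space J} {Z : Space L} → Uniform I → Uniform L → Saturated X → Saturated Z →
    X ≃ᵗ Y → Y ≃ᵗ Z → X ≃ᵗ Z
  ≃ᵗ-trans uI uL satX satZ e e′ = record
    { to = e′.to ∘ e.to ; from = e.from ∘ e′.from
    ; to-cont = cont-∘ e′.to-cont e.to-cont ; from-cont = cont-∘ e.from-cont e′.from-cont
    ; to∈ = λ x x∈ → e′.to∈ _ (e.to∈ x x∈) ; from∈ = λ y y∈ → e.from∈ _ (e′.from∈ y y∈)
    ; left = deformation-trans uI satX e.to-cont e.from-cont e.to∈ e.from∈ e′.left e.left
    ; right = deformation-trans uL satZ e′.from-cont e′.to-cont e′.from∈ e′.to∈ e.right e′.right }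
    where
    module e = _≃ᵗ_ e
    module e′ = _≃ᵗ_ e′

  -- Simplicial complexes and collapses

  open import Algebra.Properties.CommutativeMonoid.Sum +-commutativeMonoid using (∑-distrib-+; sum-cong-≋; sum-replicate-zero)
  open import Algebra.Properties.Semiring.Sum semiring using (*-distribˡ-sum)

  -- `δ i` is the vertex `i` in barycentric coordinates.
  δ : ∀ {n} → Fin n → Fin n → ℝ
  δ zero    zero    = 1#
  δ zero    (suc _) = 0#
  δ (suc _) zero    = 0#
  δ (suc i) (suc j) = δ i j

  δ-refl : ∀ {n} (i : Fin n) → δ i i ≈ 1#
  δ-refl zero    = ≈-refl
  δ-refl (suc i) = δ-refl i

  δ-≢ : ∀ {n} {i j : Fin n} → j ≢ i → δ i j ≈ 0#
  δ-≢ {i = zero}  {zero}  j≢i = ⊥-elim (j≢i refl)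
  δ-≢ {i = zero}  {suc j} j≢i = ≈-refl
  δ-≢ {i = suc i} {zero}  j≢i = ≈-refl
  δ-≢ {i = suc i} {suc j} j≢i = δ-≢ (λ j≡i → j≢i (≡.cong suc j≡i))

  0≤δ : ∀ {n} (i j : Fin n) → 0# ≤ δ i j
  0≤δ zero    zero    = 0≤1
  0≤δ zero    (suc _) = ≤-refl
  0≤δ (suc _) zero    = ≤-refl
  0≤δ (suc i) (suc j) = 0≤δ i j

  sum-0 : ∀ {n} {x : Euclidean (Fin n)} → (∀ i → x i ≈ 0#) → sum x ≈ 0#
  sum-0 {n} h = ≈-trans (sum-cong-≋ h) (sum-replicate-zero n)

  sum-δ : ∀ {n} (i : Fin n) → sum (δ i) ≈ 1#
  sum-δ {suc n} zero = ≈-trans (+-congˡ (sum-0 {n} {λ _ → 0#} λ _ → ≈-refl)) (+-identityʳ 1#)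
  sum-δ (suc i) = ≈-trans (+-identityˡ _) (sum-δ i)

  sum-*ˡ : ∀ {n} s (x : Euclidean (Fin n)) → sum (λ i → s * x i) ≈ s * sum x
  sum-*ˡ s x = ≈-sym (*-distribˡ-sum s x)

  sum-nonneg : ∀ {n} {x : Euclidean (Fin n)} → (∀ i → 0# ≤ x i) → 0# ≤ sum x
  sum-nonneg {zero}  h = ≤-refl
  sum-nonneg {suc n} h = 0≤+ (h zero) (sum-nonneg (h ∘ suc))

  -- A simplicial complex, given by the down-closed class of those vertex sets
  -- that are contained in a simplex.
  record Complex (n : ℕ) : Set₁ where
    field
      Face : (Fin n → Set) → Set
      down : ∀ {P Q} → (∀ v → P v → Q v) → Face Q → Face P
  open Complex public

  -- A predicate and not a `Subset`, since being nonzero is not decided by computation; this is why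
  -- faces are predicates as well.
  supp : Euclidean (Fin n) → Fin n → Set
  supp x v = ¬ x v ≈ 0#

  ∣_∣ᶜ : Complex n → Space (Fin n)
  ∣ K ∣ᶜ x = (∀ v → 0# ≤ x v) × sum x ≈ 1# × Face K (supp x)

  ∣∣-saturated : (K : Complex n) → Saturated ∣ K ∣ᶜ
  ∣∣-saturated K x≋y (x≥0 , Σx≈1 , x∈) =
    (λ v → ≤-respʳ (x≋y v) (x≥0 v)) , ≈-trans (≈-sym (sum-cong-≋ x≋y)) Σx≈1 ,
    down K (λ v y≉0 x≈0 → y≉0 (≈-trans (≈-sym (x≋y v)) x≈0)) x∈

  infix 4 _⊑_ _≃ᶜ_
  _⊑_ : Complex n → Complex n → Set₁
  K ⊑ L = ∀ P → Face K P → Face L P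

  record _≃ᶜ_ {m n} (K : Complex m) (L : Complex n) : Set where
    constructor [_]
    field equivalence : ∣ K ∣ᶜ ≃ᵗ ∣ L ∣ᶜ
  open _≃ᶜ_ public

  ≃ᶜ-sym : ∀ {m n} {K : Complex m} {L : Complex n} → K ≃ᶜ L → L ≃ᶜ K
  ≃ᶜ-sym [ e ] = [ ≃ᵗ-sym e ]

  infixr 5 _⟫_
  _⟫_ : ∀ {l m n} {K : Complex l} {L : Complex m} {M : Complex n} → K ≃ᶜ L → L ≃ᶜ M → K ≃ᶜ M
  _⟫_ {K = K} {M = M} [ e ] [ f ] = [ ≃ᵗ-trans (uniform-Fin _) (uniform-Fin _) (∣∣-saturated K) (∣∣-saturated M) e f ]

  ≃ᶜ-ext : {K L : Complex n} → K ⊑ L → L ⊑ K → K ≃ᶜ L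
  ≃ᶜ-ext K⊑L L⊑K = [ ≃ᵗ-ext (λ _ (p , q , r) → p , q , K⊑L _ r) (λ _ (p , q , r) → p , q , L⊑K _ r) ]

  -- The case `a ≡ b` is allowed: `Face K (Pair v v)` says that `v` is a vertex of `K`, so vertices
  -- and edges are treated alike.
  Pair : Fin n → Fin n → Fin n → Set
  Pair a b v = v ≡ a ⊎ v ≡ b

  Triple : Fin n → Fin n → Fin n → Fin n → Set
  Triple a b c v = v ≡ a ⊎ v ≡ b ⊎ v ≡ c

  infixl 6 _∪ᵉ_ _∖_
  _∪ᵉ_ : Complex n → Fin n × Fin n → Complex n
  K ∪ᵉ (a , b) = record
    { Face = λ P → Face K P ⊎ (∀ v → P v → Pair a b v)
    ; down = λ P⊆Q → λ { (inj₁ q) → inj₁ (down K P⊆Q q) ; (inj₂ q) → inj₂ (λ v p → q v (P⊆Q v p)) } }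

  -- Deletion of the open star of the face {a, b}: of an edge or, for `a ≡ b`, of a vertex with
  -- everything at it.
  _∖_ : Complex n → Fin n × Fin n → Complex n
  K ∖ (a , b) = record
    { Face = λ P → Face K P × ¬ (P a × P b)
    ; down = λ P⊆Q (q , ¬ab) → down K P⊆Q q , λ (pa , pb) → ¬ab (P⊆Q _ pa , P⊆Q _ pb) }

  _↛_ : Complex n → Fin n × Fin n → Set₁
  K ↛ (a , b) = ∀ P → Face K P → P a → P b → ⊥

  -- The free face {a, b} (a vertex if a ≡ b) is pushed across {a, b, c} along
  -- κ c - χ, where χ is the indicator of {a, b} and κ its total mass.
  module Collapse (K : Complex n) {a b c : Fin n} (c≢a : c ≢ a) (c≢b : c ≢ b)
    (abc : Face K (Triple a b c)) (free : ∀ P → Face K P → P a → P b → ∀ v → P v → Triple a b c v) where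

    position : ∀ i → i ≡ c ⊎ i ≢ c × (i ≡ a ⊎ i ≡ b ⊎ i ≢ a × i ≢ b)
    position i with i Fin.≟ c | i Fin.≟ a | i Fin.≟ b
    ... | yes i≡c | _       | _       = inj₁ i≡c
    ... | no i≢c  | yes i≡a | _       = inj₂ (i≢c , inj₁ i≡a)
    ... | no i≢c  | no _    | yes i≡b = inj₂ (i≢c , inj₂ (inj₁ i≡b))
    ... | no i≢c  | no i≢a  | no i≢b  = inj₂ (i≢c , inj₂ (inj₂ (i≢a , i≢b)))

    χ : Fin n → ℝ
    χ i with i Fin.≟ a | i Fin.≟ b
    ... | no _ | no _ = 0#
    ... | _    | _    = 1#

    χ-a : χ a ≈ 1#
    χ-a with a Fin.≟ a | a Fin.≟ b
    ... | no a≢a | _ = ⊥-elim (a≢a refl)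
    ... | yes _  | _ = ≈-refl

    χ-b : χ b ≈ 1#
    χ-b with b Fin.≟ a | b Fin.≟ b
    ... | _     | no b≢b = ⊥-elim (b≢b refl)
    ... | yes _ | yes _ = ≈-refl
    ... | no _  | yes _ = ≈-refl

    χ-other : ∀ {i} → i ≢ a → i ≢ b → χ i ≈ 0#
    χ-other {i} i≢a i≢b with i Fin.≟ a | i Fin.≟ b
    ... | yes i≡a | _       = ⊥-elim (i≢a i≡a)
    ... | no _    | yes i≡b = ⊥-elim (i≢b i≡b)
    ... | no _    | no _    = ≈-refl

    0≤χ : ∀ i → 0# ≤ χ i
    0≤χ i with i Fin.≟ a | i Fin.≟ b
    ... | no _  | no _  = ≤-refl
    ... | no _  | yes _ = 0≤1
    ... | yes _ | _     = 0≤1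

    κ : ℝ
    κ = sum χ

    d : Fin n → ℝ
    d i = κ * δ c i - χ i

    d-sum : sum d ≈ 0#
    d-sum = ≈-trans (∑-distrib-+ (λ i → κ * δ c i) (λ i → - χ i))
      (≈-trans (+-cong (≈-trans (sum-*ˡ κ (δ c)) (≈-trans (*-congˡ (sum-δ c)) (*-identityʳ κ)))
                       (≈-trans (sum-cong-≋ (λ i → solve 1 (λ x → :- x := (:- :1) :* x) ≈-refl (χ i))) (sum-*ˡ (- 1#) χ)))
               (solve 1 (λ k → k :+ (:- :1) :* k := :0) ≈-refl κ))

    d-ab : ∀ {i} → i ≢ c → χ i ≈ 1# → d i ≈ - 1#
    d-ab i≢c χi = ≈-trans (+-cong (*-congˡ (δ-≢ i≢c)) (-‿cong χi)) (solve 1 (λ k → k :* :0 :- :1 := :- :1) ≈-refl κ)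

    d-c : d c ≈ κ
    d-c = ≈-trans (+-cong (*-congˡ (δ-refl c)) (-‿cong (χ-other c≢a c≢b))) (solve 1 (λ k → k :* :1 :- :0 := k) ≈-refl κ)

    d-other : ∀ {i} → i ≢ a → i ≢ b → i ≢ c → d i ≈ 0#
    d-other i≢a i≢b i≢c = ≈-trans (+-cong (*-congˡ (δ-≢ i≢c)) (-‿cong (χ-other i≢a i≢b)))
      (solve 1 (λ k → k :* :0 :- :0 := :0) ≈-refl κ)

    -- The longest admissible push: at `m x` the smaller of the coordinates at `a` and `b` reaches 0
    -- and the point leaves the open star of {a, b}. Points already outside that star have `m x ≈ 0`
    -- and stay fixed.
    m : Euclidean (Fin n) → ℝ
    m x = x a ⊓ x b

    push : ℝ → Euclidean (Fin n) → Euclidean (Fin n)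
    push s x i = x i + s * d i

    push-sum : ∀ s x → sum (push s x) ≈ sum x
    push-sum s x = ≈-trans (∑-distrib-+ x (λ i → s * d i))
      (≈-trans (+-congˡ (≈-trans (sum-*ˡ s d) (≈-trans (*-congˡ d-sum) (zeroʳ s)))) (+-identityʳ _))

    push-ab : ∀ s x {i} → i ≢ c → χ i ≈ 1# → push s x i ≈ x i - s
    push-ab s x {i} i≢c χi = ≈-trans (+-congˡ (*-congˡ (d-ab i≢c χi)))
      (solve 2 (λ x s → x :+ s :* (:- :1) := x :- s) ≈-refl (x i) s)

    push-0 : ∀ {s x} → s ≈ 0# → push s x ≋ x
    push-0 s≈0 i = ≈-trans (+-congˡ (≈-trans (*-congʳ s≈0) (zeroˡ _))) (+-identityʳ _)

    push-other : ∀ s x {i} → i ≢ a → i ≢ b → i ≢ c → push s x i ≈ x i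
    push-other s x i≢a i≢b i≢c = ≈-trans (+-congˡ (≈-trans (*-congˡ (d-other i≢a i≢b i≢c)) (zeroʳ s))) (+-identityʳ _)

    push-nonneg : ∀ {s x} → (∀ i → 0# ≤ x i) → 0# ≤ s → s ≤ m x → ∀ i → 0# ≤ push s x i
    push-nonneg {s} {x} x≥0 0≤s s≤m i with position i
    ... | inj₁ refl = 0≤+ (x≥0 c) (*-nonneg 0≤s (≤-respʳ (≈-sym d-c) (sum-nonneg 0≤χ)))
    ... | inj₂ (i≢c , inj₁ refl) = ≤-respʳ (≈-sym (push-ab s x i≢c χ-a)) (0≤- (≤-trans s≤m (x⊓y≤x _ _)))
    ... | inj₂ (i≢c , inj₂ (inj₁ refl)) = ≤-respʳ (≈-sym (push-ab s x i≢c χ-b)) (0≤- (≤-trans s≤m (x⊓y≤y _ _)))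
    ... | inj₂ (i≢c , inj₂ (inj₂ (i≢a , i≢b))) = ≤-respʳ (≈-sym (push-other s x i≢a i≢b i≢c)) (x≥0 i)

    -- Either nothing moves, or `a` and `b` both lie in the support of `x`; then freeness confines
    -- the support to {a, b, c}, and the push stays inside this face.
    push∈ : ∀ {s x} → 0# ≤ s → s ≤ m x → ∣ K ∣ᶜ x → ∣ K ∣ᶜ (push s x)
    push∈ {s} {x} 0≤s s≤m x∈@(x≥0 , Σx≈1 , F) with dec {m x ≈ 0#}
    ... | yes m≈0 = ∣∣-saturated K (λ i → ≈-sym (push-0 {x = x} (≤-antisym (≤-respʳ m≈0 s≤m) 0≤s) i)) x∈
    ... | no m≉0 = push-nonneg x≥0 0≤s s≤m , ≈-trans (push-sum s x) Σx≈1 , down K inside abc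
      where
      a∈ : supp x a
      a∈ a≈0 = m≉0 (≤-antisym (≤-trans (x⊓y≤x _ _) (≤-reflexive a≈0)) (≤-trans 0≤s s≤m))
      b∈ : supp x b
      b∈ b≈0 = m≉0 (≤-antisym (≤-trans (x⊓y≤y _ _) (≤-reflexive b≈0)) (≤-trans 0≤s s≤m))
      inside : ∀ v → supp (push s x) v → Triple a b c v
      inside v v∈ with position v
      ... | inj₁ v≡c = inj₂ (inj₂ v≡c)
      ... | inj₂ (_ , inj₁ v≡a) = inj₁ v≡a
      ... | inj₂ (_ , inj₂ (inj₁ v≡b)) = inj₂ (inj₁ v≡b)
      ... | inj₂ (v≢c , inj₂ (inj₂ (v≢a , v≢b))) =
        free (supp x) F a∈ b∈ v (λ x≈0 → v∈ (≈-trans (push-other s x v≢a v≢b v≢c) x≈0))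

    0≤m : ∀ {x} → (∀ i → 0# ≤ x i) → 0# ≤ m x
    0≤m x≥0 = 0≤⊓ (x≥0 a) (x≥0 b)

    r : Euclidean (Fin n) → Euclidean (Fin n)
    r x = push (m x) x

    r∈ : ∀ x → ∣ K ∣ᶜ x → ∣ K ∖ (a , b) ∣ᶜ (r x)
    r∈ x x∈@(x≥0 , _) with push∈ (0≤m {x} x≥0) ≤-refl x∈
    ... | (p , q , F) = p , q , F , λ (a∈ , b∈) → [
        (λ xa≤xb → a∈ (≈-trans (push-ab (m x) x (λ { refl → c≢a refl }) χ-a)
          (≈-trans (+-congˡ (-‿cong (x≤y⇒x⊓y≈x xa≤xb))) (-‿inverseʳ _)))) ,
        (λ xb≤xa → b∈ (≈-trans (push-ab (m x) x (λ { refl → c≢b refl }) χ-b)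
          (≈-trans (+-congˡ (-‿cong (y≤x⇒x⊓y≈y xb≤xa))) (-‿inverseʳ _)))) ]′ (total (x a) (x b))

    r-id : ∀ y → ∣ K ∖ (a , b) ∣ᶜ y → r y ≋ y
    r-id y (y≥0 , _ , _ , ¬ab) = push-0 {x = y} (byContradiction λ m≉0 → ¬ab
      ((λ ya≈0 → m≉0 (≤-antisym (≤-trans (x⊓y≤x _ _) (≤-reflexive ya≈0)) (0≤m {y} y≥0))) ,
       (λ yb≈0 → m≉0 (≤-antisym (≤-trans (x⊓y≤y _ _) (≤-reflexive yb≈0)) (0≤m {y} y≥0)))))

    m-cont : Contℝ m
    m-cont = cont-⊓ (cont-proj a) (cont-proj b)

    D : Deformation ∣ K ∣ᶜ r
    D = record
      { H = λ p → push ((1# - p nothing) * m (p ∘ just)) (p ∘ just)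
      ; H-cont = cont-coords (uniform-Fin n) λ i → cont-+ (cont-proj (just i))
          (cont-* (cont-* (cont-- (cont-const 1#) (cont-proj nothing)) (cont-∘ℝ m-cont (cont-reindex just))) (cont-const (d i)))
      ; H∈ = λ p ((0≤t , t≤1) , x∈) → let 0≤mp = 0≤m {p ∘ just} (proj₁ x∈) in
          push∈ {x = p ∘ just} (*-nonneg (0≤- t≤1) 0≤mp)
            (≤-by (*-nonneg 0≤t 0≤mp)
              (solve 2 (λ t m → m :- (:1 :- t) :* m := t :* m) ≈-refl (p nothing) (m (p ∘ just)))) x∈
      ; H-0 = λ p _ t≈0 i → +-congˡ (*-congʳ (≈-trans (*-congʳ (+-congˡ (-‿cong t≈0)))
          (solve 1 (λ m → (:1 :- :0) :* m := m) ≈-refl (m (p ∘ just)))))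
      ; H-1 = λ p _ t≈1 → push-0 {x = p ∘ just} (≈-trans (*-congʳ (+-congˡ (-‿cong t≈1)))
          (solve 1 (λ m → (:1 :- :1) :* m := :0) ≈-refl (m (p ∘ just))))
      }

    collapse : K ≃ᶜ K ∖ (a , b)
    collapse = [ retraction r
      (cont-coords (uniform-Fin n) λ i → cont-+ (cont-proj i) (cont-* m-cont (cont-const (d i))))
      (λ _ (p , q , F , _) → p , q , F) r∈ r-id D ]

  grow : Complex n → Fin n → Complex (suc n)
  grow K c = record
    { Face = λ P → (¬ P zero × Face K (P ∘ suc)) ⊎ (∀ v → P v → Pair zero (suc c) v)
    ; down = λ P⊆Q → λ
        { (inj₁ (q , F)) → inj₁ ((λ p → q (P⊆Q _ p)) , down K (λ v → P⊆Q (suc v)) F)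
        ; (inj₂ q) → inj₂ λ v p → q v (P⊆Q v p) } }

  -- The homotopy carries the mass of the new vertex to `c`. This is again the collapse of a leaf,
  -- but it changes the set of coordinates, hence the separate formulas.
  module Grow (K : Complex n) (c : Fin n) (c∈K : Face K (_≡ c)) where

    f : Euclidean (Fin n) → Euclidean (Fin (suc n))
    f x zero    = 0#
    f x (suc i) = x i

    g : Euclidean (Fin (suc n)) → Euclidean (Fin n)
    g y i = y (suc i) + y zero * δ c i

    f∈ : ∀ x → ∣ K ∣ᶜ x → ∣ grow K c ∣ᶜ (f x)
    f∈ x (x≥0 , Σx≈1 , F) =
      (λ { zero → ≤-refl ; (suc i) → x≥0 i }) , ≈-trans (+-identityˡ _) Σx≈1 , inj₁ ((λ 0≉0 → 0≉0 ≈-refl) , F)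

    g∈ : ∀ y → ∣ grow K c ∣ᶜ y → ∣ K ∣ᶜ (g y)
    g∈ y (y≥0 , Σy≈1 , F) =
      (λ i → 0≤+ (y≥0 (suc i)) (*-nonneg (y≥0 zero) (0≤δ c i))) ,
      ≈-trans (∑-distrib-+ (y ∘ suc) (λ i → y zero * δ c i))
        (≈-trans (+-congˡ (≈-trans (sum-*ˡ (y zero) (δ c)) (≈-trans (*-congˡ (sum-δ c)) (*-identityʳ _))))
          (≈-trans (+-comm _ _) Σy≈1)) ,
      face F
      where
      face : Face (grow K c) (supp y) → Face K (supp (g y))
      face (inj₁ (¬0 , F′)) = down K (λ v gv≉0 yv≈0 → gv≉0
        (≈-trans (+-cong yv≈0 (*-congʳ (byContradiction ¬0)))
          (≈-trans (+-identityˡ _) (zeroˡ _)))) F′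
      face (inj₂ h) = down K (λ v gv≉0 → byContradiction λ v≢c → gv≉0
        (≈-trans (+-cong (byContradiction λ y≉0 → [ (λ ()) , (λ { refl → v≢c refl }) ]′ (h (suc v) y≉0))
            (≈-trans (*-congˡ (δ-≢ v≢c)) (zeroʳ _))) (+-identityˡ _))) c∈K

    D : Deformation ∣ grow K c ∣ᶜ (f ∘ g)
    D = record
      { H = H
      ; H-cont = cont-coords (uniform-Fin (suc n)) λ where
          zero → cont-* (cont-proj nothing) (cont-proj (just zero))
          (suc i) → cont-+ (cont-proj (just (suc i)))
            (cont-* (cont-* (cont-- (cont-const 1#) (cont-proj nothing)) (cont-proj (just zero))) (cont-const (δ c i)))
      ; H∈ = H∈
      ; H-0 = λ where
          p _ t≈0 zero → ≈-trans (*-congʳ t≈0) (zeroˡ _)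
          p _ t≈0 (suc i) → +-congˡ (*-congʳ (≈-trans (*-congʳ (+-congˡ (-‿cong t≈0)))
            (solve 1 (λ m → (:1 :- :0) :* m := m) ≈-refl (p (just zero)))))
      ; H-1 = λ where
          p _ t≈1 zero → ≈-trans (*-congʳ t≈1) (*-identityˡ _)
          p _ t≈1 (suc i) → ≈-trans (+-congˡ (*-congʳ (*-congʳ (+-congˡ (-‿cong t≈1)))))
            (solve 3 (λ x m d → x :+ (:1 :- :1) :* m :* d := x) ≈-refl (p (just (suc i))) (p (just zero)) (δ c i))
      }
      where
      H : Euclidean (Maybe (Fin (suc n))) → Euclidean (Fin (suc n))
      H p zero    = p nothing * p (just zero)
      H p (suc i) = p (just (suc i)) + (1# - p nothing) * p (just zero) * δ c i
      H∈ : ∀ p → Cylinder ∣ grow K c ∣ᶜ p → ∣ grow K c ∣ᶜ (H p)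
      H∈ p ((0≤t , t≤1) , y≥0 , Σy≈1 , F) =
        (λ { zero → *-nonneg 0≤t (y≥0 zero)
           ; (suc i) → 0≤+ (y≥0 (suc i)) (*-nonneg (*-nonneg (0≤- t≤1) (y≥0 zero)) (0≤δ c i)) }) ,
        ≈-trans (+-congˡ (≈-trans (∑-distrib-+ (λ i → p (just (suc i))) (λ i → (1# - p nothing) * p (just zero) * δ c i))
            (+-congˡ (≈-trans (sum-*ˡ _ (δ c)) (*-congˡ (sum-δ c))))))
          (≈-trans (solve 3 (λ t y s → t :* y :+ (s :+ (:1 :- t) :* y :* :1) := y :+ s) ≈-refl
            (p nothing) (p (just zero)) (sum (λ i → p (just (suc i))))) Σy≈1) ,
        face F
        where
        face : Face (grow K c) (supp (p ∘ just)) → Face (grow K c) (supp (H p))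
        face (inj₁ (¬0 , F′)) = inj₁
          ((λ h → h (≈-trans (*-congˡ (byContradiction ¬0)) (zeroʳ _))) ,
           down K (λ v Hv≉0 yv≈0 → Hv≉0 (≈-trans (+-cong yv≈0 (*-congʳ (*-congˡ (byContradiction ¬0))))
             (solve 2 (λ t d → :0 :+ t :* :0 :* d := :0) ≈-refl (1# - p nothing) (δ c v)))) F′)
        face (inj₂ h) = inj₂ λ where
          zero _ → inj₁ refl
          (suc v) Hv≉0 → byContradiction λ ¬pair → Hv≉0
            (≈-trans (+-cong (byContradiction λ y≉0 → ¬pair (h (suc v) y≉0))
              (*-congˡ (δ-≢ {i = c} λ v≡c → ¬pair (inj₂ (≡.cong suc v≡c)))))
              (≈-trans (+-identityˡ _) (zeroʳ _)))

    grow-≃ : K ≃ᶜ grow K c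
    grow-≃ = [ record
      { to = f ; from = g
      ; to-cont = cont-coords (uniform-Fin (suc n)) λ { zero → cont-const 0# ; (suc i) → cont-proj i }
      ; from-cont = cont-coords (uniform-Fin n) λ i →
          cont-+ (cont-proj (suc i)) (cont-* (cont-proj zero) (cont-const (δ c i)))
      ; to∈ = f∈ ; from∈ = g∈
      ; left = deformation-const λ x _ i → ≈-trans (+-congˡ (zeroˡ _)) (+-identityʳ _)
      ; right = D } ]

  -- Slides and petals

  pair-swap : {a b : Fin n} → ∀ v → Pair a b v → Pair b a v
  pair-swap v (inj₁ p) = inj₂ p
  pair-swap v (inj₂ p) = inj₁ p

  ↛-∪ᵉ : {X : Complex n} {a b c d : Fin n} → X ↛ (a , b) → ¬ Pair c d a ⊎ ¬ Pair c d b → (X ∪ᵉ (c , d)) ↛ (a , b)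
  ↛-∪ᵉ X↛ _         P (inj₁ F) Pa Pb = X↛ P F Pa Pb
  ↛-∪ᵉ X↛ (inj₁ ¬a) P (inj₂ h) Pa Pb = ¬a (h _ Pa)
  ↛-∪ᵉ X↛ (inj₂ ¬b) P (inj₂ h) Pa Pb = ¬b (h _ Pb)

  infixl 6 _∪ᵗ_
  _∪ᵗ_ : Complex n → Fin n × Fin n × Fin n → Complex n
  K ∪ᵗ (a , b , c) = record
    { Face = λ P → Face K P ⊎ (∀ v → P v → Triple a b c v)
    ; down = λ P⊆Q → λ { (inj₁ q) → inj₁ (down K P⊆Q q) ; (inj₂ q) → inj₂ (λ v p → q v (P⊆Q v p)) } }

  -- The edge {e, q} is free in the filled triangle because `X` has no face containing it. After the
  -- collapse {e, p} is what remains of the triangle, {p, q} belonging to `X` anyway.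
  triangle-collapse : (X : Complex n) {e p q : Fin n} → e ≢ p → e ≢ q → p ≢ q →
    Face X (Pair p q) → X ↛ (e , q) → X ∪ᵗ (e , p , q) ≃ᶜ X ∪ᵉ (e , p)
  triangle-collapse X {e} {p} {q} e≢p e≢q p≢q pq X↛ =
    Collapse.collapse (X ∪ᵗ (e , p , q)) {e} {q} {p} (λ p≡e → e≢p (≡.sym p≡e)) p≢q (inj₂ perm)
      (λ { P (inj₁ F) Pe Pq → ⊥-elim (X↛ P F Pe Pq) ; P (inj₂ h) _ _ v Pv → perm v (h v Pv) })
    ⟫ ≃ᶜ-ext to from
    where
    perm : ∀ {a b c : Fin _} v → Triple a b c v → Triple a c b v
    perm v (inj₁ x)        = inj₁ x
    perm v (inj₂ (inj₁ x)) = inj₂ (inj₂ x)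
    perm v (inj₂ (inj₂ x)) = inj₂ (inj₁ x)
    to : (X ∪ᵗ (e , p , q)) ∖ (e , q) ⊑ X ∪ᵉ (e , p)
    to P (inj₁ F , _) = inj₁ F
    to P (inj₂ h , ¬eq) with dec {P e}
    ... | yes Pe = inj₂ λ v Pv → case v Pv (h v Pv)
      where
      case : ∀ v → P v → Triple e p q v → Pair e p v
      case v Pv (inj₁ x)           = inj₁ x
      case v Pv (inj₂ (inj₁ x))    = inj₂ x
      case v Pv (inj₂ (inj₂ refl)) = ⊥-elim (¬eq (Pe , Pv))
    ... | no ¬Pe = inj₁ (down X (λ v Pv → case v Pv (h v Pv)) pq)
      where
      case : ∀ v → P v → Triple e p q v → Pair p q v
      case v Pv (inj₁ refl) = ⊥-elim (¬Pe Pv)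
      case v Pv (inj₂ x)    = x
    from : X ∪ᵉ (e , p) ⊑ (X ∪ᵗ (e , p , q)) ∖ (e , q)
    from P (inj₁ F) = inj₁ F , λ (Pe , Pq) → X↛ P F Pe Pq
    from P (inj₂ h) = inj₂ (λ v Pv → [ inj₁ , (λ x → inj₂ (inj₁ x)) ]′ (h v Pv)) ,
      λ (_ , Pq) → [ (λ q≡e → e≢q (≡.sym q≡e)) , (λ q≡p → p≢q (≡.sym q≡p)) ]′ (h q Pq)

  -- Both complexes are collapses of `X` with the filled triangle {e, p, q}, through {e, q} and
  -- through {e, p} respectively.
  slide : (X : Complex n) {e p q : Fin n} → e ≢ p → e ≢ q → p ≢ q →
    Face X (Pair p q) → X ↛ (e , p) → X ↛ (e , q) → X ∪ᵉ (e , p) ≃ᶜ X ∪ᵉ (e , q)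
  slide X {e} {p} {q} e≢p e≢q p≢q pq X↛p X↛q =
    ≃ᶜ-sym (triangle-collapse X e≢p e≢q p≢q pq X↛q) ⟫ ≃ᶜ-ext (perm p q) (perm q p) ⟫
    triangle-collapse X e≢q e≢p (λ q≡p → p≢q (≡.sym q≡p)) (down X pair-swap pq) X↛p
    where
    perm : ∀ p q → X ∪ᵗ (e , p , q) ⊑ X ∪ᵗ (e , q , p)
    perm p q P (inj₁ F) = inj₁ F
    perm p q P (inj₂ h) = inj₂ λ v Pv → [ inj₁ , [ (λ x → inj₂ (inj₂ x)) , (λ x → inj₂ (inj₁ x)) ]′ ]′ (h v Pv)

  -- The degenerate case of `Collapse` in which the free face is the vertex `v` and the triangle is
  -- the edge {v, c}.
  leaf-collapse : (X : Complex n) {v c : Fin n} → v ≢ c → Face X (Pair c c) → X ↛ (v , v) → X ∪ᵉ (v , c) ≃ᶜ X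
  leaf-collapse X {v} {c} v≢c cc X↛ =
    Collapse.collapse (X ∪ᵉ (v , c)) {v} {v} {c} (λ c≡v → v≢c (≡.sym c≡v)) (λ c≡v → v≢c (≡.sym c≡v))
      (inj₂ λ _ → λ { (inj₁ x) → inj₁ x ; (inj₂ x) → x })
      (λ { P (inj₁ F) Pv _ → ⊥-elim (X↛ P F Pv Pv) ; P (inj₂ h) _ _ u Pu → inj₂ (h u Pu) })
    ⟫ ≃ᶜ-ext to (λ P F → inj₁ F , λ (Pv , _) → X↛ P F Pv Pv)
    where
    to : (X ∪ᵉ (v , c)) ∖ (v , v) ⊑ X
    to P (inj₁ F , _)  = F
    to P (inj₂ h , ¬v) = down X (λ u Pu → case u Pu (h u Pu)) cc
      where
      case : ∀ u → P u → Pair v c u → Pair c c u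
      case u Pu (inj₁ refl) = ⊥-elim (¬v (Pu , Pu))
      case u Pu (inj₂ x)    = inj₁ x

  old : Complex n → Complex (suc (suc n))
  old X = record
    { Face = λ P → ¬ P zero × ¬ P (suc zero) × Face X (λ v → P (suc (suc v)))
    ; down = λ P⊆Q (¬0 , ¬1 , F) → (λ p → ¬0 (P⊆Q _ p)) , (λ p → ¬1 (P⊆Q _ p)) , down X (λ v → P⊆Q (suc (suc v))) F }

  -- The wedge at r of X with the boundary of the triangle {0, 1, r}.
  Petal : Complex n → Fin n → Complex (suc (suc n))
  Petal X r = old X ∪ᵉ (zero , suc zero) ∪ᵉ (zero , suc (suc r)) ∪ᵉ (suc zero , suc (suc r))

  module _ {a b : Fin n} where
    ss : Fin n → Fin (suc (suc n))
    ss i = suc (suc i)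

    pair-ss : ∀ v → Pair a b v → Pair (ss a) (ss b) (ss v)
    pair-ss v (inj₁ refl) = inj₁ refl
    pair-ss v (inj₂ refl) = inj₂ refl

    pair-ss⁻¹ : ∀ v → Pair (ss a) (ss b) (ss v) → Pair a b v
    pair-ss⁻¹ v (inj₁ refl) = inj₁ refl
    pair-ss⁻¹ v (inj₂ refl) = inj₂ refl

    ¬pair-0 : ¬ Pair (ss a) (ss b) zero
    ¬pair-0 = [ (λ ()) , (λ ()) ]′

    ¬pair-1 : ¬ Pair (ss a) (ss b) (suc zero)
    ¬pair-1 = [ (λ ()) , (λ ()) ]′

    old-pair : {X : Complex n} → Face X (Pair a b) → Face (old X) (Pair (ss a) (ss b))
    old-pair {X} F = ¬pair-0 , ¬pair-1 , down X pair-ss⁻¹ F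

    from-old : {P : Fin (suc (suc n)) → Set} → ¬ P zero → ¬ P (suc zero) →
      (∀ v → P (ss v) → Pair a b v) → ∀ v → P v → Pair (ss a) (ss b) v
    from-old ¬0 ¬1 h zero          P0 = ⊥-elim (¬0 P0)
    from-old ¬0 ¬1 h (suc zero)    P1 = ⊥-elim (¬1 P1)
    from-old ¬0 ¬1 h (suc (suc v)) Pv = pair-ss v (h v Pv)

    old-∪ᵉ : {X : Complex n} → old (X ∪ᵉ (a , b)) ⊑ old X ∪ᵉ (ss a , ss b)
    old-∪ᵉ P (¬0 , ¬1 , inj₁ F) = inj₁ (¬0 , ¬1 , F)
    old-∪ᵉ P (¬0 , ¬1 , inj₂ h) = inj₂ (from-old ¬0 ¬1 h)

    ∪ᵉ-old : {X : Complex n} → old X ∪ᵉ (ss a , ss b) ⊑ old (X ∪ᵉ (a , b))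
    ∪ᵉ-old P (inj₁ (¬0 , ¬1 , F)) = ¬0 , ¬1 , inj₁ F
    ∪ᵉ-old P (inj₂ h) = (λ p → ¬pair-0 (h _ p)) , (λ p → ¬pair-1 (h _ p)) , inj₂ (λ v p → pair-ss⁻¹ v (h _ p))

  suc-suc-≢ : {i j : Fin n} → i ≢ j → Fin.suc (Fin.suc i) ≢ suc (suc j)
  suc-suc-≢ i≢j refl = i≢j refl

  ∉pair : {a b v : Fin n} → v ≢ a → v ≢ b → ¬ Pair a b v
  ∉pair v≢a v≢b = [ v≢a , v≢b ]′

  -- The edge {w, v} is stretched to a path w - 0 - 1 - v, whose ends are then
  -- slid to r along {w, r} and {v, r}.
  petalize : (Q : Complex n) {r v w : Fin n} → v ≢ r → w ≢ r → v ≢ w →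
    Face Q (Pair v r) → Face Q (Pair w r) → Q ↛ (w , v) → Q ∪ᵉ (w , v) ≃ᶜ Petal Q r
  petalize {n} Q {r} {v} {w} v≢r w≢r v≢w vr wr Q↛ =
    Grow.grow-≃ Q⁺ v (inj₂ λ _ → inj₂) ⟫
    Grow.grow-≃ (grow Q⁺ v) zero (inj₂ λ _ → inj₁) ⟫
    ≃ᶜ-ext to from ⟫
    -- The two added edges form a tail v - 1 - 0. Along it the end `v` of the edge {w, v} slides to
    -- 1 and then to 0, which leaves the path w - 0 - 1 - v.
    slide X w≢v′ (λ ()) (λ ()) (inj₁ (inj₂ pair-swap)) X↛wv X↛w1 ⟫
    slide X (λ ()) (λ ()) (λ ()) (inj₂ pair-swap) X↛w1 X↛w0 ⟫
    ≃ᶜ-ext swap swap ⟫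
    slide X (λ ()) (λ ()) (suc-suc-≢ w≢r) (inj₁ (inj₁ (old-pair {X = Q} wr))) X↛0w X↛0r ⟫
    ≃ᶜ-ext regroup regroup⁻¹ ⟫
    slide Y (λ ()) (λ ()) (suc-suc-≢ v≢r) (inj₁ (inj₁ (old-pair {X = Q} vr))) Y↛1v Y↛1r
    where
    0′ 1′ r′ v′ w′ : Fin (suc (suc n))
    0′ = zero
    1′ = suc zero
    r′ = suc (suc r)
    v′ = suc (suc v)
    w′ = suc (suc w)
    Q⁺ : Complex n
    Q⁺ = Q ∪ᵉ (w , v)
    X Y : Complex (suc (suc n))
    X = old Q ∪ᵉ (1′ , v′) ∪ᵉ (0′ , 1′)
    Y = old Q ∪ᵉ (0′ , 1′) ∪ᵉ (0′ , r′)
    w≢v′ : w′ ≢ v′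
    w≢v′ = suc-suc-≢ (λ w≡v → v≢w (≡.sym w≡v))
    old↛0 : ∀ {a} → old Q ↛ (0′ , a)
    old↛0 P (¬0 , _) p _ = ¬0 p
    old↛1 : ∀ {a} → old Q ↛ (1′ , a)
    old↛1 P (_ , ¬1 , _) p _ = ¬1 p
    X↛wv : X ↛ (w′ , v′)
    X↛wv = ↛-∪ᵉ {X = old Q ∪ᵉ (1′ , v′)} (↛-∪ᵉ {X = old Q} (λ P (_ , _ , F) → Q↛ _ F)
      (inj₁ (∉pair (λ ()) w≢v′))) (inj₁ (∉pair (λ ()) (λ ())))
    X↛w1 : X ↛ (w′ , 1′)
    X↛w1 = ↛-∪ᵉ {X = old Q ∪ᵉ (1′ , v′)} (↛-∪ᵉ {X = old Q} (λ P F p q → old↛1 P F q p)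
      (inj₁ (∉pair (λ ()) w≢v′))) (inj₁ (∉pair (λ ()) (λ ())))
    X↛0a : ∀ {a} → a ≢ 0′ → a ≢ 1′ → X ↛ (0′ , a)
    X↛0a a≢0 a≢1 = ↛-∪ᵉ {X = old Q ∪ᵉ (1′ , v′)} (↛-∪ᵉ {X = old Q} old↛0
      (inj₁ (∉pair (λ ()) (λ ())))) (inj₂ (∉pair a≢0 a≢1))
    X↛0w : X ↛ (0′ , w′)
    X↛0w = X↛0a (λ ()) (λ ())
    X↛0r : X ↛ (0′ , r′)
    X↛0r = X↛0a (λ ()) (λ ())
    X↛w0 : X ↛ (w′ , 0′)
    X↛w0 P F p q = X↛0w P F q p
    Y↛1a : ∀ {a} → a ≢ 0′ → a ≢ 1′ → Y ↛ (1′ , a)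
    Y↛1a a≢0 a≢1 = ↛-∪ᵉ {X = old Q ∪ᵉ (0′ , 1′)} (↛-∪ᵉ {X = old Q} old↛1
      (inj₂ (∉pair a≢0 a≢1))) (inj₁ (∉pair (λ ()) (λ ())))
    Y↛1v : Y ↛ (1′ , v′)
    Y↛1v = Y↛1a (λ ()) (λ ())
    Y↛1r : Y ↛ (1′ , r′)
    Y↛1r = Y↛1a (λ ()) (λ ())
    to : grow (grow Q⁺ v) zero ⊑ X ∪ᵉ (w′ , v′)
    to P (inj₁ (¬0 , inj₁ (¬1 , inj₁ F))) = inj₁ (inj₁ (inj₁ (¬0 , ¬1 , F)))
    to P (inj₁ (¬0 , inj₁ (¬1 , inj₂ h))) = inj₂ (from-old ¬0 ¬1 h)
    to P (inj₁ (¬0 , inj₂ h)) = inj₁ (inj₁ (inj₂ λ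
      { zero p → ⊥-elim (¬0 p) ; (suc u) p → [ (λ { refl → inj₁ refl }) , (λ { refl → inj₂ refl }) ]′ (h u p) }))
    to P (inj₂ h) = inj₁ (inj₂ h)
    from : X ∪ᵉ (w′ , v′) ⊑ grow (grow Q⁺ v) zero
    from P (inj₁ (inj₁ (inj₁ (¬0 , ¬1 , F)))) = inj₁ (¬0 , inj₁ (¬1 , inj₁ F))
    from P (inj₁ (inj₁ (inj₂ h))) = inj₁ ((λ p → [ (λ ()) , (λ ()) ]′ (h _ p)) ,
      inj₂ λ u p → [ (λ { refl → inj₁ refl }) , (λ { refl → inj₂ refl }) ]′ (h (suc u) p))
    from P (inj₁ (inj₂ h)) = inj₂ h
    from P (inj₂ h) = inj₁ ((λ p → ¬pair-0 (h _ p)) , inj₁ ((λ p → ¬pair-1 (h _ p)) , inj₂ λ u p → pair-ss⁻¹ u (h _ p)))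
    swap : ∀ {a b} → X ∪ᵉ (a , b) ⊑ X ∪ᵉ (b , a)
    swap P (inj₁ F) = inj₁ F
    swap P (inj₂ h) = inj₂ λ u p → pair-swap u (h u p)
    regroup : X ∪ᵉ (0′ , r′) ⊑ Y ∪ᵉ (1′ , v′)
    regroup P (inj₁ (inj₁ (inj₁ F))) = inj₁ (inj₁ (inj₁ F))
    regroup P (inj₁ (inj₁ (inj₂ h))) = inj₂ h
    regroup P (inj₁ (inj₂ h))        = inj₁ (inj₁ (inj₂ h))
    regroup P (inj₂ h)               = inj₁ (inj₂ h)
    regroup⁻¹ : Y ∪ᵉ (1′ , v′) ⊑ X ∪ᵉ (0′ , r′)
    regroup⁻¹ P (inj₁ (inj₁ (inj₁ F))) = inj₁ (inj₁ (inj₁ F))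
    regroup⁻¹ P (inj₂ h)               = inj₁ (inj₁ (inj₂ h))
    regroup⁻¹ P (inj₁ (inj₁ (inj₂ h))) = inj₁ (inj₂ h)
    regroup⁻¹ P (inj₁ (inj₂ h))        = inj₂ h

  -- Several petals at one vertex

  embed : ∀ k → Fin n → Fin (k ℕ.* 2 ℕ.+ n)
  embed zero    i = i
  embed (suc k) i = suc (suc (embed k i))

  embed-injective : ∀ k {i j : Fin n} → embed k i ≡ embed k j → i ≡ j
  embed-injective zero    p = p
  embed-injective (suc k) p = embed-injective k (Fin.suc-injective (Fin.suc-injective p))

  petals : ∀ k → Complex n → Fin n → Complex (k ℕ.* 2 ℕ.+ n)
  petals zero    K r = K
  petals (suc k) K r = Petal (petals k K r) (embed k r)

  Petal-mono : {K L : Complex n} {r : Fin n} → K ⊑ L → Petal K r ⊑ Petal L r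
  Petal-mono K⊑L P (inj₁ (inj₁ (inj₁ (¬0 , ¬1 , F)))) = inj₁ (inj₁ (inj₁ (¬0 , ¬1 , K⊑L _ F)))
  Petal-mono K⊑L P (inj₁ (inj₁ (inj₂ h))) = inj₁ (inj₁ (inj₂ h))
  Petal-mono K⊑L P (inj₁ (inj₂ h)) = inj₁ (inj₂ h)
  Petal-mono K⊑L P (inj₂ h) = inj₂ h

  petals-mono : ∀ k {K L : Complex n} {r : Fin n} → K ⊑ L → petals k K r ⊑ petals k L r
  petals-mono zero    K⊑L = K⊑L
  petals-mono (suc k) {K} {L} {r} K⊑L = Petal-mono {K = petals k K r} {petals k L r} (petals-mono k {K} {L} K⊑L)

  petals-∪ᵉ : ∀ k {K : Complex n} {r a b} → petals k (K ∪ᵉ (a , b)) r ⊑ petals k K r ∪ᵉ (embed k a , embed k b)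
  petals-∪ᵉ zero    P F = F
  petals-∪ᵉ (suc k) {K} {r} P F =
    sort {petals k K r} P (Petal-mono {K = petals k (K ∪ᵉ _) r} {petals k K r ∪ᵉ _} {embed k r} (petals-∪ᵉ k {K} {r}) P F)
    where
    sort : ∀ {X : Complex (k ℕ.* 2 ℕ.+ _)} {r a b} → Petal (X ∪ᵉ (a , b)) r ⊑ Petal X r ∪ᵉ (suc (suc a) , suc (suc b))
    sort {X} P (inj₁ (inj₁ (inj₁ F))) with old-∪ᵉ {X = X} P F
    ... | inj₁ F′ = inj₁ (inj₁ (inj₁ (inj₁ F′)))
    ... | inj₂ h  = inj₂ h
    sort P (inj₁ (inj₁ (inj₂ h))) = inj₁ (inj₁ (inj₁ (inj₂ h)))
    sort P (inj₁ (inj₂ h)) = inj₁ (inj₁ (inj₂ h))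
    sort P (inj₂ h) = inj₁ (inj₂ h)

  ∪ᵉ-petals : ∀ k {K : Complex n} {r a b} → petals k K r ∪ᵉ (embed k a , embed k b) ⊑ petals k (K ∪ᵉ (a , b)) r
  ∪ᵉ-petals zero    P F = F
  ∪ᵉ-petals (suc k) {K} {r} P F =
    Petal-mono {K = petals k K r ∪ᵉ _} {petals k (K ∪ᵉ _) r} {embed k r} (∪ᵉ-petals k {K} {r}) P (sort {petals k K r} P F)
    where
    sort : ∀ {X : Complex (k ℕ.* 2 ℕ.+ _)} {r a b} → Petal X r ∪ᵉ (suc (suc a) , suc (suc b)) ⊑ Petal (X ∪ᵉ (a , b)) r
    sort {X} P (inj₁ (inj₁ (inj₁ (inj₁ F)))) = inj₁ (inj₁ (inj₁ (∪ᵉ-old {X = X} P (inj₁ F))))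
    sort {X} P (inj₂ h) = inj₁ (inj₁ (inj₁ (∪ᵉ-old {X = X} P (inj₂ h))))
    sort P (inj₁ (inj₁ (inj₁ (inj₂ h)))) = inj₁ (inj₁ (inj₂ h))
    sort P (inj₁ (inj₁ (inj₂ h))) = inj₁ (inj₂ h)
    sort P (inj₁ (inj₂ h)) = inj₂ h

  petals-pair : ∀ k {K : Complex n} {r a b} → Face K (Pair a b) → Face (petals k K r) (Pair (embed k a) (embed k b))
  petals-pair zero    F = F
  petals-pair (suc k) {K} {r} F = inj₁ (inj₁ (inj₁ (old-pair {X = petals k K r} (petals-pair k {K} F))))

  -- The faces added by the petals contain no old vertex but `r`, so one of them can contain both
  -- `a` and `b` only if both are `r`.
  petals-↛ : ∀ k {K : Complex n} {r a b} → ¬ (a ≡ r × b ≡ r) → K ↛ (a , b) → petals k K r ↛ (embed k a , embed k b)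
  petals-↛ zero    _   K↛ = K↛
  petals-↛ (suc k) {K} {r} {a} {b} ¬rr K↛ =
    ↛-∪ᵉ {X = old X ∪ᵉ _ ∪ᵉ _} (↛-∪ᵉ {X = old X ∪ᵉ _} (↛-∪ᵉ {X = old X}
      (λ P (_ , _ , F) → petals-↛ k {K} ¬rr K↛ _ F)
      (inj₁ (∉pair (λ ()) (λ ())))) (off (λ ()))) (off (λ ()))
    where
    X = petals k K r
    ss-embed≢ : ∀ {i j : Fin _} → i ≢ j → embed (suc k) i ≢ embed (suc k) j
    ss-embed≢ i≢j p = i≢j (embed-injective (suc k) p)
    off : ∀ {c} → (∀ {i} → embed (suc k) i ≢ c) →
      ¬ Pair c (embed (suc k) r) (embed (suc k) a) ⊎ ¬ Pair c (embed (suc k) r) (embed (suc k) b)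
    off new with a Fin.≟ r
    ... | no a≢r   = inj₁ (∉pair new (ss-embed≢ a≢r))
    ... | yes refl = inj₂ (∉pair new (ss-embed≢ λ b≡r → ¬rr (refl , b≡r)))

  -- Reduction of connected graphs

  toSubset : (Fin n → Set) → Subset.Subset n
  toSubset P = Vec.tabulate λ i → does (dec {P i})

  ∈-toSubset : {P : Fin n → Set} → ∀ {i} → P i → i Subset.∈ toSubset P
  ∈-toSubset {P = P} {i} p = Vec.lookup⇒[]= i _ (≡.trans (Vec.lookup∘tabulate _ i) (dec-true dec p))

  ∈-toSubset⁻¹ : {P : Fin n → Set} → ∀ {i} → i Subset.∈ toSubset P → P i
  ∈-toSubset⁻¹ {P = P} {i} i∈ with dec {P i} | ≡.trans (≡.sym (Vec.lookup∘tabulate (λ i → does (dec {P i})) i)) (Vec.[]=⇒lookup i∈)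
  ... | yes p | _ = p
  ... | no _  | ()

  uncurried : (Fin n → Fin n → Set) → Fin (n ℕ.* n) → Set
  uncurried {n} R i = R (proj₁ (remQuot {n} n i)) (proj₂ (remQuot {n} n i))

  measure : (Fin n → Fin n → Set) → ℕ
  measure {n} R = Subset.∣ toSubset {n ℕ.* n} (uncurried R) ∣

  measure-< : {R S : Fin n → Fin n → Set} → (∀ {u v} → R u v → S u v) → ∀ {u v} → S u v → ¬ R u v →
    measure R ℕ.< measure S
  measure-< {n} {R} {S} R⊆S {u} {v} Suv ¬Ruv = Subset.p⊂q⇒∣p∣<∣q∣
    ((λ i∈ → ∈-toSubset {P = uncurried S} (R⊆S (∈-toSubset⁻¹ {P = uncurried R} i∈))) ,
     combine u v ,
     ∈-toSubset {P = uncurried S} (subst (λ (p : Fin n × Fin n) → S (proj₁ p) (proj₂ p)) (≡.sym (Fin.remQuot-combine u v)) Suv) ,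
     λ i∈ → ¬Ruv (subst (λ (p : Fin n × Fin n) → R (proj₁ p) (proj₂ p)) (Fin.remQuot-combine u v) (∈-toSubset⁻¹ {P = uncurried R} i∈)))

  -- Connectedness as an induction principle over the vertices: when an edge is replaced by a path,
  -- only the closure of `P` under the old edge has to be checked, and no paths are rebuilt.
  Connectedᶜ : Complex n → Fin n → Set₁
  Connectedᶜ K r = ∀ (P : _ → Set) → P r → (∀ u v → Face K (Pair u v) → P u → P v) →
    ∀ v → Face K (Pair v v) → P v

  AtMostOneDimensional : Complex n → Set₁
  AtMostOneDimensional K = ∀ P → Face K P → ∀ x y z → P x → P y → P z → x ≡ y ⊎ y ≡ z ⊎ x ≡ z

  vertexComplex : Fin n → Complex n
  vertexComplex r = record { Face = λ P → ∀ v → P v → v ≡ r ; down = λ P⊆Q h v p → h v (P⊆Q v p) }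

  pair-diag : {a : Fin n} → ∀ v → Pair a a v → v ≡ a
  pair-diag v = [ id , id ]′

  module Core {r : Fin n} where

    -- For `u ≡ v` the pair stands for a vertex other than `r`; hence the measure drops not only
    -- when an edge moves to `r` but also when a leaf disappears.
    OffRoot : Complex n → Fin n → Fin n → Set
    OffRoot K u v = u ≢ r × v ≢ r × Face K (Pair u v)

    module Edge (K : Complex n) (1-dim : AtMostOneDimensional K) (conn : Connectedᶜ K r)
      {v w : Fin n} (v≢r : v ≢ r) (w≢r : w ≢ r) (v≢w : v ≢ w)
      (wv : Face K (Pair w v)) (vr : Face K (Pair v r)) where

      Q : Complex n
      Q = K ∖ (w , v)

      w∉ : ¬ Pair v r w
      w∉ = ∉pair (λ w≡v → v≢w (≡.sym w≡v)) w≢r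

      vr-Q : Face Q (Pair v r)
      vr-Q = vr , λ (w∈ , _) → w∉ w∈

      split : K ⊑ Q ∪ᵉ (w , v)
      split P F with dec {P w × P v}
      ... | no ¬wv = inj₁ (F , ¬wv)
      ... | yes (Pw , Pv) = inj₂ λ u Pu → case u (1-dim P F w v u Pw Pv Pu)
        where
        case : ∀ u → w ≡ v ⊎ v ≡ u ⊎ w ≡ u → Pair w v u
        case u (inj₁ w≡v)        = ⊥-elim (v≢w (≡.sym w≡v))
        case u (inj₂ (inj₁ v≡u)) = inj₂ (≡.sym v≡u)
        case u (inj₂ (inj₂ w≡u)) = inj₁ (≡.sym w≡u)

      unsplit : Q ∪ᵉ (w , v) ⊑ K
      unsplit P (inj₁ (F , _)) = F
      unsplit P (inj₂ h)       = down K h wv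

      remove : ∀ k → petals k K r ≃ᶜ petals k Q r ∪ᵉ (embed k w , embed k v)
      remove k =
        ≃ᶜ-ext {L = petals k (Q ∪ᵉ (w , v)) r} (petals-mono k {K} {Q ∪ᵉ (w , v)} split) (petals-mono k {Q ∪ᵉ (w , v)} {K} unsplit) ⟫
        ≃ᶜ-ext (petals-∪ᵉ k {Q}) (∪ᵉ-petals k {Q})

      -- The deleted edge {w, v} is bypassed by w - r - v. As `P r` is given, a single edge at `r`
      -- suffices in either direction.
      conn-⊇ : (L : Complex n) → Q ⊑ L → Face L (Pair w r) → (∀ x → Face L (Pair x x) → Face K (Pair x x)) → Connectedᶜ L r
      conn-⊇ L Q⊑L wr vertices P Pr closed x xx = conn P Pr closed′ x (vertices x xx)
        where
        closed′ : ∀ x y → Face K (Pair x y) → P x → P y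
        closed′ x y xy Px with dec {Pair x y w × Pair x y v}
        ... | no ¬wv = closed x y (Q⊑L _ (xy , ¬wv)) Px
        ... | yes (inj₁ refl , inj₁ refl) = ⊥-elim (v≢w refl)
        ... | yes (inj₂ refl , inj₂ refl) = ⊥-elim (v≢w refl)
        ... | yes (inj₁ refl , inj₂ refl) = closed r v (down L pair-swap (Q⊑L _ vr-Q)) Pr
        ... | yes (inj₂ refl , inj₁ refl) = closed r w (down L pair-swap wr) Pr

      Q-1-dim : AtMostOneDimensional Q
      Q-1-dim P (F , _) = 1-dim P F

    -- Here `k` petals have been split off and hang at `r`, while `K` is the part still to be
    -- reduced; all moves take place with the petals attached. The number `m` bounds the recursion,
    -- as every case loses an `OffRoot` pair.
    coreℓ : ∀ m (K : Complex n) k → measure (OffRoot K) ℕ.< m → AtMostOneDimensional K →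
      Face K (Pair r r) → Connectedᶜ K r → ∃ λ k′ → petals k K r ≃ᶜ petals k′ (vertexComplex r) r
    coreℓ (suc m) K k μ<m 1-dim rr conn
      with dec {∃₂ λ v w → v ≢ r × w ≢ r × v ≢ w × Face K (Pair w v) × Face K (Pair v r)}
    ... | yes (v , w , v≢r , w≢r , v≢w , wv , vr) = edge (dec {Face K (Pair w r)})
      where
      open Edge K 1-dim conn v≢r w≢r v≢w wv vr
      smaller : (L : Complex n) → (∀ {x y} → OffRoot L x y → OffRoot K x y) → ¬ Face L (Pair w v) → measure (OffRoot L) ℕ.< m
      smaller L L⊆K ¬wv = ℕ.<-≤-trans
        (measure-< {R = OffRoot L} {OffRoot K} L⊆K (w≢r , v≢r , wv) (λ (_ , _ , F) → ¬wv F)) (ℕ.≤-pred μ<m)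
      edge : Dec (Face K (Pair w r)) → ∃ λ k′ → petals k K r ≃ᶜ petals k′ (vertexComplex r) r
      edge (yes wr) =
        let wr-Q = wr , λ { (_ , v∈) → ∉pair v≢w v≢r v∈ }
            (k′ , e) = coreℓ m Q (suc k)
              (smaller Q (λ (x≢r , y≢r , F , _) → x≢r , y≢r , F) (λ (_ , ¬wv) → ¬wv (inj₁ refl , inj₂ refl)))
              Q-1-dim (rr , λ { (w∈ , _) → w≢r (pair-diag _ w∈) })
              (conn-⊇ Q (λ _ → id) wr-Q (λ _ → proj₁))
        in k′ , (remove k ⟫
          petalize (petals k Q r) (λ p → v≢r (embed-injective k p)) (λ p → w≢r (embed-injective k p))
            (λ p → v≢w (embed-injective k p))
            (petals-pair k {Q} vr-Q) (petals-pair k {Q} wr-Q)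
            (petals-↛ k {Q} (λ (w≡r , _) → w≢r w≡r) (λ P (_ , ¬wv) Pw Pv → ¬wv (Pw , Pv))) ⟫ e)
      edge (no ¬wr) =
        let L = Q ∪ᵉ (w , r)
            (k′ , e) = coreℓ m L k (smaller L offRoot ¬wv-L) L-1-dim
              (inj₂ λ x x∈ → inj₂ (pair-diag x x∈)) (conn-⊇ L (λ _ → inj₁) (inj₂ λ _ → id) vertex)
        in k′ , (remove k ⟫
          slide (petals k Q r) (λ p → v≢w (≡.sym (embed-injective k p))) (λ p → w≢r (embed-injective k p))
            (λ p → v≢r (embed-injective k p)) (petals-pair k {Q} vr-Q)
            (petals-↛ k {Q} (λ (w≡r , _) → w≢r w≡r) (λ P (_ , ¬wv) Pw Pv → ¬wv (Pw , Pv)))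
            (petals-↛ k {Q} (λ (w≡r , _) → w≢r w≡r)
              (λ P (F , _) Pw Pr → ¬wr (down K (λ { x (inj₁ refl) → Pw ; x (inj₂ refl) → Pr }) F))) ⟫
          ≃ᶜ-ext (∪ᵉ-petals k {Q}) (petals-∪ᵉ k {Q}) ⟫ e)
        where
        vertex : ∀ x → Face (Q ∪ᵉ (w , r)) (Pair x x) → Face K (Pair x x)
        vertex x (inj₁ (F , _)) = F
        vertex x (inj₂ h) with h x (inj₁ refl)
        ... | inj₁ refl = down K (λ y y∈ → inj₁ (pair-diag y y∈)) wv
        ... | inj₂ refl = rr
        offRoot : ∀ {x y} → OffRoot (Q ∪ᵉ (w , r)) x y → OffRoot K x y
        offRoot (x≢r , y≢r , inj₁ (F , _)) = x≢r , y≢r , F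
        offRoot {x} {y} (x≢r , y≢r , inj₂ h) = x≢r , y≢r ,
          down K (λ { z (inj₁ refl) → [ inj₁ , (λ p → ⊥-elim (x≢r p)) ]′ (h z (inj₁ refl))
                    ; z (inj₂ refl) → [ inj₁ , (λ p → ⊥-elim (y≢r p)) ]′ (h z (inj₂ refl)) }) wv
        ¬wv-L : ¬ Face (Q ∪ᵉ (w , r)) (Pair w v)
        ¬wv-L (inj₁ (_ , ¬wv)) = ¬wv (inj₁ refl , inj₂ refl)
        ¬wv-L (inj₂ h) = ∉pair v≢w v≢r (h v (inj₂ refl))
        L-1-dim : AtMostOneDimensional (Q ∪ᵉ (w , r))
        L-1-dim P (inj₁ (F , _)) = 1-dim P F
        L-1-dim P (inj₂ h) x y z Px Py Pz with h x Px | h y Py | h z Pz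
        ... | inj₁ p | inj₁ q | _      = inj₁ (≡.trans p (≡.sym q))
        ... | inj₂ p | inj₂ q | _      = inj₁ (≡.trans p (≡.sym q))
        ... | _      | inj₁ p | inj₁ q = inj₂ (inj₁ (≡.trans p (≡.sym q)))
        ... | _      | inj₂ p | inj₂ q = inj₂ (inj₁ (≡.trans p (≡.sym q)))
        ... | inj₁ p | _      | inj₁ q = inj₂ (inj₂ (≡.trans p (≡.sym q)))
        ... | inj₂ p | _      | inj₂ q = inj₂ (inj₂ (≡.trans p (≡.sym q)))
    ... | no ¬edge with dec {∃ λ v → v ≢ r × Face K (Pair v r)}
    -- By `¬edge`, a neighbour `v` of `r` has no neighbour other than `r`, so it is a leaf.
    ... | yes (v , v≢r , vr) =
        let (k′ , e) = coreℓ m Q k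
              (ℕ.<-≤-trans (measure-< {R = OffRoot Q} {OffRoot K} (λ (x≢r , y≢r , F , _) → x≢r , y≢r , F)
                (v≢r , v≢r , down K (λ x x∈ → inj₁ (pair-diag x x∈)) vr)
                (λ (_ , _ , _ , ¬v) → ¬v (inj₁ refl , inj₁ refl))) (ℕ.≤-pred μ<m))
              (λ P (F , _) → 1-dim P F) rr-Q conn-Q
        in k′ , (≃ᶜ-ext {L = petals k (Q ∪ᵉ (v , r)) r} (petals-mono k {K} {Q ∪ᵉ (v , r)} split) (petals-mono k {Q ∪ᵉ (v , r)} {K} unsplit) ⟫
          ≃ᶜ-ext (petals-∪ᵉ k {Q}) (∪ᵉ-petals k {Q}) ⟫
          leaf-collapse (petals k Q r) (λ p → v≢r (embed-injective k p)) (petals-pair k {Q} rr-Q)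
            (petals-↛ k {Q} (λ (v≡r , _) → v≢r v≡r) (λ P (_ , ¬v) Pv _ → ¬v (Pv , Pv))) ⟫ e)
      where
      Q : Complex n
      Q = K ∖ (v , v)
      rr-Q : Face Q (Pair r r)
      rr-Q = rr , λ (v∈ , _) → v≢r (pair-diag v v∈)
      only-r : ∀ u → u ≢ v → Face K (Pair u v) → u ≡ r
      only-r u u≢v uv = byContradiction λ u≢r → ¬edge (v , u , v≢r , u≢r , (λ v≡u → u≢v (≡.sym v≡u)) , uv , vr)
      split : K ⊑ Q ∪ᵉ (v , r)
      split P F with dec {P v}
      ... | no ¬v  = inj₁ (F , λ (Pv , _) → ¬v Pv)
      ... | yes Pv = inj₂ λ u Pu → byContradiction λ ¬pair → ¬pair
        (inj₂ (only-r u (λ u≡v → ¬pair (inj₁ u≡v)) (down K (λ { x (inj₁ refl) → Pu ; x (inj₂ refl) → Pv }) F)))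
      unsplit : Q ∪ᵉ (v , r) ⊑ K
      unsplit P (inj₁ (F , _)) = F
      unsplit P (inj₂ h)       = down K h vr
      conn-Q : Connectedᶜ Q r
      conn-Q P Pr closed x (xx , ¬v) = conn (λ u → u ≢ v → P u) (λ _ → Pr) closed′ x xx
        (λ { refl → ¬v (inj₁ refl , inj₁ refl) })
        where
        closed′ : ∀ x y → Face K (Pair x y) → (x ≢ v → P x) → y ≢ v → P y
        closed′ x y xy Px y≢v with x Fin.≟ v
        ... | yes refl = subst P (≡.sym (only-r y y≢v (down K pair-swap xy))) Pr
        ... | no x≢v   = closed x y (xy , λ (v∈ , _) → ∉pair (λ v≡x → x≢v (≡.sym v≡x)) (λ v≡y → y≢v (≡.sym v≡y)) v∈) (Px x≢v)
    -- No edge leaves `r`, so by connectedness it is the only vertex.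
    ... | no ¬leaf = k , ≃ᶜ-ext (petals-mono k {K} {vertexComplex r} to)
                                (petals-mono k {vertexComplex r} {K} (λ P h → down K (λ v Pv → inj₁ (h v Pv)) rr))
      where
      to : K ⊑ vertexComplex r
      to P F v Pv = conn (_≡ r) refl
        (λ { x y xy refl → byContradiction λ y≢r → ¬leaf (y , y≢r , down K pair-swap xy) })
        v (down K (λ { x (inj₁ refl) → Pv ; x (inj₂ refl) → Pv }) F)

    core : (K : Complex n) → AtMostOneDimensional K → Face K (Pair r r) → Connectedᶜ K r →
      ∃ λ k → K ≃ᶜ petals k (vertexComplex r) r
    core K = coreℓ (suc (measure (OffRoot K))) K zero (ℕ.n<1+n _)

  -- The boundary of a triangle and the circle

  0≤pos : ∀ x → 0# ≤ x ⊔ 0#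
  0≤pos x = y≤x⊔y x 0#

  ⊔0-pos : ∀ {x} → 0# ≤ x → x ⊔ 0# ≈ x
  ⊔0-pos = y≤x⇒x⊔y≈x

  ⊔0-neg : ∀ {x} → x ≤ 0# → x ⊔ 0# ≈ 0#
  ⊔0-neg = x≤y⇒x⊔y≈y

  neg-≤0 : ∀ {x} → 0# ≤ x → - x ≤ 0#
  neg-≤0 0≤x = ≤-respʳ (solve 0 (:- :0 := :0) ≈-refl) (neg-≤ 0≤x)

  pos-neg : ∀ x → (x ⊔ 0#) - (- x ⊔ 0#) ≈ x
  pos-neg x with total 0# x
  ... | inj₁ 0≤x = ≈-trans (+-cong (⊔0-pos 0≤x) (-‿cong (⊔0-neg (neg-≤0 0≤x))))
        (solve 1 (λ x → x :- :0 := x) ≈-refl x)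
  ... | inj₂ x≤0 = ≈-trans (+-cong (⊔0-neg x≤0) (-‿cong (⊔0-pos (0≤-neg x≤0))))
        (solve 1 (λ x → :0 :- (:- x) := x) ≈-refl x)

  pos+neg : ∀ x → (x ⊔ 0#) + (- x ⊔ 0#) ≈ abs x
  pos+neg x with total 0# x
  ... | inj₁ 0≤x = ≈-trans (+-cong (⊔0-pos 0≤x) (⊔0-neg (neg-≤0 0≤x)))
        (≈-trans (+-identityʳ x) (≈-sym (abs-pos 0≤x)))
  ... | inj₂ x≤0 = ≈-trans (+-cong (⊔0-neg x≤0) (⊔0-pos (0≤-neg x≤0)))
        (≈-trans (+-identityˡ _) (≈-sym (abs-neg x≤0)))

  abs-*ʳ : ∀ x {c} → 0# ≤ c → abs (x * c) ≈ abs x * c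
  abs-*ʳ x {c} 0≤c with total 0# x
  ... | inj₁ 0≤x = ≈-trans (abs-pos (*-nonneg 0≤x 0≤c)) (*-congʳ (≈-sym (abs-pos 0≤x)))
  ... | inj₂ x≤0 = ≈-trans (abs-neg (≤-by (*-nonneg (0≤-neg x≤0) 0≤c)
          (solve 2 (λ x c → :0 :- x :* c := (:- x) :* c) ≈-refl x c)))
        (≈-trans (solve 2 (λ x c → :- (x :* c) := (:- x) :* c) ≈-refl x c) (*-congʳ (≈-sym (abs-neg x≤0))))

  1≤1+ : ∀ {x} → 0# ≤ x → 1# ≤ 1# + x
  1≤1+ {x} 0≤x = ≤-by 0≤x (solve 1 (λ x → :1 :+ x :- :1 := x) ≈-refl x)

  *-inv-1+ : ∀ {x} → 0# ≤ x → (1# + x) * inv (1# + x) ≈ 1#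
  *-inv-1+ 0≤x = *-inv (0<⇒≉0 (<-≤-trans 0<1 (1≤1+ 0≤x)))

  Plane : Set
  Plane = Euclidean (Fin 2)

  pt : ℝ → ℝ → Plane
  pt a b 0F = a
  pt a b 1F = b

  cont-pt : ∀ {I} {φ ψ : Euclidean I → ℝ} → Contℝ φ → Contℝ ψ → Cont (λ x → pt (φ x) (ψ x))
  cont-pt cφ cψ = cont-coords (uniform-Fin 2) λ { 0F → cφ ; 1F → cψ }

  -- The boundary of the triangle with vertices (0, 0), (1, 0), (0, 1).
  Triangle : Space (Fin 2)
  Triangle x = (0# ≤ x 0F × 0# ≤ x 1F × x 0F + x 1F ≤ 1#) × (x 0F ≈ 0# ⊎ x 1F ≈ 0# ⊎ x 0F + x 1F ≈ 1#)

  -- The unit circle of the sum norm, a halfway station: piecewise affine maps lead to the triangle,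
  -- and maps that are rational on each quadrant lead to the circle.
  Diamond : Space (Fin 2)
  Diamond x = abs (x 0F) + abs (x 1F) ≈ 1#

  -- On the two legs the minimum `m` vanishes, and they fill the half of the diamond with
  -- nonnegative first coordinate. On the hypotenuse the first coordinate is -2`m`, which gives the
  -- other half. The corner (0, 0) goes to (1, 0), the future base point.
  triangle→diamond diamond→triangle diamond→circle circle→diamond : Plane → Plane
  triangle→diamond x = pt (1# - x 0F - x 1F - (m + m)) (x 0F - x 1F) where m = x 0F ⊓ x 1F
  diamond→triangle x = pt ((x 1F ⊔ 0#) + h) ((- x 1F ⊔ 0#) + h) where h = ½ * (- x 0F ⊔ 0#)
  -- The quarter arcs are parametrised rationally by the tangent of the half angle.
  diamond→circle x = pt (x 0F * (1# + abs (x 1F)) * i) ((1# + 1#) * x 1F * i) where i = inv (1# + x 1F * x 1F)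
  circle→diamond x = pt (x 0F * (1# + y * y) * inv (1# + abs y)) y where y = x 1F * inv (1# + abs (x 0F))

  c0 : Contℝ {Fin 2} (λ x → x 0F)
  c0 = cont-proj 0F
  c1 : Contℝ {Fin 2} (λ x → x 1F)
  c1 = cont-proj 1F

  triangle→diamond-cont : Cont triangle→diamond
  triangle→diamond-cont = cont-pt
    (cont-- (cont-- (cont-- (cont-const 1#) c0) c1) (cont-+ (cont-⊓ c0 c1) (cont-⊓ c0 c1))) (cont-- c0 c1)

  diamond→triangle-cont : Cont diamond→triangle
  diamond→triangle-cont = cont-pt (cont-+ (cont-⊔ c1 (cont-const 0#)) ch) (cont-+ (cont-⊔ (cont-neg c1) (cont-const 0#)) ch)
    where
    ch : Contℝ {Fin 2} (λ x → ½ * (- x 0F ⊔ 0#))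
    ch = cont-* (cont-const ½) (cont-⊔ (cont-neg c0) (cont-const 0#))

  diamond→circle-cont : Cont diamond→circle
  diamond→circle-cont = cont-pt
    (cont-* (cont-* c0 (cont-+ (cont-const 1#) (cont-abs c1))) ci)
    (cont-* (cont-* (cont-const (1# + 1#)) c1) ci)
    where
    ci : Contℝ {Fin 2} (λ x → inv (1# + x 1F * x 1F))
    ci = cont-inv (λ x → 1≤1+ (0≤sq (x 1F))) (cont-+ (cont-const 1#) (cont-* c1 c1))

  circle→diamond-cont : Cont circle→diamond
  circle→diamond-cont = cont-pt
    (cont-* (cont-* c0 (cont-+ (cont-const 1#) (cont-* cy cy)))
      (cont-inv (λ x → 1≤1+ (0≤abs _)) (cont-+ (cont-const 1#) (cont-abs cy)))) cy
    where
    cy : Contℝ {Fin 2} (λ x → x 1F * inv (1# + abs (x 0F)))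
    cy = cont-* c1 (cont-inv (λ x → 1≤1+ (0≤abs (x 0F))) (cont-+ (cont-const 1#) (cont-abs c0)))

  triangle→diamond-values : ∀ {x} → Triangle x →
    Diamond (triangle→diamond x) × diamond→triangle (triangle→diamond x) ≋ x
  triangle→diamond-values {x} ((0≤a , 0≤b , a+b≤1) , onside) = side onside
    where
    a = x 0F
    b = x 1F
    X = triangle→diamond x 0F
    Y = triangle→diamond x 1F
    result : ∀ {x⁻ y⁺ y⁻} → abs X + abs Y ≈ 1# → - X ⊔ 0# ≈ x⁻ → Y ⊔ 0# ≈ y⁺ → - Y ⊔ 0# ≈ y⁻ →
      y⁺ + ½ * x⁻ ≈ a → y⁻ + ½ * x⁻ ≈ b → Diamond (triangle→diamond x) × diamond→triangle (triangle→diamond x) ≋ x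
    result D px py⁺ py⁻ ea eb = D , λ where
      0F → ≈-trans (+-cong py⁺ (*-congˡ px)) ea
      1F → ≈-trans (+-cong py⁻ (*-congˡ px)) eb
    ½-drop : ∀ y → y + ½ * 0# ≈ y
    ½-drop y = solve 2 (λ y h → y :+ h :* :0 := y) ≈-refl y ½
    half : ∀ m → ½ * (m + m) ≈ m
    half m = ≈-trans (solve 2 (λ h m → h :* (m :+ m) := (h :+ h) :* m) ≈-refl ½ m) (≈-trans (*-congʳ ½+½) (*-identityˡ m))
    -- Serves both legs: `c` is the coordinate that need not vanish, and `d` is the second
    -- coordinate in the diamond, equal to `c` up to sign.
    b≈0-case : ∀ {c d} → 0# ≤ c → c ≤ 1# → a ⊓ b ≈ 0# → a + b ≈ c → Y ≈ d → abs d ≈ c →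
      abs X + abs Y ≈ 1# × - X ⊔ 0# ≈ 0#
    b≈0-case {c} {d} 0≤c c≤1 m≈0 a+b≈c Y≈d d≈c =
      ≈-trans (+-cong (≈-trans (abs-cong X≈) (abs-pos (0≤- c≤1))) (≈-trans (abs-cong Y≈d) d≈c))
        (solve 1 (λ c → :1 :- c :+ c := :1) ≈-refl c) ,
      ⊔0-neg (neg-≤0 (≤-respʳ (≈-sym X≈) (0≤- c≤1)))
      where
      X≈ : X ≈ 1# - c
      X≈ = ≈-trans (+-cong (solve 2 (λ a b → :1 :- a :- b := :1 :- (a :+ b)) ≈-refl a b) (-‿cong (+-cong m≈0 m≈0)))
           (≈-trans (+-congʳ (+-congˡ (-‿cong a+b≈c))) (solve 1 (λ c → :1 :- c :- (:0 :+ :0) := :1 :- c) ≈-refl c))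
    side : a ≈ 0# ⊎ b ≈ 0# ⊎ a + b ≈ 1# → Diamond (triangle→diamond x) × diamond→triangle (triangle→diamond x) ≋ x
    side (inj₁ a≈0) = result (proj₁ r) (proj₂ r)
        (⊔0-neg (≤-respˡ (≈-sym Y≈) (neg-≤0 0≤b)))
        (≈-trans (⊔-cong (≈-trans (-‿cong Y≈) (neg-neg b)) ≈-refl) (⊔0-pos 0≤b))
        (≈-trans (½-drop 0#) (≈-sym a≈0)) (½-drop b)
      where
      Y≈ : Y ≈ - b
      Y≈ = ≈-trans (+-congʳ a≈0) (+-identityˡ _)
      r = b≈0-case {b} { - b } 0≤b (≤-respˡ (≈-trans (+-congʳ a≈0) (+-identityˡ b)) a+b≤1)
        (≈-trans (x≤y⇒x⊓y≈x (≤-respˡ (≈-sym a≈0) 0≤b)) a≈0) (≈-trans (+-congʳ a≈0) (+-identityˡ b)) Y≈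
        (≈-trans (abs-neg (neg-≤0 0≤b)) (neg-neg b))
    side (inj₂ (inj₁ b≈0)) = result (proj₁ r) (proj₂ r)
        (≈-trans (⊔-cong Y≈ ≈-refl) (⊔0-pos 0≤a))
        (⊔0-neg (neg-≤0 (≤-respʳ (≈-sym Y≈) 0≤a)))
        (½-drop a) (≈-trans (½-drop 0#) (≈-sym b≈0))
      where
      Y≈ : Y ≈ a
      Y≈ = ≈-trans (+-congˡ (-‿cong b≈0)) (solve 1 (λ a → a :- :0 := a) ≈-refl a)
      r = b≈0-case {a} {a} 0≤a (≤-respˡ (≈-trans (+-congˡ b≈0) (+-identityʳ a)) a+b≤1)
        (≈-trans (y≤x⇒x⊓y≈y (≤-respˡ (≈-sym b≈0) 0≤a)) b≈0) (≈-trans (+-congˡ b≈0) (+-identityʳ a)) Y≈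
        (abs-pos 0≤a)
    side (inj₂ (inj₂ a+b≈1)) with total a b
    ... | inj₁ a≤b = result
        (≈-trans (+-cong absX (≈-trans (abs-neg Y≤0) (solve 2 (λ a b → :- (a :- b) := b :- a) ≈-refl a b)))
          (≈-trans (+-congʳ (+-cong m≈ m≈)) (≈-trans (solve 2 (λ a b → a :+ a :+ (b :- a) := a :+ b) ≈-refl a b) a+b≈1)))
        x⁻ (⊔0-neg Y≤0) (⊔0-pos (0≤-neg Y≤0))
        (≈-trans (+-identityˡ _) (≈-trans (half _) m≈))
        (≈-trans (+-congˡ (≈-trans (half _) m≈)) (solve 2 (λ a b → (:- (a :- b)) :+ a := b) ≈-refl a b))
      where
      m≈ : a ⊓ b ≈ a
      m≈ = x≤y⇒x⊓y≈x a≤b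
      Y≤0 : Y ≤ 0#
      Y≤0 = ≤-by (0≤- a≤b) (solve 2 (λ a b → :0 :- (a :- b) := b :- a) ≈-refl a b)
      -X≈ : - X ≈ a ⊓ b + a ⊓ b
      -X≈ = ≈-trans (solve 3 (λ a b m → :- (:1 :- a :- b :- (m :+ m)) := (a :+ b :- :1) :+ (m :+ m)) ≈-refl a b (a ⊓ b))
        (≈-trans (+-congʳ (≈-trans (+-congʳ a+b≈1) (-‿inverseʳ 1#))) (+-identityˡ _))
      0≤-X : 0# ≤ - X
      0≤-X = ≤-respʳ (≈-sym -X≈) (0≤+ (0≤⊓ 0≤a 0≤b) (0≤⊓ 0≤a 0≤b))
      absX : abs X ≈ a ⊓ b + a ⊓ b
      absX = ≈-trans (abs-neg (≤-by 0≤-X (+-identityˡ _))) -X≈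
      x⁻ : - X ⊔ 0# ≈ a ⊓ b + a ⊓ b
      x⁻ = ≈-trans (⊔0-pos 0≤-X) -X≈
    ... | inj₂ b≤a = result
        (≈-trans (+-cong absX (abs-pos 0≤Y))
          (≈-trans (+-congʳ (+-cong m≈ m≈)) (≈-trans (solve 2 (λ a b → b :+ b :+ (a :- b) := a :+ b) ≈-refl a b) a+b≈1)))
        x⁻ (⊔0-pos 0≤Y) (⊔0-neg (neg-≤0 0≤Y))
        (≈-trans (+-congˡ (≈-trans (half _) m≈)) (solve 2 (λ a b → (a :- b) :+ b := a) ≈-refl a b))
        (≈-trans (+-identityˡ _) (≈-trans (half _) m≈))
      where
      m≈ : a ⊓ b ≈ b
      m≈ = y≤x⇒x⊓y≈y b≤a
      0≤Y : 0# ≤ Y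
      0≤Y = 0≤- b≤a
      -X≈ : - X ≈ a ⊓ b + a ⊓ b
      -X≈ = ≈-trans (solve 3 (λ a b m → :- (:1 :- a :- b :- (m :+ m)) := (a :+ b :- :1) :+ (m :+ m)) ≈-refl a b (a ⊓ b))
        (≈-trans (+-congʳ (≈-trans (+-congʳ a+b≈1) (-‿inverseʳ 1#))) (+-identityˡ _))
      0≤-X : 0# ≤ - X
      0≤-X = ≤-respʳ (≈-sym -X≈) (0≤+ (0≤⊓ 0≤a 0≤b) (0≤⊓ 0≤a 0≤b))
      absX : abs X ≈ a ⊓ b + a ⊓ b
      absX = ≈-trans (abs-neg (≤-by 0≤-X (+-identityˡ _))) -X≈
      x⁻ : - X ⊔ 0# ≈ a ⊓ b + a ⊓ b
      x⁻ = ≈-trans (⊔0-pos 0≤-X) -X≈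

  diamond→triangle-values : ∀ {x} → Diamond x →
    Triangle (diamond→triangle x) × triangle→diamond (diamond→triangle x) ≋ x
  diamond→triangle-values {x} D =
    ((0≤+ (0≤pos Y) 0≤h , 0≤+ (0≤pos (- Y)) 0≤h ,
      ≤-respˡ (≈-sym A+B≈) (≤-by (0≤pos X) slack)) , onside) ,
    λ { 0F → X-value ; 1F → Y-value }
    where
    X = x 0F
    Y = x 1F
    x⁻ = - X ⊔ 0#
    h = ½ * x⁻
    A = (Y ⊔ 0#) + h
    B = (- Y ⊔ 0#) + h
    0≤h : 0# ≤ h
    0≤h = *-nonneg (<⇒≤ 0<½) (0≤pos (- X))
    h+h≈ : h + h ≈ x⁻
    h+h≈ = ≈-trans (solve 2 (λ h x → h :* x :+ h :* x := (h :+ h) :* x) ≈-refl ½ x⁻) (≈-trans (*-congʳ ½+½) (*-identityˡ x⁻))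
    A+B≈ : A + B ≈ abs Y + x⁻
    A+B≈ = ≈-trans (solve 3 (λ p q h → (p :+ h) :+ (q :+ h) := (p :+ q) :+ (h :+ h)) ≈-refl (Y ⊔ 0#) (- Y ⊔ 0#) h)
      (+-cong (pos+neg Y) h+h≈)
    slack : 1# - (abs Y + x⁻) ≈ X ⊔ 0#
    slack = ≈-trans (+-congʳ (≈-sym D)) (≈-trans (+-congʳ (+-congʳ (≈-sym (pos+neg X))))
      (solve 3 (λ p q y → ((p :+ q) :+ y) :- (y :+ q) := p) ≈-refl (X ⊔ 0#) x⁻ (abs Y)))
    onside : A ≈ 0# ⊎ B ≈ 0# ⊎ A + B ≈ 1#
    onside with total 0# X | total 0# Y
    ... | inj₂ X≤0 | _ = inj₂ (inj₂ (≈-trans A+B≈ (≈-trans (+-comm _ _)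
          (≈-trans (+-congʳ (≈-trans (⊔0-pos (0≤-neg X≤0)) (≈-sym (abs-neg X≤0)))) D))))
    ... | inj₁ 0≤X | inj₁ 0≤Y = inj₂ (inj₁ (≈-trans (+-cong (⊔0-neg (neg-≤0 0≤Y)) (*-congˡ (⊔0-neg (neg-≤0 0≤X))))
          (≈-trans (+-identityˡ _) (zeroʳ ½))))
    ... | inj₁ 0≤X | inj₂ Y≤0 = inj₁ (≈-trans (+-cong (⊔0-neg Y≤0) (*-congˡ (⊔0-neg (neg-≤0 0≤X))))
          (≈-trans (+-identityˡ _) (zeroʳ ½)))
    A⊓B≈h : A ⊓ B ≈ h
    A⊓B≈h with total 0# Y
    ... | inj₁ 0≤Y = ≈-trans (y≤x⇒x⊓y≈y (+-mono-≤ (≤-trans (≤-reflexive (⊔0-neg (neg-≤0 0≤Y))) (0≤pos Y)) ≤-refl))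
          (≈-trans (+-congʳ (⊔0-neg (neg-≤0 0≤Y))) (+-identityˡ h))
    ... | inj₂ Y≤0 = ≈-trans (x≤y⇒x⊓y≈x (+-mono-≤ (≤-trans (≤-reflexive (⊔0-neg Y≤0)) (0≤pos (- Y))) ≤-refl))
          (≈-trans (+-congʳ (⊔0-neg Y≤0)) (+-identityˡ h))
    X-value : triangle→diamond (diamond→triangle x) 0F ≈ X
    X-value = ≈-trans (+-cong (≈-trans (solve 2 (λ a b → :1 :- a :- b := :1 :- (a :+ b)) ≈-refl A B) (+-congˡ (-‿cong A+B≈)))
        (-‿cong (≈-trans (+-cong A⊓B≈h A⊓B≈h) h+h≈)))
      (≈-trans (+-congʳ slack) (pos-neg X))
    Y-value : A - B ≈ Y
    Y-value = ≈-trans (solve 3 (λ p q h → (p :+ h) :- (q :+ h) := p :- q) ≈-refl (Y ⊔ 0#) (- Y ⊔ 0#) h) (pos-neg Y)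

  -- The inverse is a variable `i` with its defining equation, and `s` stands for `abs Y` with the
  -- same square, so every identity becomes polynomial and the ring solver applies.
  module DiamondToCircle (X Y i : ℝ) (D : abs X + abs Y ≈ 1#) (Di : (1# + Y * Y) * i ≈ 1#) (0≤i : 0# ≤ i) where

    s U V : ℝ
    s = abs Y
    U = X * (1# + s) * i
    V = (1# + 1#) * Y * i

    absX : abs X ≈ 1# - s
    absX = ≈-trans (solve 2 (λ a b → a := a :+ b :- b) ≈-refl (abs X) s) (+-congʳ D)

    Di′ : (1# + s * s) * i ≈ 1#
    Di′ = ≈-trans (*-congʳ (+-congˡ (abs*abs Y))) Di

    on-circle : U * U + V * V ≈ 1#
    on-circle = ≈-trans
      (solve 4 (λ X p i Y → (X :* p :* i) :* (X :* p :* i) :+ (:2 :* Y :* i) :* (:2 :* Y :* i)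
        := ((X :* X) :* (p :* p) :+ :2 :* :2 :* (Y :* Y)) :* (i :* i)) ≈-refl X (1# + s) i Y)
      (≈-trans (*-congʳ (≈-trans (+-cong (*-congʳ (≈-trans (≈-sym (abs*abs X)) (*-cong absX absX))) (*-congˡ (≈-sym (abs*abs Y))))
        (solve 1 (λ s → ((:1 :- s) :* (:1 :- s)) :* ((:1 :+ s) :* (:1 :+ s)) :+ :2 :* :2 :* (s :* s)
          := (:1 :+ s :* s) :* (:1 :+ s :* s)) ≈-refl s)))
      (≈-trans (solve 2 (λ d i → d :* d :* (i :* i) := (d :* i) :* (d :* i)) ≈-refl (1# + s * s) i)
        (≈-trans (*-cong Di′ Di′) (*-identityˡ 1#))))

    -- The half-angle formula: `abs U` is the cosine (1 - s²)/(1 + s²) for `s` the tangent of the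
    -- half angle. Dividing `V` by this sum therefore gives back `Y`.
    1+U : 1# + abs U ≈ (1# + 1#) * i
    1+U = ≈-trans (+-cong (≈-sym Di′)
        (≈-trans (abs-*ʳ (X * (1# + s)) 0≤i) (*-congʳ (≈-trans (abs-*ʳ X (≤-trans 0≤1 (1≤1+ (0≤abs Y)))) (*-congʳ absX)))))
      (solve 2 (λ s i → (:1 :+ s :* s) :* i :+ (:1 :- s) :* (:1 :+ s) :* i := :2 :* i) ≈-refl s i)

    Y-value : ∀ j → (1# + abs U) * j ≈ 1# → V * j ≈ Y
    Y-value j Uj = ≈-trans (solve 3 (λ Y i j → :2 :* Y :* i :* j := (:2 :* i) :* j :* Y) ≈-refl Y i j)
      (≈-trans (*-congʳ (≈-trans (*-congʳ (≈-sym 1+U)) Uj)) (*-identityˡ Y))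

    X-value : ∀ y k → y ≈ Y → (1# + abs y) * k ≈ 1# → U * (1# + y * y) * k ≈ X
    X-value y k y≈Y yk = ≈-trans (*-congʳ (*-congˡ (+-congˡ (*-cong y≈Y y≈Y))))
      (≈-trans (solve 5 (λ X s i d k → X :* s :* i :* d :* k := X :* (d :* i) :* (s :* k)) ≈-refl X (1# + s) i (1# + Y * Y) k)
      (≈-trans (*-cong (*-congˡ Di) (≈-trans (*-congʳ (+-congˡ (≈-sym (abs-cong y≈Y)))) yk))
        (solve 1 (λ x → x :* :1 :* :1 := x) ≈-refl X)))

  diamond→circle-values : ∀ {x} → Diamond x →
    circle (diamond→circle x) × circle→diamond (diamond→circle x) ≋ x
  diamond→circle-values {x} D = C.on-circle , λ
    { 0F → C.X-value _ _ Yv (*-inv-1+ (0≤abs _)) ; 1F → Yv }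
    where
    module C = DiamondToCircle (x 0F) (x 1F) (inv (1# + x 1F * x 1F)) D (*-inv-1+ (0≤sq (x 1F)))
      (<⇒≤ (0<inv (<-≤-trans 0<1 (1≤1+ (0≤sq (x 1F))))))
    Yv : C.V * inv (1# + abs C.U) ≈ x 1F
    Yv = C.Y-value _ (*-inv-1+ (0≤abs C.U))

  module CircleToDiamond (U V j : ℝ) (C : U * U + V * V ≈ 1#) (Sj : (1# + abs U) * j ≈ 1#) where

    s Y : ℝ
    s = abs U
    Y = V * j

    VV : V * V ≈ 1# - s * s
    VV = ≈-trans (solve 2 (λ u v → v :* v := u :* u :+ v :* v :- u :* u) ≈-refl U V)
      (+-cong C (-‿cong (≈-sym (abs*abs U))))

    1+YY : 1# + Y * Y ≈ (1# + 1#) * j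
    1+YY = ≈-trans (+-cong (≈-trans (≈-sym (*-identityˡ 1#)) (*-cong (≈-sym Sj) (≈-sym Sj)))
        (≈-trans (solve 2 (λ v j → v :* j :* (v :* j) := v :* v :* (j :* j)) ≈-refl V j) (*-congʳ VV)))
      (≈-trans (solve 2 (λ s j → (:1 :+ s) :* j :* ((:1 :+ s) :* j) :+ (:1 :- s :* s) :* (j :* j) := :2 :* j :* ((:1 :+ s) :* j)) ≈-refl s j)
        (≈-trans (*-congˡ Sj) (*-identityʳ _)))

    on-diamond : ∀ k → 0# ≤ k → (1# + abs Y) * k ≈ 1# → abs (U * (1# + Y * Y) * k) + abs Y ≈ 1#
    on-diamond k 0≤k Kk = ≈-trans (+-cong
        (≈-trans (≈-trans (abs-*ʳ _ 0≤k) (*-congʳ (≈-trans (abs-*ʳ U (≤-trans 0≤1 (1≤1+ (0≤sq Y)))) (*-congˡ 1+YY))))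
          (*-congʳ (≈-trans (solve 2 (λ s j → s :* (:2 :* j) := :2 :* ((:1 :+ s) :* j :- j)) ≈-refl s j)
            (≈-trans (*-congˡ (+-congʳ Sj)) lem))))
        (≈-trans (≈-sym (*-identityʳ _)) (*-congˡ (≈-sym Kk))))
      (≈-trans (solve 2 (λ y k → (:1 :- y :* y) :* k :+ y :* ((:1 :+ y) :* k) := (:1 :+ y) :* k) ≈-refl (abs Y) k) Kk)
      where
      lem : (1# + 1#) * (1# - j) ≈ 1# - abs Y * abs Y
      lem = ≈-trans (solve 1 (λ j → :2 :* (:1 :- j) := :2 :- :2 :* j) ≈-refl j)
        (≈-trans (+-congˡ (-‿cong (≈-sym 1+YY)))
        (≈-trans (solve 1 (λ y → :2 :- (:1 :+ y) := :1 :- y) ≈-refl (Y * Y)) (+-congˡ (-‿cong (≈-sym (abs*abs Y))))))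

    U-value : ∀ k i → (1# + abs Y) * k ≈ 1# → (1# + Y * Y) * i ≈ 1# → U * (1# + Y * Y) * k * (1# + abs Y) * i ≈ U
    U-value k i Kk Di = ≈-trans
      (solve 5 (λ u d k a i → u :* d :* k :* a :* i := u :* (a :* k) :* (d :* i)) ≈-refl U (1# + Y * Y) k (1# + abs Y) i)
      (≈-trans (*-cong (*-congˡ Kk) Di) (solve 1 (λ x → x :* :1 :* :1 := x) ≈-refl U))

    V-value : ∀ i → (1# + Y * Y) * i ≈ 1# → (1# + 1#) * Y * i ≈ V
    V-value i Di = ≈-trans (solve 3 (λ v j i → :2 :* (v :* j) :* i := v :* (:2 :* j :* i)) ≈-refl V j i)
      (≈-trans (*-congˡ (≈-trans (*-congʳ (≈-sym 1+YY)) Di)) (*-identityʳ V))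

  circle→diamond-values : ∀ {x} → circle x →
    Diamond (circle→diamond x) × diamond→circle (circle→diamond x) ≋ x
  circle→diamond-values {x} C =
    D.on-diamond _ (<⇒≤ (0<inv (<-≤-trans 0<1 (1≤1+ (0≤abs D.Y))))) Kk ,
    λ { 0F → D.U-value _ _ Kk Di ; 1F → D.V-value _ Di }
    where
    module D = CircleToDiamond (x 0F) (x 1F) (inv (1# + abs (x 0F))) C (*-inv-1+ (0≤abs (x 0F)))
    Kk : (1# + abs D.Y) * inv (1# + abs D.Y) ≈ 1#
    Kk = *-inv-1+ (0≤abs D.Y)
    Di : (1# + D.Y * D.Y) * inv (1# + D.Y * D.Y) ≈ 1#
    Di = *-inv-1+ (0≤sq D.Y)

  toCircle fromCircle : Plane → Plane
  toCircle   = diamond→circle ∘ triangle→diamond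
  fromCircle = diamond→triangle ∘ circle→diamond

  toCircle-cont : Cont toCircle
  toCircle-cont = cont-∘ diamond→circle-cont triangle→diamond-cont

  fromCircle-cont : Cont fromCircle
  fromCircle-cont = cont-∘ diamond→triangle-cont circle→diamond-cont

  toCircle∈ : ∀ {x} → Triangle x → circle (toCircle x)
  toCircle∈ {x} T = proj₁ (diamond→circle-values {triangle→diamond x} (proj₁ (triangle→diamond-values {x} T)))

  fromCircle∈ : ∀ {x} → circle x → Triangle (fromCircle x)
  fromCircle∈ {x} C = proj₁ (diamond→triangle-values {circle→diamond x} (proj₁ (circle→diamond-values {x} C)))

  fromCircle∘toCircle : ∀ {x} → Triangle x → fromCircle (toCircle x) ≋ x
  fromCircle∘toCircle {x} T i =
    let (D , e) = triangle→diamond-values {x} T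
    in ≈-trans (cont-resp diamond→triangle-cont {circle→diamond (toCircle x)} {triangle→diamond x}
      (proj₂ (diamond→circle-values {triangle→diamond x} D)) i) (e i)

  toCircle∘fromCircle : ∀ {x} → circle x → toCircle (fromCircle x) ≋ x
  toCircle∘fromCircle {x} C i =
    let (D , e) = circle→diamond-values {x} C
    in ≈-trans (cont-resp diamond→circle-cont {triangle→diamond (fromCircle x)} {circle→diamond x}
      (proj₂ (diamond→triangle-values {circle→diamond x} D)) i) (e i)

  -- A point with no mass on the two new vertices of a petal has coordinates (0, 0) there; it must
  -- go to the base point of that circle, as the wedge demands of all circles but one.
  toCircle-base : ∀ {x} → x 0F ≈ 0# → x 1F ≈ 0# → toCircle x ≋ circleBase
  toCircle-base {x} a≈0 b≈0 = λ where
      0F → ≈-trans (*-cong (≈-trans (*-cong X≈1 (+-congˡ (≈-trans (abs-cong Y≈0) abs0))) (solve 0 (:1 :* (:1 :+ :0) := :1) ≈-refl)) i≈1)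
        (*-identityˡ 1#)
      1F → ≈-trans (*-congʳ (≈-trans (*-congˡ Y≈0) (zeroʳ _))) (zeroˡ _)
    where
    X = triangle→diamond x 0F
    Y = triangle→diamond x 1F
    abs0 : abs 0# ≈ 0#
    abs0 = abs-pos ≤-refl
    m≈0 : x 0F ⊓ x 1F ≈ 0#
    m≈0 = ≈-trans (x≤y⇒x⊓y≈x (≤-reflexive (≈-trans a≈0 (≈-sym b≈0)))) a≈0
    Y≈0 : Y ≈ 0#
    Y≈0 = ≈-trans (+-cong a≈0 (-‿cong b≈0)) (-‿inverseʳ 0#)
    X≈1 : X ≈ 1#
    X≈1 = ≈-trans (+-cong (+-cong (+-congˡ (-‿cong a≈0)) (-‿cong b≈0)) (-‿cong (+-cong m≈0 m≈0)))
      (solve 0 (:1 :- :0 :- :0 :- (:0 :+ :0) := :1) ≈-refl)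
    i≈1 : inv (1# + Y * Y) ≈ 1#
    i≈1 = ≈-trans (≈-trans (≈-sym (*-identityˡ _))
        (*-congʳ (≈-sym (≈-trans (+-congˡ (≈-trans (*-congʳ Y≈0) (zeroˡ Y))) (+-identityʳ 1#))))) (*-inv-1+ (0≤sq Y))

  fromCircle-base : ∀ {x} → x ≋ circleBase → fromCircle x 0F ≈ 0# × fromCircle x 1F ≈ 0#
  fromCircle-base {x} x≋ = at-origin 0F , at-origin 1F
    where
    origin : Plane
    origin = λ _ → 0#
    origin∈ : Triangle origin
    origin∈ = (≤-refl , ≤-refl , ≤-respˡ (≈-sym (+-identityˡ 0#)) 0≤1) , inj₁ ≈-refl
    at-origin : fromCircle x ≋ origin
    at-origin i = ≈-trans (cont-resp fromCircle-cont {x} {toCircle origin} (λ j → ≈-trans (x≋ j) (≈-sym (toCircle-base {origin} ≈-refl ≈-refl j))) i)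
      (fromCircle∘toCircle {origin} origin∈ i)

  -- Roses and wedges of circles

  module Rose (r : Fin n) where

    first : ∀ {k} → Euclidean (Fin (suc k) × Fin 2) → Plane
    first z s = z (zero , s)

    rest : ∀ {k} → Euclidean (Fin (suc k) × Fin 2) → Euclidean (Fin k × Fin 2)
    rest z (c , s) = z (suc c , s)

    petal₁ : ∀ {k} → Euclidean (Fin (suc k ℕ.* 2 ℕ.+ n)) → Plane
    petal₁ x = pt (x zero) (x (suc zero))

    others : ∀ {k} → Euclidean (Fin (suc k ℕ.* 2 ℕ.+ n)) → Euclidean (Fin (k ℕ.* 2 ℕ.+ n))
    others x i = x (suc (suc i))

    -- In each petal the barycentric coordinates of its two new vertices form a point of `Triangle`;
    -- the third coordinate, the mass elsewhere, is redundant.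
    unroll : ∀ k → Euclidean (Fin (k ℕ.* 2 ℕ.+ n)) → Euclidean (Fin k × Fin 2)
    unroll (suc k) x (zero  , s) = toCircle (petal₁ {k} x) s
    unroll (suc k) x (suc c , s) = unroll k (others {k} x) (c , s)

    -- ρ is the total mass, of which the vertex r receives what the petals leave.
    roll : ∀ k → ℝ → Euclidean (Fin k × Fin 2) → Euclidean (Fin (k ℕ.* 2 ℕ.+ n))
    roll zero    ρ z i             = ρ * δ r i
    roll (suc k) ρ z zero          = fromCircle (first z) 0F
    roll (suc k) ρ z (suc zero)    = fromCircle (first z) 1F
    roll (suc k) ρ z (suc (suc i)) = roll k (ρ - fromCircle (first z) 0F - fromCircle (first z) 1F) (rest z) i

    unroll-cont : ∀ {I} k {h : Euclidean I → Euclidean (Fin (k ℕ.* 2 ℕ.+ n))} → Cont h → ∀ j → Contℝ (λ x → unroll k (h x) j)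
    unroll-cont (suc k) {h} ch (zero , s) = cont-∘ℝ (cont-proj s) (cont-∘ toCircle-cont
      (cont-pt (cont-∘ℝ (cont-proj zero) ch) (cont-∘ℝ (cont-proj (suc zero)) ch)))
    unroll-cont (suc k) {h} ch (suc c , s) = unroll-cont k {λ x → others {k} (h x)} (cont-∘ (cont-reindex (λ i → suc (suc i))) ch) (c , s)

    roll-cont : ∀ {I} k {ρ : Euclidean I → ℝ} {h : Euclidean I → Euclidean (Fin k × Fin 2)} →
      Contℝ ρ → Cont h → ∀ i → Contℝ (λ x → roll k (ρ x) (h x) i)
    roll-cont zero    cρ ch i = cont-* cρ (cont-const (δ r i))
    roll-cont {I} (suc k) {ρ} {h} cρ ch = λ where
        zero → cq 0F
        (suc zero) → cq 1F
        (suc (suc i)) → roll-cont k {ρ = λ x → ρ x - fromCircle (first (h x)) 0F - fromCircle (first (h x)) 1F}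
          {λ x → rest (h x)} (cont-- (cont-- cρ (cq 0F)) (cq 1F)) (cont-∘ (cont-reindex (λ (c , s) → suc c , s)) ch) i
      where
      cq : ∀ s → Contℝ (λ x → fromCircle (first (h x)) s)
      cq s = cont-∘ℝ (cont-proj s) (cont-∘ fromCircle-cont (cont-∘ (cont-reindex (λ s → zero , s)) ch))

    roll-sum : ∀ k ρ z → sum (roll k ρ z) ≈ ρ
    roll-sum zero    ρ z = ≈-trans (sum-*ˡ ρ (δ r)) (≈-trans (*-congˡ (sum-δ r)) (*-identityʳ ρ))
    roll-sum (suc k) ρ z = ≈-trans (+-congˡ (+-congˡ (roll-sum k _ (rest z))))
      (solve 3 (λ a b p → a :+ (b :+ (p :- a :- b)) := p) ≈-refl (fromCircle (first z) 0F) (fromCircle (first z) 1F) ρ)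

    Base : ∀ k → Euclidean (Fin k × Fin 2) → Set
    Base k z = ∀ c → (λ s → z (c , s)) ≋ circleBase

    roll-base : ∀ k {ρ z} → Base k z → ∀ i → roll k ρ z i ≈ ρ * δ (embed k r) i
    roll-base zero    zb i = ≈-refl
    roll-base (suc k) {ρ} {z} zb zero          = ≈-trans (proj₁ (fromCircle-base {first z} (zb zero))) (≈-sym (zeroʳ ρ))
    roll-base (suc k) {ρ} {z} zb (suc zero)    = ≈-trans (proj₂ (fromCircle-base {first z} (zb zero))) (≈-sym (zeroʳ ρ))
    roll-base (suc k) {ρ} {z} zb (suc (suc i)) = ≈-trans (roll-base k (λ c → zb (suc c)) i)
      (*-congʳ (≈-trans (+-cong (+-congˡ (-‿cong (proj₁ e))) (-‿cong (proj₂ e))) (solve 1 (λ p → p :- :0 :- :0 := p) ≈-refl ρ)))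
      where e = fromCircle-base {first z} (zb zero)

    -- The points of the rose, and the scaled ones that occur in its parts.
    Petals : ∀ k → Euclidean (Fin (k ℕ.* 2 ℕ.+ n)) → Set
    Petals zero    x = ∀ i → i ≢ r → x i ≈ 0#
    Petals (suc k) x = Triangle (petal₁ {k} x) × Petals k (others {k} x)

    Concentrated : ∀ k → Euclidean (Fin (k ℕ.* 2 ℕ.+ n)) → Set
    Concentrated k x = ∀ i → i ≢ embed k r → x i ≈ 0#

    concentrated-others : ∀ k {x} → Concentrated (suc k) x → Concentrated k (others {k} x)
    concentrated-others k c i i≢r = c (suc (suc i)) (suc-suc-≢ i≢r)

    concentrated⇒petals : ∀ k {x} → Concentrated k x → Petals k x
    concentrated⇒petals zero    c = c
    concentrated⇒petals (suc k) {x} c =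
      ((≤-reflexive (≈-sym x0) , ≤-reflexive (≈-sym x1) , ≤-respˡ (≈-sym (≈-trans (+-cong x0 x1) (+-identityʳ 0#))) 0≤1) , inj₁ x0) ,
      concentrated⇒petals k (concentrated-others k {x} c)
      where
      x0 = c zero (λ ())
      x1 = c (suc zero) (λ ())

    concentrated⇒base : ∀ k {x} → Concentrated k x → Base k (unroll k x)
    concentrated⇒base (suc k) {x} c zero     = toCircle-base {petal₁ {k} x} (c zero (λ ())) (c (suc zero) (λ ()))
    concentrated⇒base (suc k) {x} c (suc c′) = concentrated⇒base k (concentrated-others k {x} c) c′

    rose : ∀ k → Complex (k ℕ.* 2 ℕ.+ n)
    rose k = petals k (vertexComplex r) r


    ∉supp : ∀ {m} {x : Euclidean (Fin m)} {a b} → (∀ v → supp x v → Pair a b v) → ∀ v → v ≢ a → v ≢ b → x v ≈ 0#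
    ∉supp h v v≢a v≢b = byContradiction λ x≉0 → [ v≢a , v≢b ]′ (h v x≉0)

    data Position (k : ℕ) (x : Euclidean (Fin (suc k ℕ.* 2 ℕ.+ n))) : Set where
      inside  : x zero ≈ 0# → x (suc zero) ≈ 0# → Face (rose k) (supp (others {k} x)) → Position k x
      onPetal : Concentrated k (others {k} x) →
        (x zero ≈ 0# ⊎ x (suc zero) ≈ 0# ⊎ (∀ i → others {k} x i ≈ 0#)) → Position k x

    position : ∀ k {x} → Face (rose (suc k)) (supp x) → Position k x
    position k (inj₁ (inj₁ (inj₁ (¬0 , ¬1 , F)))) = inside (byContradiction ¬0) (byContradiction ¬1) F
    position k {x} (inj₁ (inj₁ (inj₂ h))) = onPetal (λ i _ → zeros i) (inj₂ (inj₂ zeros))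
      where
      zeros : ∀ i → others {k} x i ≈ 0#
      zeros i = ∉supp {x = x} h _ (λ ()) (λ ())
    position k {x} (inj₁ (inj₂ h)) = onPetal (λ i i≢r → ∉supp {x = x} h _ (λ ()) (suc-suc-≢ i≢r))
      (inj₂ (inj₁ (∉supp {x = x} h _ (λ ()) (λ ()))))
    position k {x} (inj₂ h) = onPetal (λ i i≢r → ∉supp {x = x} h _ (λ ()) (suc-suc-≢ i≢r))
      (inj₁ (∉supp {x = x} h _ (λ ()) (λ ())))

    rose⇒petals : ∀ k {x} → ∣ rose k ∣ᶜ x → Petals k x
    rose⇒petals zero    {x} (x≥0 , Σx , F) i i≢r = byContradiction λ x≉0 → i≢r (F i x≉0)
    rose⇒petals (suc k) {x} (x≥0 , Σx , F) with position k {x} F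
    ... | inside x0 x1 F′ =
      ((x≥0 _ , x≥0 _ , ≤-respˡ (≈-sym (≈-trans (+-cong x0 x1) (+-identityʳ 0#))) 0≤1) , inj₁ x0) ,
      rose⇒petals k ((λ i → x≥0 (suc (suc i))) , ≈-trans (≈-sym (≈-trans (+-cong x0 (+-congʳ x1)) (≈-trans (+-identityˡ _) (+-identityˡ _)))) Σx , F′)
    ... | onPetal c side =
      ((x≥0 _ , x≥0 _ , ≤-by (sum-nonneg {x = others {k} x} (λ i → x≥0 (suc (suc i)))) slack) ,
       [ inj₁ , [ (λ p → inj₂ (inj₁ p)) , (λ p → inj₂ (inj₂ (total-mass p))) ]′ ]′ side) ,
      concentrated⇒petals k c
      where
      slack : 1# - (x zero + x (suc zero)) ≈ sum (others {k} x)
      slack = ≈-trans (+-congʳ (≈-sym Σx))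
        (solve 3 (λ a b s → a :+ (b :+ s) :- (a :+ b) := s) ≈-refl (x zero) (x (suc zero)) (sum (others {k} x)))
      total-mass : (∀ i → others {k} x i ≈ 0#) → x zero + x (suc zero) ≈ 1#
      total-mass zs = ≈-trans (≈-trans (≈-sym (+-identityʳ _)) (≈-trans (+-congˡ (≈-sym (sum-0 {x = others {k} x} zs))) (+-assoc _ _ _))) Σx

    -- The alternative `Base` keeps the recursion going: without petals the wedge is empty, whereas
    -- the rose still has the point `r`.
    unroll∈ : ∀ k {x} → ∣ rose k ∣ᶜ x → Base k (unroll k x) ⊎ wedgeOfCircles k (unroll k x)
    unroll∈ zero    x∈ = inj₁ λ ()
    unroll∈ (suc k) {x} x∈@(x≥0 , Σx , F) with position k {x} F
    ... | inside x0 x1 F′ = tail (unroll∈ k ((λ i → x≥0 (suc (suc i))) , ≈-trans (≈-sym (≈-trans (+-cong x0 (+-congʳ x1)) (≈-trans (+-identityˡ _) (+-identityˡ _)))) Σx , F′))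
      where
      b₀ = toCircle-base {petal₁ {k} x} x0 x1
      tail : Base k (unroll k (others {k} x)) ⊎ wedgeOfCircles k (unroll k (others {k} x)) →
        Base (suc k) (unroll (suc k) x) ⊎ wedgeOfCircles (suc k) (unroll (suc k) x)
      tail (inj₁ b) = inj₁ λ { zero → b₀ ; (suc c) → b c }
      tail (inj₂ (c , on , off)) = inj₂ (suc c , on , λ
        { zero _ → b₀ ; (suc c′) c′≢c → off c′ (λ e → c′≢c (≡.cong suc e)) })
    ... | onPetal c _ = inj₂ (zero , toCircle∈ {petal₁ {k} x} (proj₁ (rose⇒petals (suc k) {x} x∈)) , λ
        { zero 0≢0 → ⊥-elim (0≢0 refl) ; (suc c′) _ → concentrated⇒base k c c′ })

    -- The mass is not fixed to be `1#`, since a circle at its base point takes away 0 only up to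
    -- `≈`.
    roll∈ : ∀ k {ρ z} → ρ ≈ 1# → wedgeOfCircles k z → ∣ rose k ∣ᶜ (roll k ρ z)
    roll∈ (suc k) {ρ} {z} ρ≈1 (zero , on , off) = nonneg , ≈-trans (roll-sum (suc k) ρ z) ρ≈1 , face (proj₂ tri)
      where
      tri : Triangle (fromCircle (first z))
      tri = fromCircle∈ {first z} on
      A = fromCircle (first z) 0F
      B = fromCircle (first z) 1F
      ρ′ = ρ - A - B
      tail : ∀ i → roll k ρ′ (rest z) i ≈ ρ′ * δ (embed k r) i
      tail = roll-base k (λ c → off (suc c) (λ ()))
      ρ′≈ : ρ′ ≈ 1# - (A + B)
      ρ′≈ = ≈-trans (+-congʳ (+-congʳ ρ≈1)) (solve 2 (λ a b → :1 :- a :- b := :1 :- (a :+ b)) ≈-refl A B)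
      0≤ρ′ : 0# ≤ ρ′
      0≤ρ′ = ≤-respʳ (≈-sym ρ′≈) (0≤- (proj₂ (proj₂ (proj₁ tri))))
      nonneg : ∀ i → 0# ≤ roll (suc k) ρ z i
      nonneg zero          = proj₁ (proj₁ tri)
      nonneg (suc zero)    = proj₁ (proj₂ (proj₁ tri))
      nonneg (suc (suc i)) = ≤-respʳ (≈-sym (tail i)) (*-nonneg 0≤ρ′ (0≤δ (embed k r) i))
      at-r : ∀ i → ¬ roll k ρ′ (rest z) i ≈ 0# → i ≡ embed k r
      at-r i ≉0 = byContradiction λ i≢r → ≉0 (≈-trans (tail i) (≈-trans (*-congˡ (δ-≢ i≢r)) (zeroʳ ρ′)))
      face : A ≈ 0# ⊎ B ≈ 0# ⊎ A + B ≈ 1# → Face (rose (suc k)) (supp (roll (suc k) ρ z))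
      face (inj₁ A≈0) = inj₂ λ
        { zero ≉0 → ⊥-elim (≉0 A≈0) ; (suc zero) _ → inj₁ refl
        ; (suc (suc i)) ≉0 → inj₂ (≡.cong (λ j → suc (suc j)) (at-r i ≉0)) }
      face (inj₂ (inj₁ B≈0)) = inj₁ (inj₂ λ
        { zero _ → inj₁ refl ; (suc zero) ≉0 → ⊥-elim (≉0 B≈0)
        ; (suc (suc i)) ≉0 → inj₂ (≡.cong (λ j → suc (suc j)) (at-r i ≉0)) })
      face (inj₂ (inj₂ A+B≈1)) = inj₁ (inj₁ (inj₂ λ
        { zero _ → inj₁ refl ; (suc zero) _ → inj₂ refl
        ; (suc (suc i)) ≉0 → ⊥-elim (≉0 (≈-trans (tail i) (≈-trans
            (*-congʳ (≈-trans ρ′≈ (≈-trans (+-congˡ (-‿cong A+B≈1)) (-‿inverseʳ 1#)))) (zeroˡ _)))) }))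
    roll∈ (suc k) {ρ} {z} ρ≈1 (suc c , on , off) =
      (λ { zero → ≤-reflexive (≈-sym A≈0) ; (suc zero) → ≤-reflexive (≈-sym B≈0) ; (suc (suc i)) → proj₁ ih i }) ,
      ≈-trans (roll-sum (suc k) ρ z) ρ≈1 ,
      inj₁ (inj₁ (inj₁ ((λ ≉0 → ≉0 A≈0) , (λ ≉0 → ≉0 B≈0) , proj₂ (proj₂ ih))))
      where
      e = fromCircle-base {first z} (off zero (λ ()))
      A≈0 = proj₁ e
      B≈0 = proj₂ e
      ih = roll∈ k {_} {rest z} (≈-trans (+-cong (+-cong ρ≈1 (-‿cong A≈0)) (-‿cong B≈0)) (solve 0 (:1 :- :0 :- :0 := :1) ≈-refl))
        (c , on , λ c′ c′≢c → off (suc c′) (λ e → c′≢c (Fin.suc-injective e)))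

    pt-eta : (x : Plane) → pt (x 0F) (x 1F) ≋ x
    pt-eta x 0F = ≈-refl
    pt-eta x 1F = ≈-refl

    unroll∘roll : ∀ k {ρ z} → (∀ c → circle (λ s → z (c , s))) → unroll k (roll k ρ z) ≋ z
    unroll∘roll (suc k) {ρ} {z} on (zero , s) = ≈-trans
      (cont-resp toCircle-cont {pt (fromCircle (first z) 0F) (fromCircle (first z) 1F)} {fromCircle (first z)} (pt-eta _) s)
      (toCircle∘fromCircle {first z} (on zero) s)
    unroll∘roll (suc k) {ρ} {z} on (suc c , s) = unroll∘roll k {z = rest z} (λ c → on (suc c)) (c , s)

    roll∘unroll : ∀ k {ρ x} → sum x ≈ ρ → Petals k x → roll k ρ (unroll k x) ≋ x
    roll∘unroll zero {ρ} {x} Σx P i = ≈-trans (*-congʳ (≈-trans (≈-sym Σx) mass)) (≈-sym (value i))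
      where
      value : ∀ i → x i ≈ x r * δ r i
      value i with i Fin.≟ r
      ... | yes refl = ≈-sym (≈-trans (*-congˡ (δ-refl i)) (*-identityʳ (x i)))
      ... | no i≢r   = ≈-trans (P i i≢r) (≈-sym (≈-trans (*-congˡ (δ-≢ i≢r)) (zeroʳ (x r))))
      mass : sum x ≈ x r
      mass = ≈-trans (sum-cong-≋ value) (≈-trans (sum-*ˡ (x r) (δ r)) (≈-trans (*-congˡ (sum-δ r)) (*-identityʳ (x r))))
    roll∘unroll (suc k) {ρ} {x} Σx (T , P) = λ
      { zero → e 0F ; (suc zero) → e 1F ; (suc (suc i)) → roll∘unroll k {x = others {k} x} mass P i }
      where
      e : fromCircle (toCircle (petal₁ {k} x)) ≋ petal₁ {k} x
      e = fromCircle∘toCircle {petal₁ {k} x} T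
      mass : sum (others {k} x) ≈ ρ - fromCircle (first (unroll (suc k) x)) 0F - fromCircle (first (unroll (suc k) x)) 1F
      mass = ≈-sym (≈-trans (+-cong (+-cong (≈-sym Σx) (-‿cong (e 0F))) (-‿cong (e 1F)))
        (solve 3 (λ a b s → a :+ (b :+ s) :- a :- b := s) ≈-refl (x zero) (x (suc zero)) (sum (others {k} x))))

    circleBase∈ : circle circleBase
    circleBase∈ = solve 0 (:1 :* :1 :+ :0 :* :0 := :1) ≈-refl

    circle-saturated : Saturated circle
    circle-saturated x≋y x∈ = ≈-trans (+-cong (*-cong (≈-sym (x≋y 0F)) (≈-sym (x≋y 0F))) (*-cong (≈-sym (x≋y 1F)) (≈-sym (x≋y 1F)))) x∈

    wedge⇒circles : ∀ {k z} → wedgeOfCircles k z → ∀ c → circle (λ s → z (c , s))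
    wedge⇒circles (c , on , off) c′ with c′ Fin.≟ c
    ... | yes refl = on
    ... | no c′≢c  = circle-saturated (λ s → ≈-sym (off c′ c′≢c s)) circleBase∈

    rose≃wedge : ∀ k → ∣ rose (suc k) ∣ᶜ ≃ᵗ wedgeOfCircles (suc k)
    rose≃wedge k = homeomorphism (unroll (suc k)) (roll (suc k) 1#)
      (cont-coords (uniform-× (uniform-Fin (suc k)) (uniform-Fin 2)) (unroll-cont (suc k) cont-id))
      (cont-coords (uniform-Fin _) (roll-cont (suc k) (cont-const 1#) cont-id))
      -- A point all of whose circles are at the base point is counted to circle `zero`; this is
      -- where at least one petal is required.
      (λ x x∈ → [ (λ b → zero , circle-saturated (λ s → ≈-sym (b zero s)) circleBase∈ , λ c _ → b c) , id ]′ (unroll∈ (suc k) {x} x∈))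
      (λ z z∈ → roll∈ (suc k) {z = z} ≈-refl z∈)
      (λ x x∈ → roll∘unroll (suc k) {x = x} (proj₁ (proj₂ x∈)) (rose⇒petals (suc k) {x} x∈))
      (λ z z∈ → unroll∘roll (suc k) {z = z} (wedge⇒circles {z = z} z∈))

    rose≃point : ∣ rose 0 ∣ᶜ ≃ᵗ onePoint
    rose≃point = homeomorphism (λ _ ()) (λ _ → δ r)
      (cont-coords (uniform-Fin 0) λ ()) (cont-coords (uniform-Fin _) λ i → cont-const (δ r i))
      (λ _ _ → tt)
      (λ _ _ → 0≤δ r , sum-δ r , λ v ≉0 → byContradiction λ v≢r → ≉0 (δ-≢ v≢r))
      (λ x x∈ i → ≈-trans (≈-sym (*-identityˡ _)) (roll∘unroll zero {x = x} (proj₁ (proj₂ x∈)) (rose⇒petals zero {x} x∈) i))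
      (λ _ _ ())

  -- Neighbourhood complexes without free edges

  -- The part of the neighbourhood complex on the vertices satisfying `R`: reachability for a
  -- component, the full predicate for everything.
  neighbourhoodComplex : Graph n → (Fin n → Set) → Complex n
  neighbourhoodComplex G R = record
    { Face = λ P → ∃ λ w → ∀ v → P v → (v ~ w) × R v
    ; down = λ P⊆Q (w , h) → w , λ v p → h v (P⊆Q v p) }
    where open Graph G

  isomorphism : ∀ {m} (G : Graph n) (H : Graph m) (f : Fin m → Fin n) →
    (∀ {s t} → f s ≡ f t → s ≡ t) → (∀ y → ∃ λ s → f s ≡ y) →
    (∀ s t → Graph._~_ G (f s) (f t) ⇔ Graph._~_ H s t) → G ≅ H
  isomorphism G H f inj sur adj =
    mk↔ₛ′ (λ y → proj₁ (sur y)) f (λ s → inj (proj₂ (sur (f s)))) (λ y → proj₂ (sur y)) ,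
    λ u v → subst (λ p → Graph._~_ G (proj₁ p) (proj₂ p) ⇔ _) (≡.cong₂ _,_ (proj₂ (sur u)) (proj₂ (sur v)))
      (adj (proj₁ (sur u)) (proj₁ (sur v)))

  module Degree3 (G : Graph n) (deg≤3 : maxDegree G ℕ.≤ 3) where
    open Graph G hiding (Connected; maxDegree) renaming (sym to ~-sym)

    degree≤ : ∀ {m} (d : Fin m → ℕ) v → d v ℕ.≤ Vector.foldr ℕ._⊔_ 0 d
    degree≤ d zero    = ℕ.m≤m⊔n _ _
    degree≤ d (suc v) = ℕ.≤-trans (degree≤ (λ i → d (suc i)) v) (ℕ.m≤n⊔m _ _)

    ∈-neighbours : ∀ {v w} → v ~ w → w Subset.∈ neighbours v
    ∈-neighbours {v} {w} v~w = Vec.lookup⇒[]= w _ (≡.trans (Vec.lookup∘tabulate _ w) (dec-true (v ~? w) v~w))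

    -- Otherwise removing `x`, `y`, `z`, `t` in turn from the neighbours of `v` exhibits degree at
    -- least 4. The degree bound enters only here.
    among : ∀ {v x y z t} → x ≢ y → y ≢ z → x ≢ z → v ~ x → v ~ y → v ~ z → v ~ t → Triple x y z t
    among {v} {x} {y} {z} {t} x≢y y≢z x≢z vx vy vz vt = byContradiction λ t∉ →
      let p = neighbours v
          x∈ = ∈-neighbours vx
          y∈ = Subset.x∈p∧x≢y⇒x∈p-y (∈-neighbours vy) (λ e → x≢y (≡.sym e))
          z∈ = Subset.x∈p∧x≢y⇒x∈p-y (Subset.x∈p∧x≢y⇒x∈p-y (∈-neighbours vz) (λ e → x≢z (≡.sym e))) (λ e → y≢z (≡.sym e))
          t∈ = Subset.x∈p∧x≢y⇒x∈p-y (Subset.x∈p∧x≢y⇒x∈p-y (Subset.x∈p∧x≢y⇒x∈p-y (∈-neighbours vt)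
                 (λ e → t∉ (inj₁ e))) (λ e → t∉ (inj₂ (inj₁ e)))) (λ e → t∉ (inj₂ (inj₂ e)))
          4≤ : 4 ℕ.≤ degree v
          4≤ = ℕ.≤-trans (ℕ.s≤s (ℕ.≤-trans (ℕ.s≤s (ℕ.≤-trans (ℕ.s≤s (ℕ.≤-trans (ℕ.s≤s ℕ.z≤n)
                 (Subset.x∈p⇒∣p-x∣<∣p∣ t∈))) (Subset.x∈p⇒∣p-x∣<∣p∣ z∈))) (Subset.x∈p⇒∣p-x∣<∣p∣ y∈))) (Subset.x∈p⇒∣p-x∣<∣p∣ x∈)
      in ℕ.<⇒≱ 4≤ (ℕ.≤-trans (degree≤ degree v) deg≤3)

    -- A copy of the bipartite complement of a perfect matching of K₄,₄, where
    -- the two sides may overlap.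
    module CrownIn (connected : Connected G) (u w : Fin 4 → Fin n)
      (u-inj : ∀ {i j} → u i ≡ u j → i ≡ j) (w-inj : ∀ {i j} → w i ≡ w j → i ≡ j)
      (adjacent : ∀ {i j} → i ≢ j → u i ~ w j) where

      private
        -- `punchIn i` enumerates the three indices other than `i`, hence the neighbours of `u i` or
        -- `w i` on the opposite side.
        ≢-by : ∀ {f : Fin 4 → Fin n} → (∀ {i j} → f i ≡ f j → i ≡ j) → ∀ (i : Fin 4) {k l : Fin 3} → k ≢ l → f (punchIn i k) ≢ f (punchIn i l)
        ≢-by f-inj i k≢l e = k≢l (Fin.punchIn-injective i _ _ (f-inj e))

        away : ∀ (i : Fin 4) (k : Fin 3) → i ≢ punchIn i k
        away i k e = Fin.punchInᵢ≢i i k (≡.sym e)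

        found : ∀ (f : Fin 4 → Fin n) i {y} → Triple (f (punchIn i 0F)) (f (punchIn i 1F)) (f (punchIn i 2F)) y →
          ∃ λ j → i ≢ j × f j ≡ y
        found f i (inj₁ e)        = _ , away i 0F , ≡.sym e
        found f i (inj₂ (inj₁ e)) = _ , away i 1F , ≡.sym e
        found f i (inj₂ (inj₂ e)) = _ , away i 2F , ≡.sym e

      u-neighbour : ∀ {i y} → u i ~ y → ∃ λ j → i ≢ j × w j ≡ y
      u-neighbour {i} uy = found w i (among (≢-by {w} w-inj i {0F} {1F} (λ ())) (≢-by {w} w-inj i {1F} {2F} (λ ())) (≢-by {w} w-inj i {0F} {2F} (λ ()))
        (adjacent (away i 0F)) (adjacent (away i 1F)) (adjacent (away i 2F)) uy)

      w-neighbour : ∀ {i y} → w i ~ y → ∃ λ j → i ≢ j × u j ≡ y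
      w-neighbour {i} wy = found u i (among (≢-by {u} u-inj i {0F} {1F} (λ ())) (≢-by {u} u-inj i {1F} {2F} (λ ())) (≢-by {u} u-inj i {0F} {2F} (λ ()))
        (back 0F) (back 1F) (back 2F) wy)
        where
        back : ∀ k → w i ~ u (punchIn i k)
        back k = ~-sym (adjacent (Fin.punchInᵢ≢i i k))

      -- The three known neighbours of each `u i` and `w i` exhaust its degree, so the crown is
      -- closed under adjacency and, `G` being connected, is all of it.
      everything : ∀ y → (∃ λ i → u i ≡ y) ⊎ (∃ λ i → w i ≡ y)
      everything y = walk (connected (u 0F) y) (inj₁ (0F , refl))
        where
        walk : ∀ {x y} → Star _~_ x y → (∃ λ i → u i ≡ x) ⊎ (∃ λ i → w i ≡ x) → (∃ λ i → u i ≡ y) ⊎ (∃ λ i → w i ≡ y)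
        walk done           here = here
        walk (x~y then y⋯z) (inj₁ (i , refl)) = let (j , _ , e) = u-neighbour x~y in walk y⋯z (inj₂ (j , e))
        walk (x~y then y⋯z) (inj₂ (i , refl)) = let (j , _ , e) = w-neighbour x~y in walk y⋯z (inj₁ (j , e))

      -- Otherwise `u i ~ w j` would be a loop.
      meet⇒same : ∀ {i j} → u i ≡ w j → i ≡ j
      meet⇒same {i} {j} e = byContradiction λ i≢j → irrefl refl (subst (u i ~_) (≡.sym e) (adjacent i≢j))

      -- One coincidence `u i ≡ w i` spreads: every other `u l` is adjacent to `w i`, that is to
      -- `u i`, and so is some `w m`; then `m ≡ l`. With the sides identified, the crown is complete
      -- on four vertices.
      overlap⇒K₄ : ∀ {i j} → u i ≡ w j → G ≅ K₄
      overlap⇒K₄ {i} {j} e = isomorphism G K₄ u u-inj onto adj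
        where
        same : ∀ l → u l ≡ w l
        same l with l Fin.≟ i
        ... | yes refl = subst (λ m → u i ≡ w m) (≡.sym (meet⇒same e)) e
        ... | no l≢i with u-neighbour {i} {u l} (subst (_~ u l)
                (≡.trans (≡.cong w (meet⇒same e)) (≡.sym e)) (~-sym (adjacent l≢i)))
        ...   | (m , _ , wm≡ul) = ≡.trans (≡.sym wm≡ul) (≡.cong w (≡.sym (meet⇒same (≡.sym wm≡ul))))
        onto : ∀ y → ∃ λ s → u s ≡ y
        onto y = [ id , (λ (s , e) → s , ≡.trans (same s) e) ]′ (everything y)
        adj : ∀ s t → (u s ~ u t) ⇔ (s ≢ t)
        adj s t = mk⇔ (λ { us~ut refl → irrefl refl us~ut }) (λ s≢t → subst (u s ~_) (≡.sym (same t)) (adjacent s≢t))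

      Side : Set
      Side = Fin 4 ⊎ Fin 4

      vertex : Side → Fin n
      vertex = [ u , w ]′

      -- T with its bipartition: antipodal vertices of the cube share an index.
      side : Fin 8 → Side
      side 0F = inj₁ 0F
      side 1F = inj₂ 1F
      side 2F = inj₂ 2F
      side 3F = inj₂ 3F
      side 4F = inj₁ 1F
      side 5F = inj₂ 0F
      side 6F = inj₁ 2F
      side 7F = inj₁ 3F

      unside : Side → Fin 8
      unside (inj₁ 0F) = 0F
      unside (inj₁ 1F) = 4F
      unside (inj₁ 2F) = 6F
      unside (inj₁ 3F) = 7F
      unside (inj₂ 0F) = 5F
      unside (inj₂ 1F) = 1F
      unside (inj₂ 2F) = 2F
      unside (inj₂ 3F) = 3F

      unside∘side : ∀ s → unside (side s) ≡ s
      unside∘side = from-yes (Fin.all? λ s → unside (side s) Fin.≟ s)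

      side∘unside : ∀ s → side (unside s) ≡ s
      side∘unside (inj₁ 0F) = refl
      side∘unside (inj₁ 1F) = refl
      side∘unside (inj₁ 2F) = refl
      side∘unside (inj₁ 3F) = refl
      side∘unside (inj₂ 0F) = refl
      side∘unside (inj₂ 1F) = refl
      side∘unside (inj₂ 2F) = refl
      side∘unside (inj₂ 3F) = refl

      Crown : Side → Side → Set
      Crown (inj₁ i) (inj₂ j) = i ≢ j
      Crown (inj₂ i) (inj₁ j) = i ≢ j
      Crown _        _        = ⊥

      crown? : ∀ s t → Dec (Crown s t)
      crown? (inj₁ i) (inj₁ j) = no λ ()
      crown? (inj₁ i) (inj₂ j) = ¬? (i Fin.≟ j)
      crown? (inj₂ i) (inj₁ j) = ¬? (i Fin.≟ j)
      crown? (inj₂ i) (inj₂ j) = no λ ()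

      T-crown : ∀ s t → does (Graph._~?_ T s t) ≡ does (crown? (side s) (side t))
      T-crown = from-yes (Fin.all? λ s → Fin.all? λ t → does (Graph._~?_ T s t) Bool.≟ does (crown? (side s) (side t)))

      does-⇔ : ∀ {A B : Set} (a : Dec A) (b : Dec B) → does a ≡ does b → A ⇔ B
      does-⇔ (yes a) (yes b) _ = mk⇔ (λ _ → b) (λ _ → a)
      does-⇔ (no ¬a) (no ¬b) _ = mk⇔ (λ a → ⊥-elim (¬a a)) (λ b → ⊥-elim (¬b b))

      disjoint⇒T : (∀ {i j} → u i ≢ w j) → G ≅ T
      disjoint⇒T disjoint = isomorphism G T (vertex ∘ side) inj onto
        λ s t → let c = does-⇔ (Graph._~?_ T s t) (crown? (side s) (side t)) (T-crown s t)
                in mk⇔ (Equivalence.from c ∘ to (side s) (side t)) (from (side s) (side t) ∘ Equivalence.to c)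
        where
        vertex-inj : ∀ s t → vertex s ≡ vertex t → s ≡ t
        vertex-inj (inj₁ i) (inj₁ j) e = ≡.cong inj₁ (u-inj e)
        vertex-inj (inj₁ i) (inj₂ j) e = ⊥-elim (disjoint e)
        vertex-inj (inj₂ i) (inj₁ j) e = ⊥-elim (disjoint (≡.sym e))
        vertex-inj (inj₂ i) (inj₂ j) e = ≡.cong inj₂ (w-inj e)
        inj : ∀ {s t} → vertex (side s) ≡ vertex (side t) → s ≡ t
        inj {s} {t} e = ≡.trans (≡.sym (unside∘side s)) (≡.trans (≡.cong unside (vertex-inj _ _ e)) (unside∘side t))
        onto : ∀ y → ∃ λ s → vertex (side s) ≡ y
        onto y = [ (λ (i , e) → unside (inj₁ i) , ≡.trans (≡.cong vertex (side∘unside (inj₁ i))) e) ,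
                   (λ (i , e) → unside (inj₂ i) , ≡.trans (≡.cong vertex (side∘unside (inj₂ i))) e) ]′ (everything y)
        to : ∀ s t → vertex s ~ vertex t → Crown s t
        to (inj₁ i) (inj₁ j) e = let (_ , _ , p) = u-neighbour e in disjoint (≡.sym p)
        to (inj₁ i) (inj₂ j) e = let (k , i≢k , p) = u-neighbour e in subst (i ≢_) (w-inj p) i≢k
        to (inj₂ i) (inj₁ j) e = let (k , i≢k , p) = w-neighbour e in subst (i ≢_) (u-inj p) i≢k
        to (inj₂ i) (inj₂ j) e = let (_ , _ , p) = w-neighbour e in disjoint p
        from : ∀ s t → Crown s t → vertex s ~ vertex t
        from (inj₁ i) (inj₂ j) i≢j = adjacent i≢j
        from (inj₂ i) (inj₁ j) i≢j = ~-sym (adjacent λ j≡i → i≢j (≡.sym j≡i))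

      crown⇒K₄⊎T : (G ≅ K₄) ⊎ (G ≅ T)
      crown⇒K₄⊎T with dec {∃₂ λ i j → u i ≡ w j}
      ... | yes (i , j , e) = inj₁ (overlap⇒K₄ e)
      ... | no ¬meet        = inj₂ (disjoint⇒T λ e → ¬meet (_ , _ , e))

    -- `K` is what earlier collapses have left: further triangles come from `second` and lie in `K`,
    -- their common neighbours come from `K⊑` and lie in `G`.
    module NoFreeEdge (connected : Connected G) (K : Complex n) (K⊑ : K ⊑ neighbourhoodComplex G (λ _ → ⊤))
      (second : ∀ {a b c} → a ≢ b → b ≢ c → a ≢ c → Face K (Triple a b c) → ∃ λ d → ¬ Triple a b c d × Face K (Triple a b d)) where

      -- By `only`, the three vertices are the whole neighbourhood of `apex`. The apex is kept as
      -- data, so that reordering the vertices does not change it.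
      record Triangleᴳ (a b c : Fin n) : Set where
        field
          a≢b : a ≢ b
          b≢c : b ≢ c
          a≢c : a ≢ c
          face : Face K (Triple a b c)
          apex : Fin n
          apex~a : apex ~ a
          apex~b : apex ~ b
          apex~c : apex ~ c

        only : ∀ {x} → apex ~ x → Triple a b c x
        only = among a≢b b≢c a≢c apex~a apex~b apex~c

      open Triangleᴳ

      triangle : ∀ {a b c} → a ≢ b → b ≢ c → a ≢ c → Face K (Triple a b c) → Triangleᴳ a b c
      triangle p q s F with K⊑ _ F
      ... | (w , h) = record
        { a≢b = p ; b≢c = q ; a≢c = s ; face = F ; apex = w
        ; apex~a = ~-sym (proj₁ (h _ (inj₁ refl))) ; apex~b = ~-sym (proj₁ (h _ (inj₂ (inj₁ refl))))
        ; apex~c = ~-sym (proj₁ (h _ (inj₂ (inj₂ refl)))) }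

      neighbouring : ∀ {a b c} → Triangleᴳ a b c → ∃ λ d → ¬ Triple a b c d × Triangleᴳ a b d
      neighbouring t with second (a≢b t) (b≢c t) (a≢c t) (face t)
      ... | (d , d∉ , F) = d , d∉ , triangle (a≢b t) (λ b≡d → d∉ (inj₂ (inj₁ (≡.sym b≡d)))) (λ a≡d → d∉ (inj₁ (≡.sym a≡d))) F

      rotate : ∀ {a b c} → Triangleᴳ a b c → Triangleᴳ b c a
      rotate t = record
        { a≢b = b≢c t ; b≢c = λ e → a≢c t (≡.sym e) ; a≢c = λ e → a≢b t (≡.sym e)
        ; face = down K (λ { _ (inj₁ e) → inj₂ (inj₁ e) ; _ (inj₂ (inj₁ e)) → inj₂ (inj₂ e) ; _ (inj₂ (inj₂ e)) → inj₁ e }) (face t)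
        ; apex = apex t ; apex~a = apex~b t ; apex~b = apex~c t ; apex~c = apex~a t }

      flip : ∀ {a b c} → Triangleᴳ a b c → Triangleᴳ b a c
      flip t = record
        { a≢b = λ e → a≢b t (≡.sym e) ; b≢c = a≢c t ; a≢c = b≢c t
        ; face = down K (λ { _ (inj₁ e) → inj₂ (inj₁ e) ; _ (inj₂ (inj₁ e)) → inj₁ e ; _ (inj₂ (inj₂ e)) → inj₂ (inj₂ e) }) (face t)
        ; apex = apex t ; apex~a = apex~b t ; apex~b = apex~a t ; apex~c = apex~c t }

      -- An apex has no neighbours outside its triangle, whereas `apex t` has the neighbour `x`
      -- outside the triangle of `s`.
      apex≢ : ∀ {a b c d e f} (s : Triangleᴳ a b c) (t : Triangleᴳ d e f) {x} → apex t ~ x → ¬ Triple a b c x → apex s ≢ apex t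
      apex≢ s t tx x∉ e = x∉ (only s (subst (_~ _) (≡.sym e) tx))

      ∉triple : ∀ {a b c x : Fin n} → x ≢ a → x ≢ b → x ≢ c → ¬ Triple a b c x
      ∉triple p q s = [ p , [ q , s ]′ ]′

      triple-swap : ∀ {a b c x : Fin n} → Triple a b c x → Triple a c b x
      triple-swap = [ inj₁ , [ (λ e → inj₂ (inj₂ e)) , (λ e → inj₂ (inj₁ e)) ]′ ]′

      injective₄ : ∀ (f : Fin 4 → Fin n) → f 0F ≢ f 1F → f 0F ≢ f 2F → f 0F ≢ f 3F → f 1F ≢ f 2F → f 1F ≢ f 3F → f 2F ≢ f 3F →
        ∀ {i j} → f i ≡ f j → i ≡ j
      injective₄ f p q r s t u {i} {j} e with i Fin.≟ j
      ... | yes i≡j = i≡j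
      ... | no i≢j  = ⊥-elim (distinct i j i≢j e)
        where
        distinct : ∀ i j → i ≢ j → f i ≢ f j
        distinct 0F 0F i≢j = ⊥-elim (i≢j refl)
        distinct 0F 1F _ = p
        distinct 0F 2F _ = q
        distinct 0F 3F _ = r
        distinct 1F 0F _ = λ e → p (≡.sym e)
        distinct 1F 1F i≢j = ⊥-elim (i≢j refl)
        distinct 1F 2F _ = s
        distinct 1F 3F _ = t
        distinct 2F 0F _ = λ e → q (≡.sym e)
        distinct 2F 1F _ = λ e → s (≡.sym e)
        distinct 2F 2F i≢j = ⊥-elim (i≢j refl)
        distinct 2F 3F _ = u
        distinct 3F 0F _ = λ e → r (≡.sym e)
        distinct 3F 1F _ = λ e → t (≡.sym e)
        distinct 3F 2F _ = λ e → u (≡.sym e)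
        distinct 3F 3F i≢j = ⊥-elim (i≢j refl)

      -- The four facets of a tetrahedron yield a crown: `w i` is the apex of the facet opposite to
      -- `u i`, hence adjacent to the three other vertices.
      closed : ∀ {v a b c} → c ≢ v → c ≢ a → c ≢ b →
        Triangleᴳ v a b → Triangleᴳ v a c → Triangleᴳ v b c → Triangleᴳ a b c → (G ≅ K₄) ⊎ (G ≅ T)
      closed {v} {a} {b} {c} c≢v c≢a c≢b t₁ t₂ t₃ t₄ = CrownIn.crown⇒K₄⊎T connected u w
        (injective₄ u (a≢b t₁) (a≢c t₁) (a≢c t₂) (b≢c t₁) (b≢c t₂) (b≢c t₃))
        (injective₄ w
          (λ e → apex≢ t₃ t₄ (apex~a t₄) (∉triple (λ e → a≢b t₁ (≡.sym e)) (a≢b t₄) (a≢c t₄)) (≡.sym e))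
          (λ e → apex≢ t₂ t₄ (apex~b t₄) (∉triple (λ e → a≢c t₁ (≡.sym e)) (λ e → b≢c t₁ (≡.sym e)) (b≢c t₄)) (≡.sym e))
          (λ e → apex≢ t₁ t₄ (apex~c t₄) c∉ (≡.sym e))
          (apex≢ t₃ t₂ (apex~b t₂) (∉triple (λ e → a≢b t₁ (≡.sym e)) (a≢b t₄) (a≢c t₄)))
          (λ e → apex≢ t₁ t₃ (apex~c t₃) c∉ (≡.sym e))
          (λ e → apex≢ t₁ t₂ (apex~c t₂) c∉ (≡.sym e)))
        (λ {i} {j} → adjacent i j)
        where
        c∉ : ¬ Triple v a b c
        c∉ = ∉triple c≢v c≢a c≢b
        u w : Fin 4 → Fin n
        u 0F = v
        u 1F = a
        u 2F = b
        u 3F = c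
        w 0F = apex t₄
        w 1F = apex t₃
        w 2F = apex t₂
        w 3F = apex t₁
        adjacent : ∀ i j → i ≢ j → u i ~ w j
        adjacent 0F 1F _ = ~-sym (apex~a t₃)
        adjacent 0F 2F _ = ~-sym (apex~a t₂)
        adjacent 0F 3F _ = ~-sym (apex~a t₁)
        adjacent 1F 0F _ = ~-sym (apex~a t₄)
        adjacent 1F 2F _ = ~-sym (apex~b t₂)
        adjacent 1F 3F _ = ~-sym (apex~b t₁)
        adjacent 2F 0F _ = ~-sym (apex~b t₄)
        adjacent 2F 1F _ = ~-sym (apex~b t₃)
        adjacent 2F 3F _ = ~-sym (apex~c t₁)
        adjacent 3F 0F _ = ~-sym (apex~c t₄)
        adjacent 3F 1F _ = ~-sym (apex~c t₃)
        adjacent 3F 2F _ = ~-sym (apex~c t₂)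
        adjacent 0F 0F i≢j = ⊥-elim (i≢j refl)
        adjacent 1F 1F i≢j = ⊥-elim (i≢j refl)
        adjacent 2F 2F i≢j = ⊥-elim (i≢j refl)
        adjacent 3F 3F i≢j = ⊥-elim (i≢j refl)

      -- Two triangles at v a determine the third apex of v, since v has only three neighbours.
      third : ∀ {v a b c} → ¬ Triple v a b c → Triangleᴳ v a b → Triangleᴳ v a c → Triangleᴳ v b c
      third {v} {a} {b} {c} c∉ t₁ t₂ =
        let (d , d∉ , t₃) = neighbouring (flip (rotate (rotate t₁)))
            (e , e∉ , t)  = neighbouring (flip (rotate (rotate t₂)))
        in subst (Triangleᴳ v b) (≡.sym (c≡ d∉ t₃ e∉ t)) t₃
        where
        c≡ : ∀ {d e} → ¬ Triple v b a d → Triangleᴳ v b d → ¬ Triple v c a e → Triangleᴳ v c e → c ≡ d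
        -- The apexes of `t₁`, `t₂`, `t₃` are three distinct neighbours of `v`, so `apex t` is one
        -- of them. The first is not adjacent to `c` and the second not to `e`; hence it is the
        -- third, and its neighbour `c` must be `d`.
        c≡ {d} {e} d∉ t₃ e∉ t with among
          (apex≢ t₁ t₂ (apex~c t₂) c∉)
          (apex≢ t₂ t₃ (apex~b t₃) (∉triple (λ e → a≢c t₁ (≡.sym e)) (λ e → b≢c t₁ (≡.sym e)) (λ e → c∉ (inj₂ (inj₂ (≡.sym e))))))
          (apex≢ t₁ t₃ (apex~c t₃) (λ h → d∉ (triple-swap h)))
          (~-sym (apex~a t₁)) (~-sym (apex~a t₂)) (~-sym (apex~a t₃)) (~-sym (apex~a t))
        ... | inj₁ p        = ⊥-elim (c∉ (only t₁ (subst (_~ c) p (apex~b t))))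
        ... | inj₂ (inj₁ p) = ⊥-elim (e∉ (triple-swap (only t₂ (subst (_~ e) p (apex~c t)))))
        ... | inj₂ (inj₂ p) with only t₃ (subst (_~ c) p (apex~b t))
        ...   | inj₁ c≡v        = ⊥-elim (c∉ (inj₁ c≡v))
        ...   | inj₂ (inj₁ c≡b) = ⊥-elim (c∉ (inj₂ (inj₂ c≡b)))
        ...   | inj₂ (inj₂ c≡d) = c≡d

      -- From two triangles on the edge {v, a}, `third` applied at `v` and at `a` gives the two
      -- missing facets.
      tetrahedron : ∀ {v a b} → Triangleᴳ v a b → (G ≅ K₄) ⊎ (G ≅ T)
      tetrahedron t₁ with neighbouring t₁
      ... | (c , c∉ , t₂) = closed (λ e → c∉ (inj₁ e)) (λ e → c∉ (inj₂ (inj₁ e))) (λ e → c∉ (inj₂ (inj₂ e)))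
        t₁ t₂ (third c∉ t₁ t₂) (third (λ h → c∉ (triple-cycle′ h)) (flip t₁) (flip t₂))
        where
        triple-cycle′ : ∀ {a b c x : Fin n} → Triple a b c x → Triple b a c x
        triple-cycle′ = [ (λ e → inj₂ (inj₁ e)) , [ inj₁ , (λ e → inj₂ (inj₂ e)) ]′ ]′

    -- Being a connected subcomplex of the neighbourhood complex is stable under the collapses;
    -- being a neighbourhood complex is not.
    triangle-free : Connected G → ¬ (G ≅ K₄) → ¬ (G ≅ T) → {r : Fin n} →
      ∀ m (K : Complex n) → measure (λ u v → Face K (Pair u v)) ℕ.< m → K ⊑ neighbourhoodComplex G (λ _ → ⊤) →
      Face K (Pair r r) → Connectedᶜ K r →
      ∃ λ (L : Complex n) → K ≃ᶜ L × AtMostOneDimensional L × Face L (Pair r r) × Connectedᶜ L r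
    triangle-free connected ≇K₄ ≇T {r} (suc m) K μ<m K⊑ rr conn
      with dec {∃ λ a → ∃₂ λ b c → a ≢ b × b ≢ c × a ≢ c × Face K (Triple a b c) × (∀ d → Face K (Triple a b d) → Triple a b c d)}
    ... | yes (a , b , c , a≢b , b≢c , a≢c , abc , free) =
      let (L , e , rest) = triangle-free connected ≇K₄ ≇T m (K ∖ (a , b))
            (ℕ.<-≤-trans (measure-< {R = λ u v → Face (K ∖ (a , b)) (Pair u v)} {λ u v → Face K (Pair u v)} proj₁
              (down K (λ { _ (inj₁ e) → inj₁ e ; _ (inj₂ e) → inj₂ (inj₁ e) }) abc)
              (λ (_ , ¬ab) → ¬ab (inj₁ refl , inj₂ refl))) (ℕ.≤-pred μ<m))
            (λ P (F , _) → K⊑ P F)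
            (rr , λ (a∈ , b∈) → a≢b (≡.trans (pair-diag a a∈) (≡.sym (pair-diag b b∈))))
            conn′
      in L , (Collapse.collapse K (λ e → a≢c (≡.sym e)) (λ e → b≢c (≡.sym e)) abc
          (λ P F Pa Pb v Pv → free v (down K (λ { _ (inj₁ refl) → Pa ; _ (inj₂ (inj₁ refl)) → Pb ; _ (inj₂ (inj₂ refl)) → Pv }) F)) ⟫ e) , rest
      where
      ac : Face (K ∖ (a , b)) (Pair a c)
      ac = down K (λ { _ (inj₁ e) → inj₁ e ; _ (inj₂ e) → inj₂ (inj₂ e) }) abc ,
        λ (_ , b∈) → ∉pair (λ e → a≢b (≡.sym e)) b≢c b∈
      bc : Face (K ∖ (a , b)) (Pair b c)
      bc = down K (λ _ → inj₂) abc , λ (a∈ , _) → ∉pair a≢b a≢c a∈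
      -- The deleted edge {a, b} is bypassed through `c`, as `ac` and `bc` survive.
      conn′ : Connectedᶜ (K ∖ (a , b)) r
      conn′ P Pr closed x (xx , _) = conn P Pr closed′ x xx
        where
        swap : ∀ {x y} → Face (K ∖ (a , b)) (Pair x y) → Face (K ∖ (a , b)) (Pair y x)
        swap = down (K ∖ (a , b)) pair-swap
        closed′ : ∀ x y → Face K (Pair x y) → P x → P y
        closed′ x y xy Px with dec {Pair x y a × Pair x y b}
        ... | no ¬ab = closed x y (xy , ¬ab) Px
        ... | yes (inj₁ refl , inj₁ refl) = ⊥-elim (a≢b refl)
        ... | yes (inj₂ refl , inj₂ refl) = ⊥-elim (a≢b refl)
        ... | yes (inj₁ refl , inj₂ refl) = closed c b (swap bc) (closed a c ac Px)
        ... | yes (inj₂ refl , inj₁ refl) = closed c a (swap ac) (closed b c bc Px)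
    -- Now every edge of a triangle of `K` lies in a second triangle of `K`, so a single triangle
    -- would make `G` one of the two excluded graphs.
    ... | no ¬free = K , ≃ᶜ-ext (λ _ → id) (λ _ → id) , 1-dim , rr , conn
      where
      second : ∀ {a b c} → a ≢ b → b ≢ c → a ≢ c → Face K (Triple a b c) → ∃ λ d → ¬ Triple a b c d × Face K (Triple a b d)
      second {a} {b} {c} a≢b b≢c a≢c abc = byContradiction λ none →
        ¬free (a , b , c , a≢b , b≢c , a≢c , abc , λ d abd → byContradiction λ d∉ → none (d , d∉ , abd))
      module N = NoFreeEdge connected K K⊑ second
      1-dim : AtMostOneDimensional K
      1-dim P F x y z Px Py Pz = byContradiction λ distinct →
        [ ≇K₄ , ≇T ]′ (N.tetrahedron (N.triangle (λ e → distinct (inj₁ e)) (λ e → distinct (inj₂ (inj₁ e))) (λ e → distinct (inj₂ (inj₂ e)))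
          (down K (λ { _ (inj₁ refl) → Px ; _ (inj₂ (inj₁ refl)) → Py ; _ (inj₂ (inj₂ refl)) → Pz }) F)))

  -- Components

  open-resp : ∀ {I} {U : Space I} → Open U → Saturated U
  open-resp openU {x} {y} x≋y x∈ = let (ε , 0<ε , h) = openU x x∈ in h y (λ i → close-refl 0<ε (x≋y i))

  -- Connectedness of line segments

  segment : Euclidean (Fin n) → Euclidean (Fin n) → ℝ → Euclidean (Fin n)
  segment x y t i = x i + t * (y i - x i)

  segment-cont : (x y : Euclidean (Fin n)) → Cont {Fin 1} (λ p → segment x y (p 0F))
  segment-cont x y = cont-coords (uniform-Fin _) λ i →
    cont-+ (cont-const (x i)) (cont-* (cont-proj 0F) (cont-const (y i - x i)))

  -- The supremum s of the initial part of a segment that lies in U can neither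
  -- lie in V nor be less than 1.
  module Segment {U V : Space (Fin n)} (openU : Open U) (openV : Open V) (x y : Euclidean (Fin n))
    (disjoint : ∀ t → 0# ≤ t → t ≤ 1# → ¬ (U (segment x y t) × V (segment x y t))) where

    γ : ℝ → Euclidean (Fin n)
    γ = segment x y

    S : ℝ → Set
    S t = 0# ≤ t × t ≤ 1# × (∀ u → 0# ≤ u → u ≤ t → U (γ u))

    S-0 : U x → S 0#
    S-0 x∈U = ≤-refl , 0≤1 , λ u 0≤u u≤0 → open-resp openU (λ i → ≈-sym
      (≈-trans (+-congˡ (≈-trans (*-congʳ (≤-antisym u≤0 0≤u)) (zeroˡ _))) (+-identityʳ _))) x∈U

    near : {W : Space (Fin n)} → Open W → ∀ s → W (γ s) → ∃ λ η → 0# < η × (∀ t → Close η s t → W (γ t))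
    near openW s ∈W =
      let (ε , 0<ε , h) = openW (γ s) ∈W
          (η , 0<η , h′) = segment-cont x y (λ _ → s) ε 0<ε
      in η , 0<η , λ t c → h (γ t) (h′ (λ _ → t) (λ _ → c))

    module Sup (s : ℝ) (0≤s : 0# ≤ s) (s≤1 : s ≤ 1#) (upper : ∀ t → S t → t ≤ s) (least : ∀ b → b IsUpperBoundOf S → s ≤ b) where

      approach : ∀ η → 0# < η → ∃ λ t → S t × s < t + η
      approach η 0<η = byContradiction λ none → <⇒≱
        (<-by 0<η (solve 2 (λ s d → s :- (s :- d) := d) ≈-refl s η))
        (least (s - η) λ t St → ≤-by
          (0≤- (≮⇒≥ λ s<t+η → none (t , St , s<t+η))) (solve 3 (λ s d t → s :- d :- t := s :- (t :+ d)) ≈-refl s η t))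

      ∉V : V (γ s) → ⊥
      ∉V ∈V =
        let (η , 0<η , h) = near openV s ∈V
            (t , (0≤t , t≤1 , below) , s<t+η) = approach η 0<η
        in disjoint t 0≤t t≤1 (below t 0≤t ≤-refl ,
           h t (s<t+η , ≤-<-trans (upper t (0≤t , t≤1 , below)) (<-by 0<η (solve 2 (λ s d → s :+ d :- s := d) ≈-refl s η))))

      -- Up to some `t` in `S` close to the supremum, points lie in `U` by the definition of `S`;
      -- those after `t` are within `η` of `s`. The factor ½ makes this strict, and the minimum with
      -- 1 stays on the segment.
      beyond : ∀ η → 0# < η → (∀ t → Close η s t → U (γ t)) → S ((s + ½ * η) ⊓ 1#)
      beyond η 0<η h =
        let (t , (_ , _ , below) , s<t+η) = approach η 0<η
        in 0≤⊓ (0≤+ 0≤s (<⇒≤ (0<* 0<½ 0<η))) 0≤1 , x⊓y≤y _ 1# , λ u 0≤u u≤b → [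
          below u 0≤u ,
          (λ t<u → h u (<-≤-trans s<t+η (+-mono-≤ (<⇒≤ t<u) ≤-refl) ,
            ≤-<-trans (≤-trans u≤b (x⊓y≤x _ 1#))
              (<-by (0<- (halve-< 0<η)) (solve 3 (λ s d e → s :+ d :- (s :+ e) := d :- e) ≈-refl s η (½ * η))))) ]′ (≤∨> u t)

      ∈U⇒1 : U (γ s) → s ≈ 1#
      ∈U⇒1 ∈U =
        let (η , 0<η , h) = near openU s ∈U
        in ≤-antisym s≤1 (≮⇒≥ λ s<1 → <⇒≱ (above (<-by (0<* 0<½ 0<η) (solve 2 (λ s d → s :+ d :- s := d) ≈-refl s (½ * η))) s<1)
             (upper _ (beyond η 0<η h)))
        where
        above : ∀ {b} → s < b → s < 1# → s < b ⊓ 1#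
        above {b} s<b s<1 with total b 1#
        ... | inj₁ b≤1 = <-respʳ (≈-sym (x≤y⇒x⊓y≈x b≤1)) s<b
        ... | inj₂ 1≤b = <-respʳ (≈-sym (y≤x⇒x⊓y≈y 1≤b)) s<1

      end : U (γ s) ⊎ V (γ s) → U y
      end (inj₂ ∈V) = ⊥-elim (∉V ∈V)
      end (inj₁ ∈U) = open-resp openU (λ i → ≈-trans (+-congˡ (*-congʳ (∈U⇒1 ∈U)))
        (solve 2 (λ x y → x :+ :1 :* (y :- x) := y) ≈-refl (x i) (y i))) ∈U

  segment-connected : {U V : Space (Fin n)} → Open U → Open V → ∀ x y →
    (∀ t → 0# ≤ t → t ≤ 1# → U (segment x y t) ⊎ V (segment x y t)) →
    (∀ t → 0# ≤ t → t ≤ 1# → ¬ (U (segment x y t) × V (segment x y t))) → U x → U y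
  segment-connected openU openV x y cover disjoint x∈U =
    let open Segment openU openV x y disjoint
        (s , upper , least) = supremum S (0# , S-0 x∈U) (1# , λ t p → proj₁ (proj₂ p))
        0≤s = upper 0# (S-0 x∈U)
        s≤1 = least 1# λ t p → proj₁ (proj₂ p)
    in Sup.end s 0≤s s≤1 upper least (cover s 0≤s s≤1)

  segment∈ : (K : Complex n) → ∀ {x y} → (∀ v → 0# ≤ x v) → sum x ≈ 1# → (∀ v → 0# ≤ y v) → sum y ≈ 1# →
    Face K (λ v → supp x v ⊎ supp y v) → ∀ t → 0# ≤ t → t ≤ 1# → ∣ K ∣ᶜ (segment x y t)
  segment∈ K {x} {y} x≥0 Σx y≥0 Σy F t 0≤t t≤1 =
    (λ v → ≤-respʳ (solve 3 (λ t x y → (:1 :- t) :* x :+ t :* y := x :+ t :* (y :- x)) ≈-refl t (x v) (y v))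
      (0≤+ (*-nonneg (0≤- t≤1) (x≥0 v)) (*-nonneg 0≤t (y≥0 v)))) ,
    ≈-trans (∑-distrib-+ x (λ v → t * (y v - x v)))
      (≈-trans (+-cong Σx (≈-trans (sum-*ˡ t (λ v → y v - x v)) (*-congˡ
        (≈-trans (∑-distrib-+ y (λ v → - x v)) (+-cong Σy (≈-trans
          (sum-cong-≋ λ v → solve 1 (λ x → :- x := (:- :1) :* x) ≈-refl (x v)) (≈-trans (sum-*ˡ (- 1#) x) (*-congˡ Σx))))))))
        (solve 1 (λ t → :1 :+ t :* (:1 :+ (:- :1) :* :1) := :1) ≈-refl t)) ,
    down K (λ v ≉0 → byContradiction λ ¬∈ → ≉0 (≈-trans
      (+-cong (byContradiction λ x≉0 → ¬∈ (inj₁ x≉0)) (*-congˡ (+-cong (byContradiction λ y≉0 → ¬∈ (inj₂ y≉0))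
        (-‿cong (byContradiction λ x≉0 → ¬∈ (inj₁ x≉0))))))
      (solve 1 (λ t → :0 :+ t :* (:0 :- :0) := :0) ≈-refl t))) F

  support-nonempty : (x : Euclidean (Fin n)) → sum x ≈ 1# → ∃ λ v → supp x v
  support-nonempty x Σx = byContradiction λ none →
    0≉1 (≈-trans (≈-sym (sum-0 {x = x} λ v → byContradiction λ x≉0 → none (v , x≉0))) Σx)

  -- A component as the realization of a subcomplex

  module Component (G : Graph n) (C : Space (Fin n)) (comp : IsComponentOf C ∥ 𝒩 G ∥) where
    open Graph G hiding (Connected; maxDegree) renaming (sym to ~-sym)

    Common : Fin n → Fin n → Set
    Common u v = ∃ λ w → u ~ w × v ~ w

    common-sym : ∀ {u v} → Common u v → Common v u
    common-sym (w , p , q) = w , q , p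

    C⊆X : ∀ {x} → C x → ∥ 𝒩 G ∥ x
    C⊆X = proj₁ comp

    x₀ : Euclidean (Fin n)
    x₀ = proj₁ (proj₁ (proj₁ (proj₂ comp)))

    x₀∈ : C x₀
    x₀∈ = proj₂ (proj₁ (proj₁ (proj₂ comp)))

    r : Fin n
    r = proj₁ (support-nonempty x₀ (proj₁ (proj₂ (C⊆X x₀∈))))

    r∈x₀ : supp x₀ r
    r∈x₀ = proj₂ (support-nonempty x₀ (proj₁ (proj₂ (C⊆X x₀∈))))

    Reach : Fin n → Set
    Reach = Star Common r

    K : Complex n
    K = neighbourhoodComplex G Reach

    neighbour : ∀ {x} → ∥ 𝒩 G ∥ x → ∃ λ w → ∀ v → supp x v → v ~ w
    neighbour (_ , _ , σ , (_ , w , h) , out) = w , λ v x≉0 → h (byContradiction λ v∉ → x≉0 (out v v∉))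

    positive : ∀ {x : Euclidean (Fin n)} {v} → (∀ v → 0# ≤ x v) → supp x v → 0# < x v
    positive {x} {v} x≥0 x≉0 = x≥0 v , ≉-sym x≉0

    Meeting : (Fin n → Set) → Space (Fin n)
    Meeting Q x = ∃ λ v → Q v × 0# < x v

    meeting-open : ∀ Q → Open (Meeting Q)
    meeting-open Q x (v , q , 0<x) = x v , 0<x , λ y near → v , q ,
      <-by (0<- (proj₁ (near v))) (solve 2 (λ x y → y :- :0 := (y :+ x) :- x) ≈-refl (x v) (y v))

    -- The points with mass on reachable vertices and those with mass on unreachable ones form two
    -- open sets covering `C`. They do not meet on `C`, since the vertices of one support have a
    -- common neighbour. As `x₀` lies in the first, the second contains no point of `C`.
    C⊆K : ∀ x → C x → ∣ K ∣ᶜ x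
    C⊆K x x∈ = x≥0 , Σx , proj₁ (neighbour {x} (C⊆X x∈)) , λ v x≉0 → proj₂ (neighbour {x} (C⊆X x∈)) v x≉0 ,
      byContradiction λ ¬reach → separated
        (proj₂ (proj₁ (proj₂ comp)) (Meeting Reach) (Meeting (λ v → ¬ Reach v)) (meeting-open _) (meeting-open _) cover
          (x₀ , x₀∈ , r , done , positive {x₀} (proj₁ (C⊆X {x₀} x₀∈)) r∈x₀)
          (x , x∈ , v , ¬reach , positive {x} x≥0 x≉0))
      where
      x≥0 = proj₁ (C⊆X x∈)
      Σx = proj₁ (proj₂ (C⊆X x∈))
      cover : ∀ {y} → C y → Meeting Reach y ⊎ Meeting (λ v → ¬ Reach v) y
      cover {y} y∈ with support-nonempty y (proj₁ (proj₂ (C⊆X y∈)))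
      ... | (v , y≉0) with dec {Reach v}
      ...   | yes reach = inj₁ (v , reach , positive {y} (proj₁ (C⊆X y∈)) y≉0)
      ...   | no ¬reach = inj₂ (v , ¬reach , positive {y} (proj₁ (C⊆X y∈)) y≉0)
      separated : (∃ λ y → C y × Meeting Reach y × Meeting (λ v → ¬ Reach v) y) → ⊥
      separated (y , y∈ , (u , reach , 0<u) , (v , ¬reach , 0<v)) =
        let (w , h) = neighbour {y} (C⊆X y∈)
        in ¬reach (reach ◅◅ ((w , h u (0<⇒≉0 0<u) , h v (0<⇒≉0 0<v)) then done))

    K⊆X : ∀ {x} → ∣ K ∣ᶜ x → ∥ 𝒩 G ∥ x
    K⊆X {x} (x≥0 , Σx , w , h) = x≥0 , Σx , toSubset (supp x) ,
      ((let (v , x≉0) = support-nonempty x Σx in v , ∈-toSubset {P = supp x} x≉0) , w ,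
       λ {v} v∈ → proj₁ (h v (∈-toSubset⁻¹ {P = supp x} v∈))) ,
      λ v v∉ → byContradiction λ x≉0 → v∉ (∈-toSubset {P = supp x} x≉0)

    supp-δ : ∀ {i j : Fin n} → supp (δ i) j → j ≡ i
    supp-δ ≉0 = byContradiction λ j≢i → ≉0 (δ-≢ j≢i)

    -- Any two points of K are joined by segments through vertices.
    module Separation {U V : Space (Fin n)} (openU : Open U) (openV : Open V)
      (cover : ∀ {x} → ∣ K ∣ᶜ x → U x ⊎ V x) (disjoint : ∀ x → ∣ K ∣ᶜ x → ¬ (U x × V x)) where

      along : ∀ {x y} → (∀ t → 0# ≤ t → t ≤ 1# → ∣ K ∣ᶜ (segment x y t)) → U x → U y
      along {x} {y} inside = segment-connected openU openV x y
        (λ t p q → cover (inside t p q)) (λ t p q → disjoint _ (inside t p q))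

      walk : ∀ {s t} → Reach s → Star Common s t → U (δ s) → U (δ t)
      walk reach done s∈U = s∈U
      walk {s} reach (_then_ {j = s′} (w , p , q) path) s∈U = walk reach′ path
        (along (segment∈ K {δ s} {δ s′} (0≤δ s) (sum-δ s) (0≤δ s′) (sum-δ s′)
          (w , λ i → [ (λ i∈ → at-vertex i∈ (p , reach)) , (λ i∈ → at-vertex i∈ (q , reach′)) ]′)) s∈U)
        where
        reach′ : Reach s′
        reach′ = reach ◅◅ ((w , p , q) then done)
        at-vertex : ∀ {i j} → supp (δ i) j → (i ~ w) × Reach i → (j ~ w) × Reach j
        at-vertex j∈ = subst (λ j → (j ~ w) × Reach j) (≡.sym (supp-δ j∈))

      spread : ∀ {a b} → ∣ K ∣ᶜ a → ∣ K ∣ᶜ b → U a → U b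
      spread {a} {b} (a≥0 , Σa , Fa) (b≥0 , Σb , Fb) a∈U =
        let (u , a≉0) = support-nonempty a Σa
            (v , b≉0) = support-nonempty b Σb
            u-reach = proj₂ (proj₂ Fa u a≉0)
            v-reach = proj₂ (proj₂ Fb v b≉0)
            from-a = along (segment∈ K {a} {δ u} a≥0 Σa (0≤δ u) (sum-δ u)
              (down K (λ i → [ id , (λ i∈ → subst (supp a) (≡.sym (supp-δ i∈)) a≉0) ]′) Fa)) a∈U
        in along (segment∈ K {δ v} {b} (0≤δ v) (sum-δ v) b≥0 Σb
             (down K (λ i → [ (λ i∈ → subst (supp b) (≡.sym (supp-δ i∈)) b≉0) , id ]′) Fb))
             (walk u-reach (reverse common-sym u-reach ◅◅ v-reach) from-a)

    K-connected : ConnectedSpace ∣ K ∣ᶜ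
    K-connected = (x₀ , C⊆K x₀ x₀∈) , λ U V openU openV cover (a , a∈ , a∈U) (b , b∈ , b∈V) →
      byContradiction λ disjoint → disjoint
        (b , b∈ , Separation.spread openU openV cover (λ x x∈ (p , q) → disjoint (x , x∈ , p , q)) a∈ b∈ a∈U , b∈V)

    K⊆C : ∀ x → ∣ K ∣ᶜ x → C x
    K⊆C x x∈ = proj₂ (proj₂ comp) ∣ K ∣ᶜ K-connected (λ {x} → C⊆K x) K⊆X x∈

    -- Invariance under `≋` is no part of being a component; it is inherited from the realization
    -- that `C` agrees with.
    C-saturated : Saturated C
    C-saturated {x} {y} x≋y x∈ = K⊆C y (∣∣-saturated K x≋y (C⊆K x x∈))

    r∈K : Face K (Pair r r)
    r∈K = let (w , h) = neighbour {x₀} (C⊆X x₀∈) in w , λ v v∈ → subst (λ u → (u ~ w) × Reach u) (≡.sym (pair-diag v v∈)) (h r r∈x₀ , done)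

    K-graph-connected : Connectedᶜ K r
    K-graph-connected P Pr closed v (_ , h) = walk done (proj₂ (h v (inj₁ refl))) Pr
      where
      walk : ∀ {s t} → Reach s → Star Common s t → P s → P t
      walk reach done Ps = Ps
      walk reach ((w , p , q) then rest) Ps = walk (reach ◅◅ ((w , p , q) then done)) rest
        (closed _ _ (w , λ { _ (inj₁ refl) → p , reach ; _ (inj₂ refl) → q , reach ◅◅ ((w , p , q) then done) }) Ps)

  wedge-saturated : ∀ k → Saturated (wedgeOfCircles k)
  wedge-saturated k {x} {y} x≋y (c , on , off) =
    c , ≈-trans (+-cong (*-cong (e 0F) (e 0F)) (*-cong (e 1F) (e 1F))) on ,
    λ c′ c′≢c i → ≈-trans (≈-sym (x≋y (c′ , i))) (off c′ c′≢c i)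
    where
    e : ∀ i → y (c , i) ≈ x (c , i)
    e i = ≈-sym (x≋y (c , i))

  component-type : (n : ℕ) (G : Graph n) → Connected G → maxDegree G ℕ.≤ 3 → ¬ (G ≅ K₄) → ¬ (G ≅ T) →
    (C : Space (Fin n)) → IsComponentOf C ∥ 𝒩 G ∥ → Contractible C ⊎ (∃ λ k → k ℕ.≥ 1 × C ≃ wedgeOfCircles k)
  component-type n G connected deg≤3 ≇K₄ ≇T C comp =
    let (L , K≃L , 1-dim , r∈L , conn) = Degree3.triangle-free G deg≤3 connected ≇K₄ ≇T _ K (ℕ.n<1+n _)
          (λ P (w , h) → w , λ v Pv → proj₁ (h v Pv) , tt) r∈K K-graph-connected
        (k , L≃rose) = Core.core L 1-dim r∈L conn
        K≃rose : K ≃ᶜ Rose.rose r k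
        K≃rose = K≃L ⟫ L≃rose
        C≃rose = ≃ᵗ-trans (uniform-Fin n) (uniform-Fin _) C-saturated (∣∣-saturated (Rose.rose r k))
          (≃ᵗ-ext C⊆K K⊆C) (equivalence K≃rose)
    in conclude k C≃rose
    where
    open Component G C comp
    conclude : ∀ k → C ≃ᵗ ∣ Rose.rose r k ∣ᶜ → Contractible C ⊎ (∃ λ k → k ℕ.≥ 1 × C ≃ wedgeOfCircles k)
    -- Without petals the rose is a point while the wedge of no circles is empty, so this case is
    -- the contractible one.
    conclude zero    e = inj₁ (≃ᵗ⇒≃ (≃ᵗ-trans (uniform-Fin n) (uniform-Fin 0) C-saturated (λ _ _ → tt) e (Rose.rose≃point r)))
    conclude (suc k) e = inj₂ (suc k , ℕ.s≤s ℕ.z≤n ,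
      ≃ᵗ⇒≃ (≃ᵗ-trans (uniform-Fin n) (uniform-× (uniform-Fin (suc k)) (uniform-Fin 2)) C-saturated
        (λ {x} {y} → wedge-saturated (suc k) {x} {y}) e (Rose.rose≃wedge r k)))

open import Data.Fin.Base using (Fin)
open import Data.Nat.Base using (ℕ; _≤_; _≥_)
open import Data.Product.Base using (∃; _×_)
open import Data.Sum.Base using (_⊎_)
open import Relation.Nullary.Negation using (¬_)

theorem2p1 :
    (∀ ℓ → ExcludedMiddle ℓ) →
    (𝓡 : RealField) →
    let open Topology 𝓡 in
    (n : ℕ) (G : Graph n) →
    Connected G →
    maxDegree G ≤ 3 →
    ¬ (G ≅ K₄) →
    ¬ (G ≅ T) →
    (C : Space (Fin n)) →
    IsComponentOf C ∥ 𝒩 G ∥ →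
    Contractible C ⊎ (∃ λ k → k ≥ 1 × C ≃ wedgeOfCircles k)
theorem2p1 = Proof.component-type
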